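{- Let $P$ be a quasi CW-poset and $K$ a field. The category $\mathrm{Sq}_PR$ of squarefree $P$-modules over $K$ is equivalent to the opposite of the category $\mathrm{Sh}\,P$ of sheaves of finite $K$-vector spaces on $P$: $$\mathrm{Sq}_PR\cong(\mathrm{Sh}\,P)^{\mathsf{op}} .$$
   Context: All posets are finite and have a minimal element $\hat 0$; $\widehat P=P\setminus\{\hat 0\}$, $\partial\sigma=\{\tau\in P:\tau<\sigma\}$; $\Delta_P$ is the simplicial complex of all chains of $\widehat P$ (including $\emptyset$). $P$ is a quasi CW-poset if for every $\sigma\in\widehat P$ the order complex $\Delta_{\partial\sigma}$ is Gorenstein* over $K$, i.e. for every face $F$ of $\Delta=\Delta_{\partial\sigma}$ (including $\emptyset$), $\tilde H_i(\mathrm{lk}_\Delta F;K)$ is $K$ for $i=\dim\Delta-|F|$ and $0$ otherwise. Let $R=K[x_\sigma:\sigma\in\widehat P]$ with the $\mathbb Z^{|\widehat P|}$-grading $\deg x_\sigma=\mathbf e_\sigma$ (unit vectors). For $\mathbf u=\sum u_\sigma\mathbf e_\sigma\in\mathbb N^{|\widehat P|}$ let $\operatorname{supp}(\mathbf u)=\{\sigma:u_\sigma\ne0\}$. A squarefree $P$-module over $K$ is a finitely generated $\mathbb N^{|\widehat P|}$-graded $R$-module $M$ such that (a) $M_{\mathbf u}=0$ whenever $\operatorname{supp}(\mathbf u)\notin\Delta_P$; (b) for $\mathbf u$ with $\operatorname{supp}(\mathbf u)\in\Delta_P$ nonempty and $\tau\in\widehat P$, the multiplication $\times x_\tau:M_{\mathbf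 u}\to M_{\mathbf u+\mathbf e_\tau}$ is bijective if $\operatorname{supp}(\mathbf u+\mathbf e_\tau)\in\Delta_P$ and $\tau\le\max(\operatorname{supp}(\mathbf u))$. $\mathrm{Sq}_PR$ is the full subcategory of the category of $\mathbb Z^{|\widehat P|}$-graded $R$-modules and degree-preserving $R$-homomorphisms whose objects are the squarefree $P$-modules. A sheaf $\mathcal F$ (of finite $K$-vector spaces) on $P$ consists of a finite-dimensional $K$-vector space $\mathcal F_\sigma$ for each $\sigma\in P$ and linear maps $\mathrm{res}^\sigma_\tau:\mathcal F_\sigma\to\mathcal F_\tau$ for all $\sigma>\tau$ in $P$ with $\mathrm{res}^\tau_\rho\circ\mathrm{res}^\sigma_\tau=\mathrm{res}^\sigma_\rho$ for all $\sigma>\tau>\rho$. A morphism of sheaves $\mathcal F\to\mathcal G$ is a family of linear maps $\mathcal F_\sigma\to\mathcal G_\sigma$ ($\sigma\in P$) commuting with the restriction maps. -}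

module Defs where

open import Algebra.Bundles using (CommutativeMonoid; CommutativeRing; Ring)
open import Algebra.Module.Bundles using (LeftModule)
import Algebra.Module.Construct.TensorUnit as TensorUnit
import Algebra.Module.Construct.Zero as ZeroModule
import Algebra.Module.Morphism.Construct.Composition as Composition
import Algebra.Module.Morphism.Construct.Identity as Identity
open import Algebra.Module.Morphism.Structures using (IsLeftModuleHomomorphism; IsLeftModuleIsomorphism)
import Algebra.Properties.CommutativeSemigroup as CommutativeSemigroupProperties
import Algebra.Properties.CommutativeMonoid.Sum as CommutativeMonoidSum
import Algebra.Properties.Group as GroupProperties
import Algebra.Properties.AbelianGroup as AbelianGroupProperties
import Algebra.Properties.Monoid.Sum as MonoidSum
import Algebra.Properties.Semiring.Sum as SemiringSum
import Algebra.Module.Properties.LeftModule as LeftModuleProperties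
open import Data.Bool.Base using (if_then_else_)
open import Data.Empty using (⊥-elim)
open import Data.Fin.Base using (Fin; zero; suc)
import Data.Fin.Properties as Fin
open import Data.Fin.Subset using (Subset; inside; outside; _∪_; _∩_; _⊆_; Empty; ∣_∣) renaming (_∈_ to _∈ˢ_; ⊥ to ∅ˢ)
import Data.Fin.Subset.Properties as Subset
open import Data.Integer.Base as ℤ using (ℤ; +_; 0ℤ; 1ℤ)
import Data.Integer.Properties as ℤ
open import Data.Nat.Base as ℕ using (ℕ)
open import Data.Product.Base using (Σ; Σ-syntax; ∃; ∃-syntax; _×_; _,_; proj₁; proj₂)
import Data.Product.Base as Product
open import Data.Sum.Base using (_⊎_)
import Data.Sum.Base as Sum
open import Data.Vec.Base using ([]; _∷_; _[_]≔_)
open import Function.Base using (_∘_; _on_; flip)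
open import Function.Bundles using (_↔_; Inverse)
open import Function.Definitions using (Bijective)
open import Level using (Level; _⊔_) renaming (suc to lsuc)
open import Relation.Binary.Bundles using (Setoid)
open import Relation.Binary.Core using (Rel)
open import Relation.Binary.Definitions using (Minimum; DecidableEquality)
open import Relation.Binary.PropositionalEquality as ≡ using (_≡_; _≢_; _≗_)
open import Relation.Binary.Structures using (IsEquivalence; IsPartialOrder)
import Relation.Binary.Construct.NonStrictToStrict as Strict
import Relation.Binary.Construct.On as On
import Relation.Binary.Reasoning.Setoid as SetoidReasoning
open import Relation.Nullary using (¬_; does)
open import Relation.Nullary.Decidable using (map′)
open import Relation.Unary using (Pred; _∈_)

private
  variable
    o o′ h h′ e e′ r ℓr m ℓm : Level

record Category (o h e : Level) : Set (lsuc (o ⊔ h ⊔ e)) where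
  infix  4 _≈_
  infixr 9 _⊚_
  field
    Obj           : Set o
    Hom           : Obj → Obj → Set h
    _≈_           : ∀ {A B} → Rel (Hom A B) e
    id            : ∀ {A} → Hom A A
    _⊚_           : ∀ {A B C} → Hom B C → Hom A B → Hom A C
    isEquivalence : ∀ {A B} → IsEquivalence (_≈_ {A} {B})
    ⊚-cong        : ∀ {A B C} {f f′ : Hom B C} {g g′ : Hom A B} →
                    f ≈ f′ → g ≈ g′ → f ⊚ g ≈ f′ ⊚ g′
    assoc         : ∀ {A B C D} (f : Hom C D) (g : Hom B C) (k : Hom A B) →
                    (f ⊚ g) ⊚ k ≈ f ⊚ (g ⊚ k)
    identityˡ     : ∀ {A B} (f : Hom A B) → id ⊚ f ≈ f
    identityʳ     : ∀ {A B} (f : Hom A B) → f ⊚ id ≈ f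

infix 10 _ᵒᵖ

_ᵒᵖ : Category o h e → Category o h e
C ᵒᵖ = record
  { Obj           = Obj
  ; Hom           = flip Hom
  ; _≈_           = _≈_
  ; id            = id
  ; _⊚_           = flip _⊚_
  ; isEquivalence = isEquivalence
  ; ⊚-cong        = flip ⊚-cong
  ; assoc         = λ f g k → IsEquivalence.sym isEquivalence (assoc k g f)
  ; identityˡ     = identityʳ
  ; identityʳ     = identityˡ
  }
  where open Category C

FullSubcategory : (C : Category o h e) → Pred (Category.Obj C) r → Category (o ⊔ r) h e
FullSubcategory C Q = record
  { Obj           = Σ Obj Q
  ; Hom           = Hom on proj₁
  ; _≈_           = _≈_
  ; id            = id
  ; _⊚_           = _⊚_
  ; isEquivalence = isEquivalence
  ; ⊚-cong        = ⊚-cong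
  ; assoc         = assoc
  ; identityˡ     = identityˡ
  ; identityʳ     = identityʳ
  }
  where open Category C

record Functor (C : Category o h e) (D : Category o′ h′ e′) :
               Set (o ⊔ h ⊔ e ⊔ o′ ⊔ h′ ⊔ e′) where
  private
    module C = Category C
    module D = Category D
  field
    F₀     : C.Obj → D.Obj
    F₁     : ∀ {A B} → C.Hom A B → D.Hom (F₀ A) (F₀ B)
    F-cong : ∀ {A B} {f g : C.Hom A B} → f C.≈ g → F₁ f D.≈ F₁ g
    F-id   : ∀ {A} → F₁ (C.id {A}) D.≈ D.id
    F-⊚    : ∀ {A B E} (f : C.Hom B E) (g : C.Hom A B) → F₁ (f C.⊚ g) D.≈ F₁ f D.⊚ F₁ g

Idᶠ : (C : Category o h e) → Functor C C
Idᶠ C = record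
  { F₀ = λ A → A ; F₁ = λ f → f ; F-cong = λ p → p ; F-id = refl ; F-⊚ = λ _ _ → refl }
  where
  open module E {A B} = IsEquivalence (Category.isEquivalence C {A} {B})

_∘ᶠ_ : ∀ {o″ h″ e″} {B : Category o h e} {C : Category o′ h′ e′} {D : Category o″ h″ e″} →
       Functor C D → Functor B C → Functor B D
_∘ᶠ_ {D = D} G F = record
  { F₀     = G.F₀ ∘ F.F₀
  ; F₁     = G.F₁ ∘ F.F₁
  ; F-cong = G.F-cong ∘ F.F-cong
  ; F-id   = trans (G.F-cong F.F-id) G.F-id
  ; F-⊚    = λ f g → trans (G.F-cong (F.F-⊚ f g)) (G.F-⊚ (F.F₁ f) (F.F₁ g))
  }
  where
  module F = Functor F
  module G = Functor G
  open module E {X Y} = IsEquivalence (Category.isEquivalence D {X} {Y})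

record NaturalIsomorphism {C : Category o h e} {D : Category o′ h′ e′}
                          (F G : Functor C D) : Set (o ⊔ h ⊔ h′ ⊔ e′) where
  private
    module C = Category C
    module D = Category D
    module F = Functor F
    module G = Functor G
  field
    to       : ∀ A → D.Hom (F.F₀ A) (G.F₀ A)
    from     : ∀ A → D.Hom (G.F₀ A) (F.F₀ A)
    inverseˡ : ∀ A → to A D.⊚ from A D.≈ D.id
    inverseʳ : ∀ A → from A D.⊚ to A D.≈ D.id
    natural  : ∀ {A B} (f : C.Hom A B) → to B D.⊚ F.F₁ f D.≈ G.F₁ f D.⊚ to A

infix 4 _≃ᶜ_

record _≃ᶜ_ (C : Category o h e) (D : Category o′ h′ e′) :
            Set (o ⊔ h ⊔ e ⊔ o′ ⊔ h′ ⊔ e′) where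
  field
    F  : Functor C D
    G  : Functor D C
    GF : NaturalIsomorphism (G ∘ᶠ F) (Idᶠ C)
    FG : NaturalIsomorphism (F ∘ᶠ G) (Idᶠ D)

-- The library has no discrete fields; `HeytingField` carries an apartness.
record Field ℓ : Set (lsuc ℓ) where
  field
    commutativeRing : CommutativeRing ℓ ℓ
  open CommutativeRing commutativeRing public
  field
    1≉0     : ¬ (1# ≈ 0#)
    inverse : ∀ x → ¬ (x ≈ 0#) → ∃[ y ] x * y ≈ 1#

module _ {R : Ring r ℓr} where

  open Ring R using (Carrier; 0#) renaming (_≈_ to _≈ᴿ_)

  record LinearMap {m₁ ℓm₁ m₂ ℓm₂} (V : LeftModule R m₁ ℓm₁) (W : LeftModule R m₂ ℓm₂) :
                   Set (r ⊔ m₁ ⊔ ℓm₁ ⊔ m₂ ⊔ ℓm₂) where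
    private
      module V = LeftModule V
      module W = LeftModule W
    field
      ⟦_⟧            : V.Carrierᴹ → W.Carrierᴹ
      isHomomorphism : IsLeftModuleHomomorphism V.rawLeftModule W.rawLeftModule ⟦_⟧
    open IsLeftModuleHomomorphism isHomomorphism public

  open LinearMap using (⟦_⟧)

  idₗ : {V : LeftModule R m ℓm} → LinearMap V V
  idₗ {V = V} = record
    { ⟦_⟧            = λ x → x
    ; isHomomorphism = Identity.isLeftModuleHomomorphism _ (LeftModule.≈ᴹ-refl V)
    }

  infixr 9 _∘ₗ_

  _∘ₗ_ : {U V W : LeftModule R m ℓm} → LinearMap V W → LinearMap U V → LinearMap U W
  _∘ₗ_ {W = W} f g = record
    { ⟦_⟧            = ⟦ f ⟧ ∘ ⟦ g ⟧
    ; isHomomorphism = Composition.isLeftModuleHomomorphism (LeftModule.≈ᴹ-trans W)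
                         (LinearMap.isHomomorphism g) (LinearMap.isHomomorphism f)
    }

  infix 4 _≅ₗ_

  _≅ₗ_ : LeftModule R m ℓm → LeftModule R o e → Set _
  V ≅ₗ W = ∃ (IsLeftModuleIsomorphism (LeftModule.rawLeftModule V) (LeftModule.rawLeftModule W))

  module _ (V : LeftModule R m ℓm) where
    open LeftModule V

    linearCombination : ∀ {n} → (Fin n → Carrier) → (Fin n → Carrierᴹ) → Carrierᴹ
    linearCombination c b = MonoidSum.sum +ᴹ-monoid (λ i → c i *ₗ b i)

    Spanning : ∀ {n} → Pred (Fin n → Carrierᴹ) _
    Spanning b = ∀ x → ∃[ c ] x ≈ᴹ linearCombination c b

    LinearlyIndependent : ∀ {n} → Pred (Fin n → Carrierᴹ) _
    LinearlyIndependent b = ∀ c → linearCombination c b ≈ᴹ 0ᴹ → ∀ i → c i ≈ᴿ 0#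

    FinitelyGenerated : Set _
    FinitelyGenerated = ∃[ n ] Σ[ b ∈ (Fin n → Carrierᴹ) ] Spanning b

    FiniteDimensional : Set _
    FiniteDimensional = ∃[ n ] Σ[ b ∈ (Fin n → Carrierᴹ) ] Spanning b × LinearlyIndependent b

    record IsSubmodule {q} (S : Pred Carrierᴹ q) : Set (r ⊔ m ⊔ ℓm ⊔ q) where
      field
        resp : ∀ {x y} → x ≈ᴹ y → x ∈ S → y ∈ S
        0∈   : 0ᴹ ∈ S
        +∈   : ∀ {x y} → x ∈ S → y ∈ S → x +ᴹ y ∈ S
        *∈   : ∀ a {x} → x ∈ S → a *ₗ x ∈ S

    -- S / T, for submodules S and T of V with T ⊆ S.  (T ⊆ S is not needed for
    -- the construction, which without it yields S / (S ∩ T).)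
    module _ {s t} {S : Pred Carrierᴹ s} {T : Pred Carrierᴹ t}
             (isS : IsSubmodule S) (isT : IsSubmodule T) where

      private
        module S = IsSubmodule isS
        module T = IsSubmodule isT
        open SetoidReasoning ≈ᴹ-setoid
        open LeftModuleProperties V using (inverseʳ-uniqueᴹ)
        open AbelianGroupProperties +ᴹ-abelianGroup using (⁻¹-∙-comm)
        open GroupProperties +ᴹ-group using (⁻¹-involutive)
        open CommutativeSemigroupProperties (CommutativeMonoid.commutativeSemigroup +ᴹ-commutativeMonoid)
          using (interchange)

        -1*≈- : ∀ x → (Ring.-_ R (Ring.1# R)) *ₗ x ≈ᴹ -ᴹ x
        -1*≈- x = inverseʳ-uniqueᴹ x _ (begin
          x +ᴹ (Ring.-_ R (Ring.1# R)) *ₗ x              ≈⟨ +ᴹ-congʳ (*ₗ-identityˡ x) ⟨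
          Ring.1# R *ₗ x +ᴹ (Ring.-_ R (Ring.1# R)) *ₗ x ≈⟨ *ₗ-distribʳ x _ _ ⟨
          (Ring._+_ R (Ring.1# R) (Ring.-_ R (Ring.1# R))) *ₗ x ≈⟨ *ₗ-congʳ (Ring.-‿inverseʳ R (Ring.1# R)) ⟩
          0# *ₗ x                                        ≈⟨ *ₗ-zeroˡ x ⟩
          0ᴹ                                             ∎)

        neg∈S : ∀ {x} → x ∈ S → -ᴹ x ∈ S
        neg∈S x∈ = S.resp (-1*≈- _) (S.*∈ _ x∈)

        neg∈T : ∀ {x} → x ∈ T → -ᴹ x ∈ T
        neg∈T x∈ = T.resp (-1*≈- _) (T.*∈ _ x∈)

        infix 4 _~_
        _~_ : Rel Carrierᴹ t
        x ~ y = x +ᴹ -ᴹ y ∈ T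

        ≈⇒~ : ∀ {x y} → x ≈ᴹ y → x ~ y
        ≈⇒~ {x} {y} x≈y = T.resp
          (≈ᴹ-sym (≈ᴹ-trans (+ᴹ-congʳ x≈y) (-ᴹ‿inverseʳ y))) T.0∈

        neg-diff : ∀ x y → -ᴹ (x +ᴹ -ᴹ y) ≈ᴹ y +ᴹ -ᴹ x
        neg-diff x y = begin
          -ᴹ (x +ᴹ -ᴹ y)      ≈⟨ ⁻¹-∙-comm x (-ᴹ y) ⟨
          -ᴹ x +ᴹ -ᴹ (-ᴹ y)   ≈⟨ +ᴹ-congˡ (⁻¹-involutive y) ⟩
          -ᴹ x +ᴹ y           ≈⟨ +ᴹ-comm _ _ ⟩
          y +ᴹ -ᴹ x           ∎

        ~-sym : ∀ {x y} → x ~ y → y ~ x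
        ~-sym p = T.resp (neg-diff _ _) (neg∈T p)

        ~-trans : ∀ {x y z} → x ~ y → y ~ z → x ~ z
        ~-trans {x} {y} {z} p q = T.resp (begin
          (x +ᴹ -ᴹ y) +ᴹ (y +ᴹ -ᴹ z)   ≈⟨ +ᴹ-assoc x (-ᴹ y) _ ⟩
          x +ᴹ (-ᴹ y +ᴹ (y +ᴹ -ᴹ z))   ≈⟨ +ᴹ-congˡ (+ᴹ-assoc (-ᴹ y) y (-ᴹ z)) ⟨
          x +ᴹ ((-ᴹ y +ᴹ y) +ᴹ -ᴹ z)   ≈⟨ +ᴹ-congˡ (+ᴹ-congʳ (-ᴹ‿inverseˡ y)) ⟩
          x +ᴹ (0ᴹ +ᴹ -ᴹ z)            ≈⟨ +ᴹ-congˡ (+ᴹ-identityˡ (-ᴹ z)) ⟩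
          x +ᴹ -ᴹ z                    ∎) (T.+∈ p q)

        +-cong~ : ∀ {x x′ y y′} → x ~ x′ → y ~ y′ → x +ᴹ y ~ x′ +ᴹ y′
        +-cong~ {x} {x′} {y} {y′} p q = T.resp (begin
          (x +ᴹ -ᴹ x′) +ᴹ (y +ᴹ -ᴹ y′)  ≈⟨ interchange x (-ᴹ x′) y (-ᴹ y′) ⟩
          (x +ᴹ y) +ᴹ (-ᴹ x′ +ᴹ -ᴹ y′)  ≈⟨ +ᴹ-congˡ (⁻¹-∙-comm x′ y′) ⟩
          (x +ᴹ y) +ᴹ -ᴹ (x′ +ᴹ y′)     ∎) (T.+∈ p q)

        neg-cong~ : ∀ {x y} → x ~ y → -ᴹ x ~ -ᴹ y
        neg-cong~ {x} {y} p = T.resp (≈ᴹ-sym (⁻¹-∙-comm x (-ᴹ y))) (neg∈T p)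

        *-neg : ∀ a x → a *ₗ (-ᴹ x) ≈ᴹ -ᴹ (a *ₗ x)
        *-neg a x = inverseʳ-uniqueᴹ (a *ₗ x) _ (begin
          a *ₗ x +ᴹ a *ₗ (-ᴹ x)  ≈⟨ *ₗ-distribˡ a x (-ᴹ x) ⟨
          a *ₗ (x +ᴹ -ᴹ x)       ≈⟨ *ₗ-congˡ (-ᴹ‿inverseʳ x) ⟩
          a *ₗ 0ᴹ                ≈⟨ *ₗ-zeroʳ a ⟩
          0ᴹ                     ∎)

        *-cong~ : ∀ {a b x y} → a ≈ᴿ b → x ~ y → a *ₗ x ~ b *ₗ y
        *-cong~ {a} {b} {x} {y} a≈b p = T.resp (begin
          a *ₗ (x +ᴹ -ᴹ y)         ≈⟨ *ₗ-distribˡ a x (-ᴹ y) ⟩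
          a *ₗ x +ᴹ a *ₗ (-ᴹ y)    ≈⟨ +ᴹ-congˡ (*-neg a y) ⟩
          a *ₗ x +ᴹ -ᴹ (a *ₗ y)    ≈⟨ +ᴹ-congˡ (-ᴹ‿cong (*ₗ-congʳ a≈b)) ⟩
          a *ₗ x +ᴹ -ᴹ (b *ₗ y)    ∎) (T.*∈ a p)

      subquotient : LeftModule R (m ⊔ s) t
      subquotient = record
        { Carrierᴹ = ∃ S
        ; _≈ᴹ_     = _~_ on proj₁
        ; _+ᴹ_     = λ (x , p) (y , q) → x +ᴹ y , S.+∈ p q
        ; _*ₗ_     = λ a (x , p) → a *ₗ x , S.*∈ a p
        ; 0ᴹ       = 0ᴹ , S.0∈
        ; -ᴹ_      = λ (x , p) → -ᴹ x , neg∈S p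
        ; isLeftModule = record
          { isLeftSemimodule = record
            { +ᴹ-isCommutativeMonoid = record
              { isMonoid = record
                { isSemigroup = record
                  { isMagma = record
                    { isEquivalence = record
                      { refl = ≈⇒~ ≈ᴹ-refl ; sym = ~-sym ; trans = ~-trans }
                    ; ∙-cong = +-cong~
                    }
                  ; assoc = λ _ _ _ → ≈⇒~ (+ᴹ-assoc _ _ _)
                  }
                ; identity = (λ _ → ≈⇒~ (+ᴹ-identityˡ _)) , (λ _ → ≈⇒~ (+ᴹ-identityʳ _))
                }
              ; comm = λ _ _ → ≈⇒~ (+ᴹ-comm _ _)
              }
            ; isPreleftSemimodule = record
              { *ₗ-cong      = *-cong~
              ; *ₗ-zeroˡ     = λ _ → ≈⇒~ (*ₗ-zeroˡ _)
              ; *ₗ-distribʳ  = λ _ _ _ → ≈⇒~ (*ₗ-distribʳ _ _ _)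
              ; *ₗ-identityˡ = λ _ → ≈⇒~ (*ₗ-identityˡ _)
              ; *ₗ-assoc     = λ _ _ _ → ≈⇒~ (*ₗ-assoc _ _ _)
              ; *ₗ-zeroʳ     = λ _ → ≈⇒~ (*ₗ-zeroʳ _)
              ; *ₗ-distribˡ  = λ _ _ _ → ≈⇒~ (*ₗ-distribˡ _ _ _)
              }
            }
          ; -ᴹ‿cong    = neg-cong~
          ; -ᴹ‿inverse = (λ _ → ≈⇒~ (-ᴹ‿inverseˡ _)) , (λ _ → ≈⇒~ (-ᴹ‿inverseʳ _))
          }
        }

  functionModule : ∀ {a} → Set a → LeftModule R m ℓm → LeftModule R (a ⊔ m) (a ⊔ ℓm)
  functionModule A V = record
    { Carrierᴹ = A → Carrierᴹ
    ; _≈ᴹ_     = λ f g → ∀ x → f x ≈ᴹ g x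
    ; _+ᴹ_     = λ f g x → f x +ᴹ g x
    ; _*ₗ_     = λ c f x → c *ₗ f x
    ; 0ᴹ       = λ _ → 0ᴹ
    ; -ᴹ_      = λ f x → -ᴹ f x
    ; isLeftModule = record
      { isLeftSemimodule = record
        { +ᴹ-isCommutativeMonoid = record
          { isMonoid = record
            { isSemigroup = record
              { isMagma = record
                { isEquivalence = record
                  { refl  = λ _ → ≈ᴹ-refl
                  ; sym   = λ p x → ≈ᴹ-sym (p x)
                  ; trans = λ p q x → ≈ᴹ-trans (p x) (q x)
                  }
                ; ∙-cong = λ p q x → +ᴹ-cong (p x) (q x)
                }
              ; assoc = λ _ _ _ _ → +ᴹ-assoc _ _ _
              }
            ; identity = (λ _ _ → +ᴹ-identityˡ _) , (λ _ _ → +ᴹ-identityʳ _)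
            }
          ; comm = λ _ _ _ → +ᴹ-comm _ _
          }
        ; isPreleftSemimodule = record
          { *ₗ-cong      = λ p q x → *ₗ-cong p (q x)
          ; *ₗ-zeroˡ     = λ _ _ → *ₗ-zeroˡ _
          ; *ₗ-distribʳ  = λ _ _ _ _ → *ₗ-distribʳ _ _ _
          ; *ₗ-identityˡ = λ _ _ → *ₗ-identityˡ _
          ; *ₗ-assoc     = λ _ _ _ _ → *ₗ-assoc _ _ _
          ; *ₗ-zeroʳ     = λ _ _ → *ₗ-zeroʳ _
          ; *ₗ-distribˡ  = λ _ _ _ _ → *ₗ-distribˡ _ _ _
          }
        }
      ; -ᴹ‿cong    = λ p x → -ᴹ‿cong (p x)
      ; -ᴹ‿inverse = (λ _ _ → -ᴹ‿inverseˡ _) , (λ _ _ → -ᴹ‿inverseʳ _)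
      }
    }
    where open LeftModule V

record SimplicialComplex (n : ℕ) ℓ : Set (lsuc ℓ) where
  field
    Face   : Pred (Subset n) ℓ
    ∅-face : ∅ˢ ∈ Face
    closed : ∀ {S T} → T ⊆ S → S ∈ Face → T ∈ Face

open SimplicialComplex

dim : ∀ {n} → Subset n → ℤ
dim S = + ∣ S ∣ ℤ.- 1ℤ

HasDimension : ∀ {n ℓ} → SimplicialComplex n ℓ → ℤ → Set ℓ
HasDimension Δ d = (∃[ S ] S ∈ Face Δ × dim S ≡ d) × (∀ S → S ∈ Face Δ → dim S ℤ.≤ d)

link : ∀ {n ℓ} (Δ : SimplicialComplex n ℓ) (F : Subset n) → F ∈ Face Δ → SimplicialComplex n ℓ
link Δ F F∈Δ = record
  { Face   = λ G → G ∪ F ∈ Face Δ × Empty (G ∩ F)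
  ; ∅-face = ≡.subst (Face Δ) (≡.sym (Subset.∪-identityˡ F)) F∈Δ
           , λ (_ , x∈) → Subset.∉⊥ (proj₁ (Subset.x∈p∩q⁻ ∅ˢ F x∈))
  ; closed = λ {S} {T} T⊆S (S∪F∈Δ , S∩F≡∅) →
      closed Δ (λ x∈ → Subset.x∈p∪q⁺ (Sum.map₁ T⊆S (Subset.x∈p∪q⁻ T F x∈))) S∪F∈Δ
    , λ (x , x∈) → S∩F≡∅ (x , Subset.x∈p∩q⁺ (Product.map₁ T⊆S (Subset.x∈p∩q⁻ T F x∈)))
  }

module _ {ℓ} (K : Field ℓ) where

  open Field K

  private
    ring-K : LeftModule ring ℓ ℓ
    ring-K = TensorUnit.leftModule

  -- The coefficient of T in the boundary of the oriented simplex T ∪ {v}: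
  -- (-1) to the number of w ∈ T with w < v, and 0 if v ∈ T.
  incidence : ∀ {n} → Subset n → Fin n → Carrier
  incidence (inside  ∷ T) zero    = 0#
  incidence (outside ∷ T) zero    = 1#
  incidence (inside  ∷ T) (suc v) = - incidence T v
  incidence (outside ∷ T) (suc v) = incidence T v

  module _ {n : ℕ} where

    open LeftModule (functionModule (Subset n) ring-K) using (_≈ᴹ_; 0ᴹ; _+ᴹ_; _*ₗ_)
    open MonoidSum +-monoid using (sum; sum-cong-≋)
    open CommutativeMonoidSum +-commutativeMonoid using (∑-distrib-+)
    open SemiringSum semiring using (*-distribˡ-sum)
    open CommutativeSemigroupProperties *-commutativeSemigroup using (x∙yz≈y∙xz)

    -- A chain is represented by its coefficients on the faces, each oriented by
    -- the order of Fin n.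
    ∂ᶜ : (Subset n → Carrier) → (Subset n → Carrier)
    ∂ᶜ c T = sum (λ v → incidence T v * c (T [ v ]≔ inside))

    private
      term : (Subset n → Carrier) → Subset n → Fin n → Carrier
      term c T v = incidence T v * c (T [ v ]≔ inside)

      ∂-cong : ∀ {c d} → c ≈ᴹ d → ∂ᶜ c ≈ᴹ ∂ᶜ d
      ∂-cong {c} {d} p T = sum-cong-≋ {n} {term c T} {term d T} (λ v → *-congˡ (p (T [ v ]≔ inside)))

      ∂-+ : ∀ c d → ∂ᶜ (c +ᴹ d) ≈ᴹ (∂ᶜ c +ᴹ ∂ᶜ d)
      ∂-+ c d T = trans
        (sum-cong-≋ {n} {term (c +ᴹ d) T} {λ v → term c T v + term d T v} (λ v → distribˡ _ _ _))
        (∑-distrib-+ (term c T) (term d T))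

      ∂-* : ∀ a c → ∂ᶜ (a *ₗ c) ≈ᴹ (a *ₗ ∂ᶜ c)
      ∂-* a c T = trans
        (sum-cong-≋ {n} {term (a *ₗ c) T} {λ v → a * term c T v} (λ v → x∙yz≈y∙xz _ _ _))
        (sym (*-distribˡ-sum a (term c T)))

      ∂-0 : ∂ᶜ 0ᴹ ≈ᴹ 0ᴹ
      ∂-0 T = trans
        (sum-cong-≋ {n} {term 0ᴹ T} {λ _ → 0# * 0#} (λ v → trans (zeroʳ _) (sym (zeroˡ 0#))))
        (trans (sym (*-distribˡ-sum {n} 0# (λ _ → 0#))) (zeroˡ _))

    module _ (Δ : SimplicialComplex n ℓ) (i : ℤ) where

      IsChain : Pred (Subset n → Carrier) ℓ
      IsChain c = ∀ S → ¬ (S ∈ Face Δ × dim S ≡ i) → c S ≈ 0#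

      IsCycle : Pred (Subset n → Carrier) ℓ
      IsCycle c = c ∈ IsChain × ∂ᶜ c ≈ᴹ 0ᴹ

    IsBoundary : SimplicialComplex n ℓ → ℤ → Pred (Subset n → Carrier) ℓ
    IsBoundary Δ i c = ∃[ b ] b ∈ IsChain Δ (ℤ.suc i) × c ≈ᴹ ∂ᶜ b

    module _ (Δ : SimplicialComplex n ℓ) (i : ℤ) where

      private
        0-chain : ∀ j → 0ᴹ ∈ IsChain Δ j
        0-chain j _ _ = refl

        +-chain : ∀ j {c d} → c ∈ IsChain Δ j → d ∈ IsChain Δ j → c +ᴹ d ∈ IsChain Δ j
        +-chain j p q S ∉ = trans (+-cong (p S ∉) (q S ∉)) (+-identityˡ 0#)

        *-chain : ∀ j a {c} → c ∈ IsChain Δ j → a *ₗ c ∈ IsChain Δ j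
        *-chain j a p S ∉ = trans (*-congˡ (p S ∉)) (zeroʳ a)

        cycles : IsSubmodule (functionModule (Subset n) ring-K) (IsCycle Δ i)
        cycles = record
          { resp = λ c≈d (p , q) →
                (λ S ∉ → trans (sym (c≈d S)) (p S ∉))
              , (λ T → trans (sym (∂-cong c≈d T)) (q T))
          ; 0∈   = 0-chain i , ∂-0
          ; +∈   = λ {c} {d} (p , q) (p′ , q′) → +-chain i p p′
              , (λ T → trans (∂-+ c d T) (trans (+-cong (q T) (q′ T)) (+-identityˡ 0#)))
          ; *∈   = λ a {c} (p , q) → *-chain i a p
              , (λ T → trans (∂-* a c T) (trans (*-congˡ (q T)) (zeroʳ a)))
          }

        boundaries : IsSubmodule (functionModule (Subset n) ring-K) (IsBoundary Δ i)
        boundaries = record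
          { resp = λ c≈d (b , p , q) → b , p , (λ T → trans (sym (c≈d T)) (q T))
          ; 0∈   = 0ᴹ , 0-chain _ , (λ T → sym (∂-0 T))
          ; +∈   = λ (b , p , q) (b′ , p′ , q′) → (b +ᴹ b′) , +-chain _ p p′
              , (λ T → trans (+-cong (q T) (q′ T)) (sym (∂-+ b b′ T)))
          ; *∈   = λ a (b , p , q) → (a *ₗ b) , *-chain _ a p
              , (λ T → trans (*-congˡ (q T)) (sym (∂-* a b T)))
          }

      H̃ : LeftModule ring ℓ ℓ
      H̃ = subquotient (functionModule (Subset n) ring-K) cycles boundaries

  GorensteinStar : ∀ {n} → SimplicialComplex n ℓ → Set ℓ
  GorensteinStar Δ = ∃[ d ] HasDimension Δ d × (∀ F (F∈Δ : F ∈ Face Δ) i →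
    (i ≡ d ℤ.- + ∣ F ∣ → H̃ (link Δ F F∈Δ) i ≅ₗ TensorUnit.leftModule {R = ring}) ×
    (i ≢ d ℤ.- + ∣ F ∣ → H̃ (link Δ F F∈Δ) i ≅ₗ ZeroModule.leftModule {ℓ} {ℓ} {R = ring}))

record FinitePoset ℓ : Set (lsuc ℓ) where
  infix 4 _≤_
  field
    Carrier        : Set ℓ
    _≤_            : Rel Carrier ℓ
    isPartialOrder : IsPartialOrder _≡_ _≤_
    size           : ℕ
    enumeration    : Fin size ↔ Carrier
    0̂              : Carrier
    minimum        : Minimum _≤_ 0̂

  open Strict _≡_ _≤_ public using (_<_)

  index : Carrier → Fin size
  index = Inverse.from enumeration

  infix 4 _≟_

  _≟_ : DecidableEquality Carrier
  σ ≟ τ = map′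
    (λ eq → ≡.trans (≡.sym (Inverse.strictlyInverseˡ enumeration σ))
              (≡.trans (≡.cong (Inverse.to enumeration) eq)
                (Inverse.strictlyInverseˡ enumeration τ)))
    (≡.cong index)
    (index σ Fin.≟ index τ)

  P̂ : Set ℓ
  P̂ = Σ[ σ ∈ Carrier ] σ ≢ 0̂

  ∂ : Carrier → Pred Carrier ℓ
  ∂ σ τ = τ < σ

  IsChainIn : ∀ {p q} → Pred Carrier p → Pred Carrier q → Set _
  IsChainIn Q S = (∀ {σ} → σ ∈ S → σ ∈ Q) × (∀ {σ τ} → σ ∈ S → τ ∈ S → σ ≤ τ ⊎ τ ≤ σ)

  -- Δ_Q, for a subposet Q with minimal element 0̂.
  orderComplex : Pred Carrier ℓ → SimplicialComplex size ℓ
  orderComplex Q = record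
    { Face   = λ S → IsChainIn (λ σ → σ ∈ Q × σ ≢ 0̂) (λ σ → index σ ∈ˢ S)
    ; ∅-face = (λ σ∈∅ → contra σ∈∅) , (λ σ∈∅ → contra σ∈∅)
    ; closed = λ T⊆S (p , q) → (λ σ∈T → p (T⊆S σ∈T)) , (λ σ∈T τ∈T → q (T⊆S σ∈T) (T⊆S τ∈T))
    }
    where
    contra : ∀ {a} {A : Set a} {x : Fin size} → x ∈ˢ ∅ˢ → A
    contra x∈ = ⊥-elim (Subset.∉⊥ x∈)

IsQuasiCW : ∀ {ℓ} → Field ℓ → FinitePoset ℓ → Set ℓ
IsQuasiCW K P = ∀ σ → σ ≢ 0̂ → GorensteinStar K (orderComplex (∂ σ))
  where open FinitePoset P

module _ {ℓ} (K : Field ℓ) (P : FinitePoset ℓ) where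

  private
    module K = Field K
    open FinitePoset P

  infix  4 _≈ᴿ_
  infixl 6 _+ᴿ_
  infixl 7 _*ᴿ_

  -- The polynomial ring K[x_σ : σ ∈ P̂], presented as the free commutative
  -- K-algebra on P̂: expressions modulo the congruence generated by the laws of
  -- commutative rings and by con being a ring homomorphism.
  data Polynomial : Set ℓ where
    con       : K.Carrier → Polynomial
    var       : P̂ → Polynomial
    _+ᴿ_ _*ᴿ_ : Polynomial → Polynomial → Polynomial
    -ᴿ_       : Polynomial → Polynomial

  data _≈ᴿ_ : Rel Polynomial ℓ where
    ≈ᴿ-refl     : ∀ {p} → p ≈ᴿ p
    ≈ᴿ-sym      : ∀ {p q} → p ≈ᴿ q → q ≈ᴿ p
    ≈ᴿ-trans    : ∀ {p q s} → p ≈ᴿ q → q ≈ᴿ s → p ≈ᴿ s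
    +-cong      : ∀ {p p′ q q′} → p ≈ᴿ p′ → q ≈ᴿ q′ → p +ᴿ q ≈ᴿ p′ +ᴿ q′
    *-cong      : ∀ {p p′ q q′} → p ≈ᴿ p′ → q ≈ᴿ q′ → p *ᴿ q ≈ᴿ p′ *ᴿ q′
    -‿cong      : ∀ {p q} → p ≈ᴿ q → -ᴿ p ≈ᴿ -ᴿ q
    +-assoc     : ∀ p q s → (p +ᴿ q) +ᴿ s ≈ᴿ p +ᴿ (q +ᴿ s)
    +-comm      : ∀ p q → p +ᴿ q ≈ᴿ q +ᴿ p
    +-identityˡ : ∀ p → con K.0# +ᴿ p ≈ᴿ p
    -‿inverseˡ  : ∀ p → -ᴿ p +ᴿ p ≈ᴿ con K.0#
    *-assoc     : ∀ p q s → (p *ᴿ q) *ᴿ s ≈ᴿ p *ᴿ (q *ᴿ s)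
    *-comm      : ∀ p q → p *ᴿ q ≈ᴿ q *ᴿ p
    *-identityˡ : ∀ p → con K.1# *ᴿ p ≈ᴿ p
    distribˡ    : ∀ p q s → p *ᴿ (q +ᴿ s) ≈ᴿ p *ᴿ q +ᴿ p *ᴿ s
    con-cong    : ∀ {a b} → a K.≈ b → con a ≈ᴿ con b
    con-+       : ∀ a b → con (a K.+ b) ≈ᴿ con a +ᴿ con b
    con-*       : ∀ a b → con (a K.* b) ≈ᴿ con a *ᴿ con b

  polynomialRing : CommutativeRing ℓ ℓ
  polynomialRing = record
    { Carrier = Polynomial
    ; _≈_     = _≈ᴿ_
    ; _+_     = _+ᴿ_
    ; _*_     = _*ᴿ_
    ; -_      = -ᴿ_
    ; 0#      = con K.0#
    ; 1#      = con K.1#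
    ; isCommutativeRing = record
      { isRing = record
        { +-isAbelianGroup = record
          { isGroup = record
            { isMonoid = record
              { isSemigroup = record
                { isMagma = record
                  { isEquivalence = record { refl = ≈ᴿ-refl ; sym = ≈ᴿ-sym ; trans = ≈ᴿ-trans }
                  ; ∙-cong        = +-cong
                  }
                ; assoc = +-assoc
                }
              ; identity = +-identityˡ , (λ p → ≈ᴿ-trans (+-comm p _) (+-identityˡ p))
              }
            ; inverse = -‿inverseˡ , (λ p → ≈ᴿ-trans (+-comm p _) (-‿inverseˡ p))
            ; ⁻¹-cong = -‿cong
            }
          ; comm = +-comm
          }
        ; *-cong     = *-cong
        ; *-assoc    = *-assoc
        ; *-identity = *-identityˡ , (λ p → ≈ᴿ-trans (*-comm p _) (*-identityˡ p))
        ; distrib    = distribˡ , (λ p q s → ≈ᴿ-trans (*-comm (q +ᴿ s) p)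
                         (≈ᴿ-trans (distribˡ p q s) (+-cong (*-comm p q) (*-comm p s))))
        }
      ; *-comm = *-comm
      }
    }

  R : Ring ℓ ℓ
  R = CommutativeRing.ring polynomialRing

  Degree : Set ℓ
  Degree = P̂ → ℤ

  ι : (P̂ → ℕ) → Degree
  ι u σ = + u σ

  unit : P̂ → P̂ → ℕ
  unit (τ , _) (σ , _) = if does (σ ≟ τ) then 1 else 0

  infixl 6 _⊞_ _⊕_

  _⊞_ : (P̂ → ℕ) → (P̂ → ℕ) → (P̂ → ℕ)
  (u ⊞ v) σ = u σ ℕ.+ v σ

  _⊕_ : Degree → Degree → Degree
  (u ⊕ v) σ = u σ ℤ.+ v σ

  -- `Homogeneous u` is the component R_u; these are the least subgroups that
  -- have K in degree 0 and x_σ in degree e_σ and are compatible with products.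
  data Homogeneous : Degree → Polynomial → Set ℓ where
    con  : ∀ a → Homogeneous (λ _ → 0ℤ) (con a)
    var  : ∀ σ → Homogeneous (ι (unit σ)) (var σ)
    zero : ∀ {u} → Homogeneous u (con K.0#)
    add  : ∀ {u p q} → Homogeneous u p → Homogeneous u q → Homogeneous u (p +ᴿ q)
    neg  : ∀ {u p} → Homogeneous u p → Homogeneous u (-ᴿ p)
    mul  : ∀ {u v p q} → Homogeneous u p → Homogeneous v q → Homogeneous (u ⊕ v) (p *ᴿ q)
    resp : ∀ {u v p q} → u ≗ v → p ≈ᴿ q → Homogeneous u p → Homogeneous v q

  -- `Component u` is M_u; `span` and `independent` say that M is the internal
  -- direct sum of the M_u.
  record GradedModule : Set (lsuc ℓ) where
    field
      leftModule : LeftModule R ℓ ℓ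
    open LeftModule leftModule public
    open MonoidSum +ᴹ-monoid public using (sum)
    field
      Component   : Degree → Pred Carrierᴹ ℓ
      ∈-resp      : ∀ {u v x y} → u ≗ v → x ≈ᴹ y → x ∈ Component u → y ∈ Component v
      0∈          : ∀ {u} → 0ᴹ ∈ Component u
      +∈          : ∀ {u x y} → x ∈ Component u → y ∈ Component u → x +ᴹ y ∈ Component u
      -∈          : ∀ {u x} → x ∈ Component u → -ᴹ x ∈ Component u
      *∈          : ∀ {u v p x} → p ∈ Homogeneous u → x ∈ Component v → p *ₗ x ∈ Component (u ⊕ v)
      span        : ∀ x → ∃[ n ] Σ[ d ∈ (Fin n → Degree) ] Σ[ y ∈ (Fin n → Carrierᴹ) ]
                    (∀ i → y i ∈ Component (d i)) × x ≈ᴹ sum y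
      independent : ∀ {n} (d : Fin n → Degree) (y : Fin n → Carrierᴹ) →
                    (∀ {i j} → d i ≗ d j → i ≡ j) →
                    (∀ i → y i ∈ Component (d i)) →
                    sum y ≈ᴹ 0ᴹ → ∀ i → y i ≈ᴹ 0ᴹ

  record GradedHom (M N : GradedModule) : Set ℓ where
    private
      module M = GradedModule M
      module N = GradedModule N
    field
      linearMap : LinearMap M.leftModule N.leftModule
    open LinearMap linearMap public
    field
      preserves : ∀ {u x} → x ∈ M.Component u → ⟦ x ⟧ ∈ N.Component u

  GrMod : Category (lsuc ℓ) ℓ ℓ
  GrMod = record
    { Obj           = GradedModule
    ; Hom           = GradedHom
    ; _≈_           = λ {_} {N} f g → ∀ x → GradedModule._≈ᴹ_ N (⟦ f ⟧ x) (⟦ g ⟧ x)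
    ; id            = record { linearMap = idₗ ; preserves = λ x∈ → x∈ }
    ; _⊚_           = λ f g → record
      { linearMap = linearMap f ∘ₗ linearMap g
      ; preserves = λ x∈ → preserves f (preserves g x∈)
      }
    ; isEquivalence = λ {_} {N} → let module N = GradedModule N in record
      { refl  = λ _ → N.≈ᴹ-refl
      ; sym   = λ p x → N.≈ᴹ-sym (p x)
      ; trans = λ p q x → N.≈ᴹ-trans (p x) (q x)
      }
    ; ⊚-cong        = λ {_} {_} {N} {f} {_} {_} {g′} p q x →
      GradedModule.≈ᴹ-trans N (⟦⟧-cong f (q x)) (p (⟦ g′ ⟧ x))
    ; assoc         = λ {_} {_} {_} {N} _ _ _ _ → GradedModule.≈ᴹ-refl N
    ; identityˡ     = λ {_} {N} _ _ → GradedModule.≈ᴹ-refl N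
    ; identityʳ     = λ {_} {N} _ _ → GradedModule.≈ᴹ-refl N
    }
    where open GradedHom

  supp : (P̂ → ℕ) → Pred Carrier ℓ
  supp u σ = Σ[ σ≢0̂ ∈ σ ≢ 0̂ ] u (σ , σ≢0̂) ≢ 0

  -- S ∈ Δ_P
  _∈Δ : Pred Carrier ℓ → Set ℓ
  S ∈Δ = IsChainIn (_≢ 0̂) S

  IsMaximum : Pred Carrier ℓ → Pred Carrier ℓ
  IsMaximum S ρ = ρ ∈ S × (∀ {σ} → σ ∈ S → σ ≤ ρ)

  module _ (M : GradedModule) where

    open GradedModule M

    ComponentSetoid : Degree → Setoid ℓ ℓ
    ComponentSetoid u = record
      { Carrier       = ∃ (Component u)
      ; _≈_           = _≈ᴹ_ on proj₁
      ; isEquivalence = On.isEquivalence proj₁ ≈ᴹ-isEquivalence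
      }

    multiplication : ∀ τ u → ∃ (Component (ι u)) → ∃ (Component (ι (u ⊞ unit τ)))
    multiplication τ u (x , x∈) =
      var τ *ₗ x , ∈-resp (λ σ → ℤ.+-comm (ι (unit τ) σ) (ι u σ)) ≈ᴹ-refl (*∈ (var τ) x∈)

    record IsSquarefree : Set ℓ where
      field
        finitelyGenerated : FinitelyGenerated leftModule
        ℕ-graded          : ∀ u → ¬ (∀ σ → 0ℤ ℤ.≤ u σ) → ∀ {x} → x ∈ Component u → x ≈ᴹ 0ᴹ
        vanishing         : ∀ u → ¬ (supp u ∈Δ) → ∀ {x} → x ∈ Component (ι u) → x ≈ᴹ 0ᴹ
        bijective         : ∀ u → supp u ∈Δ → ∀ ρ → IsMaximum (supp u) ρ →
                            ∀ τ → supp (u ⊞ unit τ) ∈Δ → proj₁ τ ≤ ρ →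
                            Bijective (Setoid._≈_ (ComponentSetoid (ι u)))
                                      (Setoid._≈_ (ComponentSetoid (ι (u ⊞ unit τ))))
                                      (multiplication τ u)

  Sq : Category (lsuc ℓ) ℓ ℓ
  Sq = FullSubcategory GrMod IsSquarefree

  -- Restriction maps are indexed by pairs τ < σ and not by proofs of τ < σ,
  -- whence the irrelevant arguments.
  record Sheaf : Set (lsuc ℓ) where
    field
      stalk             : Carrier → LeftModule K.ring ℓ ℓ
      finiteDimensional : ∀ σ → FiniteDimensional (stalk σ)
      res               : ∀ {σ τ} → .(τ < σ) → LinearMap (stalk σ) (stalk τ)
      res-∘             : ∀ {σ τ ρ} .(τ<σ : τ < σ) .(ρ<τ : ρ < τ) .(ρ<σ : ρ < σ) x →
                          LeftModule._≈ᴹ_ (stalk ρ)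
                            (LinearMap.⟦_⟧ (res ρ<τ) (LinearMap.⟦_⟧ (res τ<σ) x))
                            (LinearMap.⟦_⟧ (res ρ<σ) x)

  record SheafHom (F G : Sheaf) : Set ℓ where
    private
      module F = Sheaf F
      module G = Sheaf G
    field
      at      : ∀ σ → LinearMap (F.stalk σ) (G.stalk σ)
      natural : ∀ {σ τ} .(τ<σ : τ < σ) x →
                LeftModule._≈ᴹ_ (G.stalk τ)
                  (LinearMap.⟦_⟧ (at τ) (LinearMap.⟦_⟧ (F.res τ<σ) x))
                  (LinearMap.⟦_⟧ (G.res τ<σ) (LinearMap.⟦_⟧ (at σ) x))

  Sh : Category (lsuc ℓ) ℓ ℓ
  Sh = record
    { Obj           = Sheaf
    ; Hom           = SheafHom
    ; _≈_           = λ {_} {G} f g → ∀ σ x →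
      LeftModule._≈ᴹ_ (stalk G σ) (⟦ at f σ ⟧ x) (⟦ at g σ ⟧ x)
    ; id            = λ {F} → record
      { at = λ _ → idₗ ; natural = λ {_} {τ} _ _ → LeftModule.≈ᴹ-refl (stalk F τ) }
    ; _⊚_           = λ {_} {_} {H} f g → record
      { at      = λ σ → at f σ ∘ₗ at g σ
      ; natural = λ {σ} {τ} τ<σ x → LeftModule.≈ᴹ-trans (stalk H τ)
          (⟦⟧-cong (at f τ) (natural g τ<σ x)) (natural f τ<σ (⟦ at g σ ⟧ x))
      }
    ; isEquivalence = λ {_} {G} → record
      { refl  = λ σ _ → LeftModule.≈ᴹ-refl (stalk G σ)
      ; sym   = λ p σ x → LeftModule.≈ᴹ-sym (stalk G σ) (p σ x)
      ; trans = λ p q σ x → LeftModule.≈ᴹ-trans (stalk G σ) (p σ x) (q σ x)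
      }
    ; ⊚-cong        = λ {_} {_} {H} {f} {_} {_} {g′} p q σ x →
      LeftModule.≈ᴹ-trans (stalk H σ) (⟦⟧-cong (at f σ) (q σ x)) (p σ (⟦ at g′ σ ⟧ x))
    ; assoc         = λ {_} {_} {_} {H} _ _ _ σ _ → LeftModule.≈ᴹ-refl (stalk H σ)
    ; identityˡ     = λ {_} {G} _ σ _ → LeftModule.≈ᴹ-refl (stalk G σ)
    ; identityʳ     = λ {_} {G} _ σ _ → LeftModule.≈ᴹ-refl (stalk G σ)
    }
    where
    open Sheaf
    open SheafHom
    open LinearMap

{-# OPTIONS --safe #-}
-- For a squarefree module M and τ ≤ σ there is a map M_τ → M_σ between the components of degrees
-- e_τ and e_σ (with e_0̂ = 0), namely multiplication by x_σ followed by the inverse of multiplication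
-- by x_τ, and these maps form a covariant functor on P (a "cosheaf").  Conversely such a functor W
-- yields the squarefree module whose component of degree u is W at the top of the chain supp u.
-- More generally a homogeneous element of degree u maps to M_σ for every σ above the chain supp u,
-- bijectively if σ is the top of the chain, so that a squarefree module is recovered from its cosheaf.
-- The components M_σ are finite-dimensional because M is finitely generated and there is only one
-- monomial in each degree; dualising them turns cosheaves into sheaves.
module Submission where

open import Defs
open import Algebra.Bundles using (AbelianGroup; CommutativeMonoid; CommutativeRing; Ring)
open import Algebra.Module.Bundles using (LeftModule)
open import Algebra.Module.Bundles.Raw using (RawLeftModule)
import Algebra.Module.Construct.TensorUnit as TensorUnit
import Algebra.Module.Morphism.LeftModuleMonomorphism as LeftModuleMonomorphism
open import Algebra.Module.Morphism.Structures using (IsLeftModuleHomomorphism; IsLeftModuleMonomorphism)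
import Algebra.Module.Properties.LeftModule as LeftModuleProperties
open import Algebra.Module.Structures using (IsLeftModule)
import Algebra.Properties.CommutativeMonoid.Sum as CommutativeMonoidSum
import Algebra.Properties.CommutativeSemigroup as CommutativeSemigroupProperties
import Algebra.Properties.Group as GroupProperties
import Algebra.Properties.Monoid.Sum as MonoidSum
open import Axiom.ExcludedMiddle using (ExcludedMiddle)
open import Data.Bool.Base using (if_then_else_)
open import Data.Empty using (⊥-elim; ⊥-elim-irr)
open import Data.Fin.Base using (Fin; punchIn; punchOut; suc; zero)
import Data.Fin.Properties as Fin
open import Data.Integer.Base as ℤ using (+_; 0ℤ; ℤ; ∣_∣)
import Data.Integer.Properties as ℤ
open import Data.List.Base using (List; []; _++_; _∷_; allFin; concat; length; lookup; map; tabulate)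
open import Data.List.Membership.Propositional using () renaming (_∈_ to _∈ₗ_; _∉_ to _∉ₗ_)
open import Data.List.Membership.Propositional.Properties using (∈-allFin; ∈-concat⁺′; ∈-lookup; ∈-tabulate⁺)
open import Data.List.Relation.Unary.All as All using (All; []; _∷_)
open import Data.List.Relation.Unary.All.Properties using (¬Any⇒All¬)
open import Data.List.Relation.Unary.AllPairs using (AllPairs; []; _∷_)
open import Data.List.Relation.Unary.Any as Any using (Any; here; there)
open import Data.List.Relation.Unary.Any.Properties using (++⁺ʳ; ++⁺ˡ; lookup-index; map⁺)
open import Data.Nat.Base as ℕ using (suc; zero; ℕ)
import Data.Nat.Properties as ℕ
open import Data.Product.Base using (_,_; _×_; proj₁; proj₂; Σ-syntax; ∃; ∃-syntax)
open import Data.Sum.Base as Sum using (_⊎_; inj₁; inj₂)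
open import Data.Vec.Functional using (removeAt)
open import Function.Base using (_∘_)
open import Function.Bundles using (Inverse)
open import Function.Definitions using (Bijective; Surjective)
open import Level using (Level; _⊔_) renaming (suc to lsuc)
open import Relation.Binary.Bundles using (Setoid)
open import Relation.Binary.PropositionalEquality as ≡ using (_≗_; _≡_; _≢_)
import Relation.Binary.Reasoning.Setoid as SetoidReasoning
open import Relation.Binary.Structures using (IsEquivalence; IsPartialOrder)
open import Relation.Nullary using (Dec; does; no; yes; ¬_)
open import Relation.Nullary.Decidable using (dec-false; dec-true; decidable-stable; recompute)
open import Relation.Unary using (Pred; _∈_)

-- Condition (b) is silent in degree 0, and elsewhere it inverts x_τ only while the largest element
-- of the support stays the same. So inverse maps are never composed with one another: the image y
-- in M_σ of an element x of degree u is characterised by the equation x^u y = x_σ x (`IsLift`).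
-- Linearity, functoriality and naturality of the lifts then reduce to commuting monomials and
-- cancelling one of them, which `monomial-bijection` permits. Since `δ 0̂` is the zero exponent,
-- the part of degree 0 serves as the stalk at 0̂ and is treated almost uniformly with the others.
--
-- A second obstacle is that a graded module comes without projections onto its components: `span`
-- yields some sum of homogeneous terms in which degrees may repeat, while `independent` speaks
-- about distinct degrees only. Terms have to be regrouped by degree before the parts of an element
-- are well defined. Excluded middle decides equality of degrees, divisibility of monomials, bounds
-- of chains and linear independence.

private
  variable
    ℓ o h e o′ h′ e′ o″ h″ e″ r ℓr m ℓm m₁ ℓ₁ m₂ ℓ₂ s a : Level

-- Composition of equivalences of categories

module _ {B : Category o h e} {C : Category o′ h′ e′} {D : Category o″ h″ e″}
         (F : Functor B C) (G : Functor C B) (F′ : Functor C D) (G′ : Functor D C) where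

  private
    module B = Category B
    module F = Functor F
    module G = Functor G
    module F′ = Functor F′
    module G′ = Functor G′

    homSetoid : B.Obj → B.Obj → Setoid _ _
    homSetoid X Y = record { isEquivalence = B.isEquivalence {X} {Y} }

    open module E {X Y} = SetoidReasoning (homSetoid X Y)

  -- Whiskering: `β` taken at `F.F₀ A` and carried over by `G` removes the inner pair of functors,
  -- and `α` removes the outer one. Stated for one side only, it gives both halves of `≃ᶜ-trans` by
  -- exchanging the roles of the categories.
  conjugate : NaturalIsomorphism (G ∘ᶠ F) (Idᶠ B) → NaturalIsomorphism (G′ ∘ᶠ F′) (Idᶠ C) →
              NaturalIsomorphism ((G ∘ᶠ G′) ∘ᶠ (F′ ∘ᶠ F)) (Idᶠ B)
  conjugate α β = record
    { to       = λ A → α.to A B.⊚ G.F₁ (β.to (F.F₀ A))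
    ; from     = λ A → G.F₁ (β.from (F.F₀ A)) B.⊚ α.from A
    ; inverseˡ = λ A → begin
        (α.to A B.⊚ G.F₁ (β.to (F.F₀ A))) B.⊚ (G.F₁ (β.from (F.F₀ A)) B.⊚ α.from A)
          ≈⟨ B.assoc _ _ _ ⟩
        α.to A B.⊚ (G.F₁ (β.to (F.F₀ A)) B.⊚ (G.F₁ (β.from (F.F₀ A)) B.⊚ α.from A))
          ≈⟨ B.⊚-cong refl (cancel (β.inverseˡ (F.F₀ A))) ⟩
        α.to A B.⊚ α.from A
          ≈⟨ α.inverseˡ A ⟩
        B.id ∎
    ; inverseʳ = λ A → begin
        (G.F₁ (β.from (F.F₀ A)) B.⊚ α.from A) B.⊚ (α.to A B.⊚ G.F₁ (β.to (F.F₀ A)))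
          ≈⟨ B.assoc _ _ _ ⟩
        G.F₁ (β.from (F.F₀ A)) B.⊚ (α.from A B.⊚ (α.to A B.⊚ G.F₁ (β.to (F.F₀ A))))
          ≈⟨ B.⊚-cong refl (sym (B.assoc _ _ _)) ⟩
        G.F₁ (β.from (F.F₀ A)) B.⊚ ((α.from A B.⊚ α.to A) B.⊚ G.F₁ (β.to (F.F₀ A)))
          ≈⟨ B.⊚-cong refl (trans (B.⊚-cong (α.inverseʳ A) refl) (B.identityˡ _)) ⟩
        G.F₁ (β.from (F.F₀ A)) B.⊚ G.F₁ (β.to (F.F₀ A))
          ≈⟨ trans (sym (G.F-⊚ _ _)) (trans (G.F-cong (β.inverseʳ (F.F₀ A))) G.F-id) ⟩
        B.id ∎
    ; natural  = λ {X} {Y} f → begin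
        (α.to Y B.⊚ G.F₁ (β.to (F.F₀ Y))) B.⊚ G.F₁ (G′.F₁ (F′.F₁ (F.F₁ f)))
          ≈⟨ trans (B.assoc _ _ _) (B.⊚-cong refl (sym (G.F-⊚ _ _))) ⟩
        α.to Y B.⊚ G.F₁ (β.to (F.F₀ Y) C.⊚ G′.F₁ (F′.F₁ (F.F₁ f)))
          ≈⟨ B.⊚-cong refl (trans (G.F-cong (β.natural (F.F₁ f))) (G.F-⊚ _ _)) ⟩
        α.to Y B.⊚ (G.F₁ (F.F₁ f) B.⊚ G.F₁ (β.to (F.F₀ X)))
          ≈⟨ trans (sym (B.assoc _ _ _)) (trans (B.⊚-cong (α.natural f) refl) (B.assoc _ _ _)) ⟩
        f B.⊚ (α.to X B.⊚ G.F₁ (β.to (F.F₀ X))) ∎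
    }
    where
    module α = NaturalIsomorphism α
    module β = NaturalIsomorphism β
    module C = Category C
    open module E′ {X Y} = IsEquivalence (B.isEquivalence {X} {Y})
    cancel : ∀ {X Y Z} {f : C.Hom Y Z} {g : C.Hom Z Y} {k : B.Hom X (G.F₀ Z)} → f C.⊚ g C.≈ C.id →
             G.F₁ f B.⊚ (G.F₁ g B.⊚ k) B.≈ k
    cancel p = trans (sym (B.assoc _ _ _))
      (trans (B.⊚-cong (trans (sym (G.F-⊚ _ _)) (trans (G.F-cong p) G.F-id)) refl) (B.identityˡ _))

equivalence : {C : Category o h e} {D : Category o′ h′ e′} (F : Functor C D) (G : Functor D C) →
              NaturalIsomorphism (G ∘ᶠ F) (Idᶠ C) → NaturalIsomorphism (F ∘ᶠ G) (Idᶠ D) → C ≃ᶜ D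
equivalence F G GF FG = record { F = F ; G = G ; GF = GF ; FG = FG }

≃ᶜ-trans : {B : Category o h e} {C : Category o′ h′ e′} {D : Category o″ h″ e″} →
           B ≃ᶜ C → C ≃ᶜ D → B ≃ᶜ D
≃ᶜ-trans S T = record
  { F  = T.F ∘ᶠ S.F
  ; G  = S.G ∘ᶠ T.G
  ; GF = conjugate S.F S.G T.F T.G S.GF T.GF
  ; FG = conjugate T.G T.F S.G S.F T.FG S.FG
  }
  where
  module S = _≃ᶜ_ S
  module T = _≃ᶜ_ T

-- Linear algebra over a ring

module _ {A : Ring r ℓr} where

  private module A = Ring A

  module _ (V : LeftModule A m ℓm) where
    open LeftModule V
    open LeftModuleProperties V using (inverseʳ-uniqueᴹ)
    open SetoidReasoning ≈ᴹ-setoid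

    -- Allows negation to be implemented as scaling by -1, as is done for functionals and for
    -- sections.
    -1*≈-ᴹ : ∀ x → (A.- A.1#) *ₗ x ≈ᴹ -ᴹ x
    -1*≈-ᴹ x = inverseʳ-uniqueᴹ x _ (begin
      x +ᴹ (A.- A.1#) *ₗ x            ≈⟨ +ᴹ-congʳ (*ₗ-identityˡ x) ⟨
      A.1# *ₗ x +ᴹ (A.- A.1#) *ₗ x    ≈⟨ *ₗ-distribʳ x _ _ ⟨
      (A.1# A.+ (A.- A.1#)) *ₗ x      ≈⟨ *ₗ-congʳ (A.-‿inverseʳ A.1#) ⟩
      A.0# *ₗ x                       ≈⟨ *ₗ-zeroˡ x ⟩
      0ᴹ                              ∎)

  module _ {V : LeftModule A m₁ ℓ₁} {W : LeftModule A m₂ ℓ₂} where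
    private
      module V = LeftModule V
      module W = LeftModule W

    -- Zero and negatives are the multiples by 0 and -1, so the remaining homomorphism laws follow
    -- from additivity and homogeneity.
    linear : (f : V.Carrierᴹ → W.Carrierᴹ) →
             (∀ {x y} → x V.≈ᴹ y → f x W.≈ᴹ f y) →
             (∀ x y → f (x V.+ᴹ y) W.≈ᴹ f x W.+ᴹ f y) →
             (∀ a x → f (a V.*ₗ x) W.≈ᴹ a W.*ₗ f x) →
             LinearMap V W
    linear f f-cong f-+ f-* = record { ⟦_⟧ = f ; isHomomorphism = isHomomorphism }
      where
      abstract
        isHomomorphism : IsLeftModuleHomomorphism V.rawLeftModule W.rawLeftModule f
        isHomomorphism = record
          { +ᴹ-isGroupHomomorphism = record
            { isMonoidHomomorphism = record
              { isMagmaHomomorphism = record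
                { isRelHomomorphism = record { cong = f-cong }
                ; homo              = f-+
                }
              ; ε-homo = W.≈ᴹ-trans (f-cong (V.≈ᴹ-sym (V.*ₗ-zeroˡ V.0ᴹ)))
                           (W.≈ᴹ-trans (f-* A.0# V.0ᴹ) (W.*ₗ-zeroˡ _))
              }
            ; ⁻¹-homo = λ x → W.≈ᴹ-trans (f-cong (V.≈ᴹ-sym (-1*≈-ᴹ V x)))
                          (W.≈ᴹ-trans (f-* _ x) (-1*≈-ᴹ W (f x)))
            }
          ; *ₗ-homo = f-*
          }

    LinearMap-linearCombination : (f : LinearMap V W) → ∀ {n} (c : Fin n → A.Carrier) b →
      LinearMap.⟦_⟧ f (linearCombination V c b) W.≈ᴹ
      linearCombination W c (λ i → LinearMap.⟦_⟧ f (b i))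
    LinearMap-linearCombination f {zero}  c b = LinearMap.0ᴹ-homo f
    LinearMap-linearCombination f {suc n} c b = W.≈ᴹ-trans (LinearMap.+ᴹ-homo f _ _)
      (W.+ᴹ-cong (LinearMap.*ₗ-homo f _ _)
        (LinearMap-linearCombination f (λ i → c (suc i)) (λ i → b (suc i))))

  -- Equality on `C` is pulled back along `f`, so `f` is injective by definition and all module laws
  -- are inherited from `V`. This covers subspaces as well as spaces of functions with extra
  -- properties.
  module Induced (V : LeftModule A m ℓm) {C : Set a} (f : C → LeftModule.Carrierᴹ V) where
    open LeftModule V

    module _ (add : C → C → C) (mul : A.Carrier → C → C) (0ᶜ : C) (neg : C → C)
             (f-add : ∀ x y → f (add x y) ≈ᴹ f x +ᴹ f y) (f-mul : ∀ c x → f (mul c x) ≈ᴹ c *ₗ f x)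
             (f-0 : f 0ᶜ ≈ᴹ 0ᴹ) (f-neg : ∀ x → f (neg x) ≈ᴹ -ᴹ f x) where

      private
        raw : RawLeftModule A.Carrier a ℓm
        raw = record
          { Carrierᴹ = C ; _≈ᴹ_ = λ x y → f x ≈ᴹ f y
          ; _+ᴹ_ = add ; _*ₗ_ = mul ; 0ᴹ = 0ᶜ ; -ᴹ_ = neg }

        mono : IsLeftModuleMonomorphism raw rawLeftModule f
        mono = record
          { isLeftModuleHomomorphism = record
            { +ᴹ-isGroupHomomorphism = record
              { isMonoidHomomorphism = record
                { isMagmaHomomorphism = record
                  { isRelHomomorphism = record { cong = λ p → p } ; homo = f-add }
                ; ε-homo = f-0
                }
              ; ⁻¹-homo = f-neg
              }
            ; *ₗ-homo = f-mul
            }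
          ; injective = λ p → p
          }

        abstract
          isLeftModule′ : IsLeftModule A (λ x y → f x ≈ᴹ f y) add 0ᶜ neg mul
          isLeftModule′ = LeftModuleMonomorphism.isLeftModule mono A.isRing isLeftModule

      induced : LeftModule A a ℓm
      induced = record { isLeftModule = isLeftModule′ }

  open Induced public using (induced)

  ΠModule : {I : Set a} → (I → LeftModule A m ℓm) → LeftModule A (a ⊔ m) (a ⊔ ℓm)
  ΠModule {I = I} V = record
    { Carrierᴹ = ∀ i → V.Carrierᴹ i
    ; _≈ᴹ_     = λ f g → ∀ x → V._≈ᴹ_ x (f x) (g x)
    ; _+ᴹ_     = λ f g x → V._+ᴹ_ x (f x) (g x)
    ; _*ₗ_     = λ c f x → V._*ₗ_ x c (f x)
    ; 0ᴹ       = λ x → V.0ᴹ x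
    ; -ᴹ_      = λ f x → V.-ᴹ_ x (f x)
    ; isLeftModule = record
      { isLeftSemimodule = record
        { +ᴹ-isCommutativeMonoid = record
          { isMonoid = record
            { isSemigroup = record
              { isMagma = record
                { isEquivalence = record
                  { refl  = λ x → V.≈ᴹ-refl x
                  ; sym   = λ p x → V.≈ᴹ-sym x (p x)
                  ; trans = λ p q x → V.≈ᴹ-trans x (p x) (q x)
                  }
                ; ∙-cong = λ p q x → V.+ᴹ-cong x (p x) (q x)
                }
              ; assoc = λ _ _ _ x → V.+ᴹ-assoc x _ _ _
              }
            ; identity = (λ _ x → V.+ᴹ-identityˡ x _) , (λ _ x → V.+ᴹ-identityʳ x _)
            }
          ; comm = λ _ _ x → V.+ᴹ-comm x _ _
          }
        ; isPreleftSemimodule = record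
          { *ₗ-cong      = λ p q x → V.*ₗ-cong x p (q x)
          ; *ₗ-zeroˡ     = λ _ x → V.*ₗ-zeroˡ x _
          ; *ₗ-distribʳ  = λ _ _ _ x → V.*ₗ-distribʳ x _ _ _
          ; *ₗ-identityˡ = λ _ x → V.*ₗ-identityˡ x _
          ; *ₗ-assoc     = λ _ _ _ x → V.*ₗ-assoc x _ _ _
          ; *ₗ-zeroʳ     = λ _ x → V.*ₗ-zeroʳ x _
          ; *ₗ-distribˡ  = λ _ _ _ x → V.*ₗ-distribˡ x _ _ _
          }
        }
      ; -ᴹ‿cong    = λ p x → V.-ᴹ‿cong x (p x)
      ; -ᴹ‿inverse = (λ _ x → V.-ᴹ‿inverseˡ x _) , (λ _ x → V.-ᴹ‿inverseʳ x _)
      }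
    }
    where module V i = LeftModule (V i)

  module _ (V : LeftModule A m ℓm) where
    open LeftModule V
    open CommutativeMonoidSum +ᴹ-commutativeMonoid
    open SetoidReasoning ≈ᴹ-setoid

    submodule-∋-linearCombination : ∀ {S : Pred Carrierᴹ s} → IsSubmodule V S →
      ∀ {n} (c : Fin n → A.Carrier) {b} → (∀ i → b i ∈ S) → linearCombination V c b ∈ S
    submodule-∋-linearCombination isS {zero}  c b∈ = IsSubmodule.0∈ isS
    submodule-∋-linearCombination isS {suc n} c b∈ = IsSubmodule.+∈ isS
      (IsSubmodule.*∈ isS _ (b∈ zero))
      (submodule-∋-linearCombination isS (λ i → c (suc i)) (λ i → b∈ (suc i)))

    sum-zero : ∀ {n} (t : Fin n → Carrierᴹ) → (∀ i → t i ≈ᴹ 0ᴹ) → sum t ≈ᴹ 0ᴹ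
    sum-zero {n} t t≈0 = ≈ᴹ-trans (sum-cong-≋ {n} t≈0) (sum-replicate-zero n)

    sum-single : ∀ {n} (t : Fin n → Carrierᴹ) j → (∀ i → i ≢ j → t i ≈ᴹ 0ᴹ) → sum t ≈ᴹ t j
    sum-single {suc n} t j t≈0 = begin
      sum t                         ≈⟨ sum-remove {i = j} t ⟩
      t j +ᴹ sum (removeAt t j)     ≈⟨ +ᴹ-congˡ (sum-zero _ (λ i → t≈0 (punchIn j i) (Fin.punchInᵢ≢i j i))) ⟩
      t j +ᴹ 0ᴹ                     ≈⟨ +ᴹ-identityʳ _ ⟩
      t j                           ∎

    linearCombination-+ : ∀ {n} c d (b : Fin n → Carrierᴹ) →
      linearCombination V (λ i → c i A.+ d i) b ≈ᴹ linearCombination V c b +ᴹ linearCombination V d b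
    linearCombination-+ {n} c d b = ≈ᴹ-trans (sum-cong-≋ {n} (λ i → *ₗ-distribʳ _ _ _)) (∑-distrib-+ (λ i → c i *ₗ b i) (λ i → d i *ₗ b i))

    linearCombination-* : ∀ {n} a c (b : Fin n → Carrierᴹ) →
      linearCombination V (λ i → a A.* c i) b ≈ᴹ a *ₗ linearCombination V c b
    linearCombination-* {zero}  a c b = ≈ᴹ-sym (*ₗ-zeroʳ a)
    linearCombination-* {suc n} a c b = ≈ᴹ-trans
      (+ᴹ-cong (*ₗ-assoc _ _ _) (linearCombination-* a (λ i → c (suc i)) (λ i → b (suc i))))
      (≈ᴹ-sym (*ₗ-distribˡ _ _ _))

    InSpan : ∀ {n} → (Fin n → Carrierᴹ) → Pred Carrierᴹ _
    InSpan b x = ∃[ c ] x ≈ᴹ linearCombination V c b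

    InSpan-isSubmodule : ∀ {n} (b : Fin n → Carrierᴹ) → IsSubmodule V (InSpan b)
    InSpan-isSubmodule b = record
      { resp = λ x≈y (c , p) → c , ≈ᴹ-trans (≈ᴹ-sym x≈y) p
      ; 0∈   = (λ _ → A.0#) , ≈ᴹ-sym (sum-zero (λ i → A.0# *ₗ b i) (λ i → *ₗ-zeroˡ (b i)))
      ; +∈   = λ (c , p) (d , q) → (λ i → c i A.+ d i) ,
                 ≈ᴹ-trans (+ᴹ-cong p q) (≈ᴹ-sym (linearCombination-+ c d b))
      ; *∈   = λ a (c , p) → (λ i → a A.* c i) ,
                 ≈ᴹ-trans (*ₗ-congˡ p) (≈ᴹ-sym (linearCombination-* a c b))
      }

    indicator : ∀ {n} → Fin n → Fin n → A.Carrier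
    indicator i j with i Fin.≟ j
    ... | yes _ = A.1#
    ... | no  _ = A.0#

    indicator-diag : ∀ {n} (i : Fin n) → indicator i i A.≈ A.1#
    indicator-diag i with i Fin.≟ i
    ... | yes _  = A.refl
    ... | no i≢i = ⊥-elim (i≢i ≡.refl)

    indicator-off : ∀ {n} (i j : Fin n) → i ≢ j → indicator i j A.≈ A.0#
    indicator-off i j i≢j with i Fin.≟ j
    ... | yes i≡j = ⊥-elim (i≢j i≡j)
    ... | no _    = A.refl

    linearCombination-indicator : ∀ {n} i (b : Fin n → Carrierᴹ) → linearCombination V (indicator i) b ≈ᴹ b i
    linearCombination-indicator i b = begin
      linearCombination V (indicator i) b ≈⟨ sum-single _ i (λ j j≢i → ≈ᴹ-trans (*ₗ-congʳ (indicator-off i j (λ eq → j≢i (≡.sym eq)))) (*ₗ-zeroˡ _)) ⟩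
      indicator i i *ₗ b i                ≈⟨ *ₗ-congʳ (indicator-diag i) ⟩
      A.1# *ₗ b i                         ≈⟨ *ₗ-identityˡ _ ⟩
      b i                                 ∎

    ∈-InSpan : ∀ {n} (b : Fin n → Carrierᴹ) i → b i ∈ InSpan b
    ∈-InSpan b i = indicator i , ≈ᴹ-sym (linearCombination-indicator i b)

    InSpan-trans : ∀ {n n′} {b : Fin n → Carrierᴹ} {b′ : Fin n′ → Carrierᴹ} →
                   (∀ i → b i ∈ InSpan b′) → ∀ {x} → x ∈ InSpan b → x ∈ InSpan b′
    InSpan-trans {b′ = b′} b⊆ (c , p) = IsSubmodule.resp isB (≈ᴹ-sym p) (submodule-∋-linearCombination isB c b⊆)
      where isB = InSpan-isSubmodule b′

  -- Each law for the right inverse is checked after applying the injective map `f`.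
  linear⁻¹ : {V : LeftModule A m₁ ℓ₁} {W : LeftModule A m₂ ℓ₂} (f : LinearMap V W) →
             let open LeftModule V using () renaming (Carrierᴹ to |V|; _≈ᴹ_ to _≈ⱽ_)
                 open LeftModule W using () renaming (Carrierᴹ to |W|; _≈ᴹ_ to _≈ᵂ_)
                 open LinearMap f using (⟦_⟧) in
             (∀ {x y} → ⟦ x ⟧ ≈ᵂ ⟦ y ⟧ → x ≈ⱽ y) →
             (f⁻¹ : |W| → |V|) → (∀ y → ⟦ f⁻¹ y ⟧ ≈ᵂ y) →
             LinearMap W V
  linear⁻¹ {W = W} f f-inj f⁻¹ f∘f⁻¹ = linear f⁻¹
    (λ {x} {y} x≈y → f-inj (trans (f∘f⁻¹ x) (trans x≈y (sym (f∘f⁻¹ y)))))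
    (λ x y → f-inj (trans (f∘f⁻¹ _) (sym (trans (LinearMap.+ᴹ-homo f _ _) (+ᴹ-cong (f∘f⁻¹ x) (f∘f⁻¹ y))))))
    (λ a x → f-inj (trans (f∘f⁻¹ _) (sym (trans (LinearMap.*ₗ-homo f _ _) (*ₗ-congˡ (f∘f⁻¹ x))))))
    where open LeftModule W using (+ᴹ-cong; *ₗ-congˡ) renaming (≈ᴹ-trans to trans; ≈ᴹ-sym to sym)

-- Finite-dimensional vector spaces and their biduals

module _ (K : Field ℓ) where

  private module K = Field K

  scalars : LeftModule K.ring ℓ ℓ
  scalars = TensorUnit.leftModule

  -- Induction on the number of generators: if they are dependent, a relation with a nonzero
  -- coefficient expresses one of them by the others, and that one is dropped.
  spanning⇒finiteDimensional : ExcludedMiddle ℓ → (V : LeftModule K.ring ℓ ℓ) →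
    ∀ n (b : Fin n → LeftModule.Carrierᴹ V) → Spanning V b → FiniteDimensional V
  spanning⇒finiteDimensional em V zero    b b-spans = zero , b , b-spans , (λ _ _ ())
  spanning⇒finiteDimensional em V (suc n) b b-spans with em {LinearlyIndependent V b}
  ... | yes b-indep = suc n , b , b-spans , b-indep
  ... | no ¬b-indep = spanning⇒finiteDimensional em V n (removeAt b i)
                        (λ x → InSpan-trans V (λ j → b∈ j (i Fin.≟ j)) (b-spans x))
    where
    open LeftModule V
    open CommutativeMonoidSum +ᴹ-commutativeMonoid using (sum-remove)

    dependence : ∃[ c ] linearCombination V c b ≈ᴹ 0ᴹ × ∃[ i ] ¬ (c i K.≈ K.0#)
    dependence = decidable-stable em λ ¬dep → ¬b-indep λ c p i → decidable-stable em λ c≉0 → ¬dep (c , p , i , c≉0)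

    c = proj₁ dependence
    i = proj₁ (proj₂ (proj₂ dependence))
    1/cᵢ = K.inverse (c i) (proj₂ (proj₂ (proj₂ dependence)))

    module Span = IsSubmodule (InSpan-isSubmodule V (removeAt b i))

    -- The relation says that `c i *ₗ b i` is minus the combination of the other generators; `b∈`
    -- then divides by `c i`.
    cᵢbᵢ∈ : InSpan V (removeAt b i) (c i *ₗ b i)
    cᵢbᵢ∈ = Span.resp (≈ᴹ-trans (-1*≈-ᴹ V _) (≈ᴹ-sym (LeftModuleProperties.inverseˡ-uniqueᴹ V _ _
        (≈ᴹ-trans (≈ᴹ-sym (sum-remove {i = i} (λ k → c k *ₗ b k))) (proj₁ (proj₂ dependence))))))
      (Span.*∈ (K.- K.1#) ((λ j → c (punchIn i j)) , ≈ᴹ-refl))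

    b∈ : ∀ j → Dec (i ≡ j) → InSpan V (removeAt b i) (b j)
    b∈ j (yes ≡.refl) = Span.resp
      (≈ᴹ-trans (≈ᴹ-sym (*ₗ-assoc _ _ _)) (≈ᴹ-trans (*ₗ-congʳ (K.trans (K.*-comm _ _) (proj₂ 1/cᵢ))) (*ₗ-identityˡ _)))
      (Span.*∈ (proj₁ 1/cᵢ) cᵢbᵢ∈)
    b∈ j (no i≢j) = ≡.subst (λ k → InSpan V (removeAt b i) (b k)) (Fin.punchIn-punchOut i≢j)
      (∈-InSpan V (removeAt b i) (punchOut i≢j))

  module _ (V : LeftModule K.ring ℓ ℓ) where

    open LeftModule V
    open LinearMap using (⟦_⟧; ⟦⟧-cong; +ᴹ-homo; *ₗ-homo)
    open CommutativeSemigroupProperties K.*-commutativeSemigroup using (x∙yz≈y∙xz)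
    open CommutativeSemigroupProperties (CommutativeMonoid.commutativeSemigroup K.+-commutativeMonoid)
      using (interchange)

    private
      Functional : Set ℓ
      Functional = LinearMap V scalars

      IsFunctional : (Carrierᴹ → K.Carrier) → Set ℓ
      IsFunctional = IsLeftModuleHomomorphism rawLeftModule (LeftModule.rawLeftModule scalars)

      abstract
        +-isFunctional : ∀ (f g : Functional) → IsFunctional (λ x → ⟦ f ⟧ x K.+ ⟦ g ⟧ x)
        +-isFunctional f g = LinearMap.isHomomorphism (linear {V = V} {W = scalars} _
          (λ p → K.+-cong (⟦⟧-cong f p) (⟦⟧-cong g p))
          (λ x y → K.trans (K.+-cong (+ᴹ-homo f x y) (+ᴹ-homo g x y)) (interchange _ _ _ _))
          (λ a x → K.trans (K.+-cong (*ₗ-homo f a x) (*ₗ-homo g a x)) (K.sym (K.distribˡ _ _ _))))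

        *-isFunctional : ∀ c (f : Functional) → IsFunctional (λ x → c K.* ⟦ f ⟧ x)
        *-isFunctional c f = LinearMap.isHomomorphism (linear {V = V} {W = scalars} _
          (λ p → K.*-congˡ (⟦⟧-cong f p))
          (λ x y → K.trans (K.*-congˡ (+ᴹ-homo f x y)) (K.distribˡ _ _ _))
          (λ a x → K.trans (K.*-congˡ (*ₗ-homo f a x)) (x∙yz≈y∙xz _ _ _)))

        0-isFunctional : IsFunctional (λ _ → K.0#)
        0-isFunctional = LinearMap.isHomomorphism (linear {V = V} {W = scalars} _
          (λ _ → K.refl) (λ _ _ → K.sym (K.+-identityˡ _)) (λ _ _ → K.sym (K.zeroʳ _)))

      plus : Functional → Functional → Functional
      plus f g = record { ⟦_⟧ = λ x → ⟦ f ⟧ x K.+ ⟦ g ⟧ x ; isHomomorphism = +-isFunctional f g }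

      times : K.Carrier → Functional → Functional
      times c f = record { ⟦_⟧ = λ x → c K.* ⟦ f ⟧ x ; isHomomorphism = *-isFunctional c f }

      zeroMap : Functional
      zeroMap = record { ⟦_⟧ = λ _ → K.0# ; isHomomorphism = 0-isFunctional }

      abstract
        isDual : IsLeftModule K.ring (λ f g → ∀ x → ⟦ f ⟧ x K.≈ ⟦ g ⟧ x) plus zeroMap (times (K.- K.1#)) times
        isDual = LeftModule.isLeftModule (induced (functionModule Carrierᴹ scalars) {C = Functional} ⟦_⟧
          plus times zeroMap (times (K.- K.1#)) (λ _ _ _ → K.refl) (λ _ _ _ → K.refl) (λ _ → K.refl)
          (λ f x → -1*≈-ᴹ scalars (⟦ f ⟧ x)))

    Dual : LeftModule K.ring ℓ ℓ
    Dual = record { isLeftModule = isDual }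

  module _ {V : LeftModule K.ring ℓ ℓ} where
    open LeftModule V
    open LinearMap using (⟦_⟧; ⟦⟧-cong; +ᴹ-homo; *ₗ-homo)

    evaluate : Carrierᴹ → LinearMap (Dual V) scalars
    evaluate x = linear (λ f → ⟦ f ⟧ x) (λ p → p x) (λ _ _ → K.refl) (λ _ _ → K.refl)

    toBidual : LinearMap V (Dual (Dual V))
    toBidual = linear evaluate (λ p f → ⟦⟧-cong f p) (λ x y f → +ᴹ-homo f x y) (λ a x f → *ₗ-homo f a x)

  module _ {V W : LeftModule K.ring ℓ ℓ} (f : LinearMap V W) where
    private
      abstract
        transpose-isHomomorphism : IsLeftModuleHomomorphism (LeftModule.rawLeftModule (Dual W)) (LeftModule.rawLeftModule (Dual V)) (_∘ₗ f)
        transpose-isHomomorphism = LinearMap.isHomomorphism (linear {V = Dual W} {W = Dual V} (_∘ₗ f)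
          (λ p x → p (LinearMap.⟦_⟧ f x)) (λ _ _ _ → K.refl) (λ _ _ _ → K.refl))

    transpose : LinearMap (Dual W) (Dual V)
    transpose = record { ⟦_⟧ = _∘ₗ f ; isHomomorphism = transpose-isHomomorphism }

  module _ (V : LeftModule K.ring ℓ ℓ) (fd : FiniteDimensional V) where
    open LeftModule V
    open LinearMap using (⟦_⟧; ⟦⟧-cong)
    open CommutativeMonoidSum K.+-commutativeMonoid using (sum-cong-≋)

    private
      n = proj₁ fd
      b = proj₁ (proj₂ fd)
      b-spans = proj₁ (proj₂ (proj₂ fd))
      b-indep = proj₂ (proj₂ (proj₂ fd))

      -- The differences of the coefficients form a relation between basis vectors. They are written
      -- with the factor -1 so that the laws of `linearCombination` apply.
      coordinates-unique : ∀ c d → linearCombination V c b ≈ᴹ linearCombination V d b → ∀ i → c i K.≈ d i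
      coordinates-unique c d p i = K.trans (K.sym (K.trans (K.+-assoc _ _ _)
          (K.trans (K.+-congˡ (K.-‿inverseˡ _)) (K.+-identityʳ _))))
        (K.trans (K.+-congʳ (K.trans (K.+-congˡ (K.sym (-1*≈-ᴹ scalars (d i))))
            (b-indep (λ i → c i K.+ (K.- K.1#) K.* d i) c-d≈0 i)))
          (K.+-identityˡ _))
        where
        c-d≈0 : linearCombination V (λ i → c i K.+ (K.- K.1#) K.* d i) b ≈ᴹ 0ᴹ
        c-d≈0 = ≈ᴹ-trans (linearCombination-+ V c _ b)
          (≈ᴹ-trans (+ᴹ-cong p (≈ᴹ-trans (linearCombination-* V _ d b) (-1*≈-ᴹ V _))) (-ᴹ‿inverseʳ _))

      -- `b-spans` merely chooses coefficients; their uniqueness is what makes the choice linear.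
      coordinate : Fin n → LinearMap V scalars
      coordinate i = linear (λ x → proj₁ (b-spans x) i)
        (λ {x} {y} x≈y → coordinates-unique _ _
          (≈ᴹ-trans (≈ᴹ-sym (proj₂ (b-spans x))) (≈ᴹ-trans x≈y (proj₂ (b-spans y)))) i)
        (λ x y → coordinates-unique _ _
          (≈ᴹ-trans (≈ᴹ-sym (proj₂ (b-spans (x +ᴹ y)))) (≈ᴹ-trans (+ᴹ-cong (proj₂ (b-spans x)) (proj₂ (b-spans y)))
            (≈ᴹ-sym (linearCombination-+ V _ _ b)))) i)
        (λ a x → coordinates-unique _ _
          (≈ᴹ-trans (≈ᴹ-sym (proj₂ (b-spans (a *ₗ x)))) (≈ᴹ-trans (*ₗ-congˡ (proj₂ (b-spans x)))
            (≈ᴹ-sym (linearCombination-* V _ _ b)))) i)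

      pairing : ∀ c d → linearCombination scalars c d K.≈ linearCombination scalars d c
      pairing c d = sum-cong-≋ {n} (λ i → K.*-comm (c i) (d i))

      dual-spans : Spanning (Dual V) coordinate
      dual-spans f = (λ i → ⟦ f ⟧ (b i)) , λ x → K.trans (⟦⟧-cong f (proj₂ (b-spans x)))
        (K.trans (LinearMap-linearCombination f _ b)
          (K.trans (pairing _ (λ i → ⟦ f ⟧ (b i)))
            (K.sym (LinearMap-linearCombination (evaluate x) _ coordinate))))

      coordinate-basis : ∀ i j → ⟦ coordinate i ⟧ (b j) K.≈ indicator V j i
      coordinate-basis i j = coordinates-unique _ _
        (≈ᴹ-trans (≈ᴹ-sym (proj₂ (b-spans (b j)))) (≈ᴹ-sym (linearCombination-indicator V j b))) i

      -- Evaluating a relation at `b j` isolates its coefficient `c j`.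
      dual-indep : LinearlyIndependent (Dual V) coordinate
      dual-indep c p j = K.trans (K.sym (linearCombination-indicator scalars j c))
        (K.trans (pairing _ c) (K.trans (sum-cong-≋ {n} (λ i → K.*-congˡ (K.sym (coordinate-basis i j))))
          (K.trans (K.sym (LinearMap-linearCombination (evaluate (b j)) c coordinate)) (p (b j)))))

    abstract
      Dual-finiteDimensional : FiniteDimensional (Dual V)
      Dual-finiteDimensional = n , coordinate , dual-spans , dual-indep

    -- The coordinate functionals already separate vectors.
    toBidual-injective : ∀ {x y} → (∀ f → ⟦ f ⟧ x K.≈ ⟦ f ⟧ y) → x ≈ᴹ y
    toBidual-injective {x} {y} p = ≈ᴹ-trans (proj₂ (b-spans x)) (≈ᴹ-trans
      (CommutativeMonoidSum.sum-cong-≋ +ᴹ-commutativeMonoid {n} (λ i → *ₗ-congʳ (p (coordinate i))))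
      (≈ᴹ-sym (proj₂ (b-spans y))))

    private
      representative : LeftModule.Carrierᴹ (Dual (Dual V)) → Carrierᴹ
      representative ξ = linearCombination V (λ i → ⟦ ξ ⟧ (coordinate i)) b

    -- Both sides expand to the sum of the products of `ξ (coordinate i)` with `f (b i)`, the right
    -- one by expanding `f` in the dual basis.
    representative-evaluates : ∀ ξ f → ⟦ f ⟧ (representative ξ) K.≈ ⟦ ξ ⟧ f
    representative-evaluates ξ f = K.trans (LinearMap-linearCombination f _ b)
      (K.trans (pairing _ (λ i → ⟦ f ⟧ (b i)))
        (K.sym (K.trans (⟦⟧-cong ξ (proj₂ (dual-spans f))) (LinearMap-linearCombination ξ _ coordinate))))

    fromBidual : LinearMap (Dual (Dual V)) V
    fromBidual = linear⁻¹ toBidual toBidual-injective representative representative-evaluates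

-- Exponents, monomials and chains

module _ (M : CommutativeMonoid m ℓm) where
  open CommutativeMonoid M
  open CommutativeMonoidSum M

  -- Used multiplicatively: raising one exponent by 1 multiplies the monomial by one variable.
  sum-update : ∀ {n} {f g : Fin n → Carrier} {x} j → f j ≈ x ∙ g j → (∀ i → i ≢ j → f i ≈ g i) →
               sum f ≈ x ∙ sum g
  sum-update {suc n} {f} {g} j fj f≈g = trans (sum-remove {i = j} f)
    (trans (∙-cong fj (sum-cong-≋ {n} (λ i → f≈g (punchIn j i) (Fin.punchInᵢ≢i j i))))
      (trans (assoc _ _ _) (∙-congˡ (sym (sum-remove {i = j} g)))))

if-yes : ∀ {a b} {A : Set a} {B : Set b} (d : Dec A) → A → {x y : B} → (if does d then x else y) ≡ x
if-yes d p = ≡.cong (λ b → if b then _ else _) (dec-true d p)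

if-no : ∀ {a b} {A : Set a} {B : Set b} (d : Dec A) → ¬ A → {x y : B} → (if does d then x else y) ≡ y
if-no d ¬p = ≡.cong (λ b → if b then _ else _) (dec-false d ¬p)

module Exponents {ℓ : Level} (K : Field ℓ) (P : FinitePoset ℓ) where

  open FinitePoset P
  open IsPartialOrder isPartialOrder public using () renaming (refl to ≤-refl; trans to ≤-trans; antisym to ≤-antisym)
  private
    module K = Field K
    module R = CommutativeRing (polynomialRing K P)

  Exponent : Set ℓ
  Exponent = P̂ → ℕ

  infixl 6 _⊹_
  _⊹_ : Exponent → Exponent → Exponent
  _⊹_ = _⊞_ K P

  𝟎 : Exponent
  𝟎 _ = 0

  -- `unit` extended to 0̂ by the zero exponent.
  δ : Carrier → Exponent
  δ σ (τ , _) = if does (τ ≟ σ) then 1 else 0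

  δ-diag : ∀ (τ : P̂) {σ} → proj₁ τ ≡ σ → δ σ τ ≡ 1
  δ-diag (τ , _) {σ} τ≡σ = if-yes (τ ≟ σ) τ≡σ

  δ-off : ∀ (τ : P̂) {σ} → proj₁ τ ≢ σ → δ σ τ ≡ 0
  δ-off (τ , _) {σ} τ≢σ = if-no (τ ≟ σ) τ≢σ

  private
    element : Fin size → Carrier
    element = Inverse.to enumeration

    element-index : ∀ σ → element (index σ) ≡ σ
    element-index = Inverse.strictlyInverseˡ enumeration

  module _ {q} (Q : Exponent → Set q) (Q-resp : ∀ {u v} → u ≗ v → Q u → Q v)
           (Q-𝟎 : Q 𝟎) (Q-step : ∀ {u} τ → Q u → Q (u ⊹ unit K P τ)) where

    private
      Q-steps : ∀ n τ {u} → Q u → Q (λ σ → u σ ℕ.+ n ℕ.* unit K P τ σ)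
      Q-steps zero    τ Qu = Q-resp (λ σ → ≡.sym (ℕ.+-identityʳ _)) Qu
      Q-steps (suc n) τ {u} Qu = Q-resp
        (λ σ → ≡.trans (ℕ.+-assoc (u σ) (n ℕ.* unit K P τ σ) _) (≡.cong (u σ ℕ.+_) (ℕ.+-comm (n ℕ.* unit K P τ σ) _)))
        (Q-step τ (Q-steps n τ Qu))

      induction-on : ∀ l u → (∀ τ → index (proj₁ τ) ∉ₗ l → u τ ≡ 0) → Q u
      induction-on []      u u≡0 = Q-resp (λ τ → ≡.sym (u≡0 τ λ ())) Q-𝟎
      induction-on (i ∷ l) u u≡0 with element i ≟ 0̂
      -- Exponents have no coordinate at 0̂, so there is nothing to clear here.
      ... | yes i≡0̂ = induction-on l u λ τ τ∉l → u≡0 τ λ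
        { (here τ≡i) → proj₂ τ (≡.trans (≡.sym (element-index _)) (≡.trans (≡.cong element τ≡i) i≡0̂))
        ; (there τ∈l) → τ∉l τ∈l }
      ... | no i≢0̂ = Q-resp u′+≗u (Q-steps (u (element i , i≢0̂)) (element i , i≢0̂) (induction-on l u′ u′≡0))
        where
        -- `u` with the coordinate of `element i` cleared; `Q-steps` restores that coordinate.
        u′ : Exponent
        u′ τ = if does (proj₁ τ ≟ element i) then 0 else u τ

        u′+≗u : ∀ τ → u′ τ ℕ.+ u (element i , i≢0̂) ℕ.* unit K P (element i , i≢0̂) τ ≡ u τ
        u′+≗u τ with proj₁ τ ≟ element i
        ... | yes ≡.refl = ≡.trans (≡.cong₂ (λ a b → a ℕ.+ u τ ℕ.* b) (if-yes (proj₁ τ ≟ element i) ≡.refl) (δ-diag τ ≡.refl)) (ℕ.*-identityʳ _)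
        ... | no τ≢i     = ≡.trans (≡.cong₂ (λ a b → a ℕ.+ u (element i , i≢0̂) ℕ.* b) (if-no (proj₁ τ ≟ element i) τ≢i) (δ-off τ τ≢i))
                             (≡.trans (≡.cong (u τ ℕ.+_) (ℕ.*-zeroʳ (u (element i , i≢0̂)))) (ℕ.+-identityʳ _))

        u′≡0 : ∀ τ → index (proj₁ τ) ∉ₗ l → u′ τ ≡ 0
        u′≡0 τ τ∉l with proj₁ τ ≟ element i
        ... | yes τ≡i = if-yes (proj₁ τ ≟ element i) τ≡i
        ... | no τ≢i  = ≡.trans (if-no (proj₁ τ ≟ element i) τ≢i) (u≡0 τ λ
          { (here τ≡i) → τ≢i (≡.trans (≡.sym (element-index _)) (≡.cong element τ≡i))
          ; (there τ∈l) → τ∉l τ∈l })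

    -- As P is finite, every exponent is reached from `𝟎` by adding unit vectors. The respect
    -- hypothesis is needed because exponents are functions, compared pointwise only.
    exponent-induction : ∀ u → Q u
    exponent-induction u = induction-on (allFin size) u (λ τ τ∉ → ⊥-elim (τ∉ (∈-allFin _)))

  private
    power : P̂ → ℕ → Polynomial K P
    power τ zero    = R.1#
    power τ (suc n) = var τ R.* power τ n

    -- The value 1 at 0̂ lets the product for x^u run over the enumeration of all of P.
    factor : Exponent → Carrier → Polynomial K P
    factor u σ with σ ≟ 0̂
    ... | yes _    = R.1#
    ... | no  σ≢0̂ = power (σ , σ≢0̂) (u (σ , σ≢0̂))

    factor-cong : ∀ {u v} → u ≗ v → ∀ σ → factor u σ R.≈ factor v σ
    factor-cong u≗v σ with σ ≟ 0̂
    ... | yes _    = R.refl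
    ... | no  σ≢0̂ = R.reflexive (≡.cong (power _) (u≗v _))

    factor-𝟎 : ∀ σ → factor 𝟎 σ R.≈ R.1#
    factor-𝟎 σ with σ ≟ 0̂
    ... | yes _ = R.refl
    ... | no  _ = R.refl

    factor-diag : ∀ u (τ : P̂) → factor (u ⊹ unit K P τ) (proj₁ τ) R.≈ var τ R.* factor u (proj₁ τ)
    factor-diag u (τ , τ≢0̂) with τ ≟ 0̂
    ... | yes τ≡0̂ = ⊥-elim (τ≢0̂ τ≡0̂)
    ... | no  _   = R.reflexive (≡.cong (power _)
      (≡.trans (≡.cong (_ ℕ.+_) (δ-diag (τ , τ≢0̂) ≡.refl)) (ℕ.+-comm _ 1)))

    factor-off : ∀ u (τ : P̂) σ → σ ≢ proj₁ τ → factor (u ⊹ unit K P τ) σ R.≈ factor u σ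
    factor-off u τ σ σ≢τ with σ ≟ 0̂
    ... | yes _    = R.refl
    ... | no σ≢0̂ = R.reflexive (≡.cong (power _)
      (≡.trans (≡.cong (_ ℕ.+_) (δ-off (σ , σ≢0̂) σ≢τ)) (ℕ.+-identityʳ _)))

    open CommutativeMonoidSum R.*-commutativeMonoid renaming (sum to product; sum-cong-≋ to product-cong)

  monomial : Exponent → Polynomial K P
  monomial u = product (factor u ∘ element)

  monomial-cong : ∀ {u v} → u ≗ v → monomial u R.≈ monomial v
  monomial-cong u≗v = product-cong {size} (factor-cong u≗v ∘ element)

  monomial-𝟎 : monomial 𝟎 R.≈ R.1#
  monomial-𝟎 = R.trans (product-cong {size} (factor-𝟎 ∘ element)) (sum-replicate-zero size)

  monomial-step : ∀ u τ → monomial (u ⊹ unit K P τ) R.≈ var τ R.* monomial u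
  monomial-step u τ = sum-update R.*-commutativeMonoid (index (proj₁ τ))
    (≡.subst (λ σ → factor (u ⊹ unit K P τ) σ R.≈ var τ R.* factor u σ) (≡.sym (element-index _)) (factor-diag u τ))
    (λ i i≢τ → factor-off u τ _ λ eq →
      i≢τ (≡.trans (≡.sym (Inverse.strictlyInverseʳ enumeration i)) (≡.cong index eq)))

  monomial-homogeneous : ∀ u → Homogeneous K P (ι K P u) (monomial u)
  monomial-homogeneous = exponent-induction (λ u → Homogeneous K P (ι K P u) (monomial u))
    (λ u≗v → resp (λ σ → ≡.cong +_ (u≗v σ)) (monomial-cong u≗v))
    (resp (λ _ → ≡.refl) (R.sym monomial-𝟎) (con K.1#))
    (λ {u} τ Hu → resp (λ σ → ≡.cong +_ (ℕ.+-comm (unit K P τ σ) (u σ))) (R.sym (monomial-step u τ)) (mul (var τ) Hu))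

  supp-resp : ∀ {u v σ} → u ≗ v → σ ∈ supp K P u → σ ∈ supp K P v
  supp-resp u≗v (σ≢0̂ , u≢0) = σ≢0̂ , λ v≡0 → u≢0 (≡.trans (u≗v _) v≡0)

  supp-⊹ˡ : ∀ u v {σ} → σ ∈ supp K P u → σ ∈ supp K P (u ⊹ v)
  supp-⊹ˡ u v (σ≢0̂ , u≢0) = σ≢0̂ , λ eq → u≢0 (ℕ.m+n≡0⇒m≡0 _ eq)

  supp-⊹ʳ : ∀ u v {σ} → σ ∈ supp K P v → σ ∈ supp K P (u ⊹ v)
  supp-⊹ʳ u v (σ≢0̂ , v≢0) = σ≢0̂ , λ eq → v≢0 (ℕ.m+n≡0⇒n≡0 (u _) eq)

  supp-⊹⁻ : ∀ u v {σ} → σ ∈ supp K P (u ⊹ v) → σ ∈ supp K P u ⊎ σ ∈ supp K P v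
  supp-⊹⁻ u v {σ} (σ≢0̂ , u+v≢0) with u (σ , σ≢0̂) ℕ.≟ 0
  ... | no u≢0  = inj₁ (σ≢0̂ , u≢0)
  ... | yes u≡0 = inj₂ (σ≢0̂ , λ v≡0 → u+v≢0 (≡.cong₂ ℕ._+_ u≡0 v≡0))

  supp-δ : ∀ {σ} → σ ≢ 0̂ → σ ∈ supp K P (δ σ)
  supp-δ {σ} σ≢0̂ = σ≢0̂ , λ δ≡0 → ℕ.1+n≢0 (≡.trans (≡.sym (δ-diag (σ , σ≢0̂) ≡.refl)) δ≡0)

  supp-δ⁻ : ∀ {σ τ} → τ ∈ supp K P (δ σ) → τ ≡ σ
  supp-δ⁻ {σ} {τ} (τ≢0̂ , δ≢0) with τ ≟ σ
  ... | yes τ≡σ = τ≡σ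
  ... | no τ≢σ  = ⊥-elim (δ≢0 (δ-off (τ , τ≢0̂) τ≢σ))

  -- The condition for a map from M_u to M_σ: the union of supp u and {σ} is a chain in P with
  -- largest element σ. The element σ need not lie in supp u.
  Below : Exponent → Carrier → Set ℓ
  Below u σ = _∈Δ K P (supp K P u) × (∀ {τ} → τ ∈ supp K P u → τ ≤ σ)

  Below-⊆ : ∀ {u v σ} → (∀ {τ} → τ ∈ supp K P v → τ ∈ supp K P u) → Below u σ → Below v σ
  Below-⊆ v⊆u ((_ , chain) , u≤σ) = (proj₁ , λ σ∈ τ∈ → chain (v⊆u σ∈) (v⊆u τ∈)) , (u≤σ ∘ v⊆u)

  Below-resp : ∀ {u v σ} → u ≗ v → Below u σ → Below v σ
  Below-resp u≗v = Below-⊆ (supp-resp (≡.sym ∘ u≗v))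

  Below-≤ : ∀ {u σ ρ} → Below u σ → σ ≤ ρ → Below u ρ
  Below-≤ (chain , u≤σ) σ≤ρ = chain , λ τ∈ → ≤-trans (u≤σ τ∈) σ≤ρ

  -- An upper bound of a chain is comparable with all its members, so it may be added to the chain.
  Below-⊹δ : ∀ {u σ ρ} → Below u σ → σ ≤ ρ → Below (u ⊹ δ σ) ρ
  Below-⊹δ {u} {σ} {ρ} ((_ , chain) , u≤σ) σ≤ρ = (proj₁ , λ α∈ β∈ → comparable (cases α∈) (cases β∈)) , bounded ∘ cases
    where
    cases : ∀ {τ} → τ ∈ supp K P (u ⊹ δ σ) → τ ∈ supp K P u ⊎ τ ∈ supp K P (δ σ)
    cases = supp-⊹⁻ u (δ σ)

    comparable : ∀ {α β} → α ∈ supp K P u ⊎ α ∈ supp K P (δ σ) → β ∈ supp K P u ⊎ β ∈ supp K P (δ σ) → α ≤ β ⊎ β ≤ α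
    comparable (inj₁ α∈) (inj₁ β∈) = chain α∈ β∈
    comparable (inj₁ α∈) (inj₂ β∈) = inj₁ (≡.subst (_ ≤_) (≡.sym (supp-δ⁻ β∈)) (u≤σ α∈))
    comparable (inj₂ α∈) (inj₁ β∈) = inj₂ (≡.subst (_ ≤_) (≡.sym (supp-δ⁻ α∈)) (u≤σ β∈))
    comparable (inj₂ α∈) (inj₂ β∈) = inj₁ (≡.subst₂ _≤_ (≡.sym (supp-δ⁻ α∈)) (≡.sym (supp-δ⁻ β∈)) ≤-refl)

    bounded : ∀ {τ} → τ ∈ supp K P u ⊎ τ ∈ supp K P (δ σ) → τ ≤ ρ
    bounded (inj₁ τ∈) = ≤-trans (u≤σ τ∈) σ≤ρ
    bounded (inj₂ τ∈) = ≡.subst (_≤ ρ) (≡.sym (supp-δ⁻ τ∈)) σ≤ρ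

  Below-𝟎 : ∀ {σ} → Below 𝟎 σ
  Below-𝟎 = (proj₁ , λ (_ , 0≢0) _ → ⊥-elim (0≢0 ≡.refl)) , λ (_ , 0≢0) → ⊥-elim (0≢0 ≡.refl)

  Below-δ : ∀ {σ ρ} → σ ≤ ρ → Below (δ σ) ρ
  Below-δ = Below-⊹δ Below-𝟎

  -- ρ is the largest element of supp u ∪ {0̂}.
  Top : Exponent → Carrier → Set ℓ
  Top u ρ = Below u ρ × (ρ ≡ 0̂ ⊎ ρ ∈ supp K P u)

  Top-δ : ∀ σ → Top (δ σ) σ
  Top-δ σ with σ ≟ 0̂
  ... | yes σ≡0̂ = Below-δ ≤-refl , inj₁ σ≡0̂
  ... | no  σ≢0̂ = Below-δ ≤-refl , inj₂ (supp-δ σ≢0̂)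

  Top⇒δ-summand : ∀ {u ρ} → Top u ρ → ∃[ v ] v ⊹ δ ρ ≗ u
  -- Truncated subtraction is exact here: `δ ρ` is zero if ρ is 0̂, and otherwise its only entry is
  -- a 1 at ρ, where `u` is positive.
  Top⇒δ-summand {u} {ρ} (_ , top) = (λ τ → u τ ℕ.∸ δ ρ τ) , λ τ → ℕ.m∸n+n≡m (δ≤u top τ)
    where
    δ≤u : ρ ≡ 0̂ ⊎ ρ ∈ supp K P u → ∀ τ → δ ρ τ ℕ.≤ u τ
    δ≤u top τ with proj₁ τ ≟ ρ
    δ≤u top              τ | no τ≢ρ     = ≡.subst (ℕ._≤ u τ) (≡.sym (δ-off τ τ≢ρ)) ℕ.z≤n
    δ≤u (inj₁ ≡.refl)    τ | yes τ≡0̂    = ⊥-elim (proj₂ τ τ≡0̂)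
    δ≤u (inj₂ (_ , u≢0)) τ | yes ≡.refl = ≡.subst (ℕ._≤ u τ) (≡.sym (δ-diag τ ≡.refl)) (ℕ.n≢0⇒n>0 u≢0)

  module _ (em : ExcludedMiddle ℓ) where

    -- Scans P keeping the largest member of the support met so far, which exists because the
    -- support is a chain. The start value 0̂ is the answer for the empty support.
    ∃-Top : ∀ u → _∈Δ K P (supp K P u) → ∃ (Top u)
    ∃-Top u (_ , chain) = let ρ , top , ≤ρ = bound (allFin size) in ρ ,
      ((proj₁ , chain) , λ {τ} τ∈ → ≤ρ τ (∈-allFin _) τ∈) , top
      where
      bound : ∀ l → ∃[ ρ ] (ρ ≡ 0̂ ⊎ ρ ∈ supp K P u) × (∀ τ → index τ ∈ₗ l → τ ∈ supp K P u → τ ≤ ρ)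
      bound []      = 0̂ , inj₁ ≡.refl , λ _ ()
      bound (i ∷ l) with bound l | em {element i ∈ supp K P u}
      ... | ρ , top , ≤ρ | no i∉ = ρ , top , λ
        { τ (here τ≡i) τ∈ → ⊥-elim (i∉ (≡.subst (supp K P u) (≡.trans (≡.sym (element-index τ)) (≡.cong element τ≡i)) τ∈))
        ; τ (there τ∈l) → ≤ρ τ τ∈l }
      ... | ρ , top , ≤ρ | yes i∈ with compare top
        where
        compare : ρ ≡ 0̂ ⊎ ρ ∈ supp K P u → ρ ≤ element i ⊎ element i ≤ ρ
        compare (inj₁ ≡.refl) = inj₁ (minimum _)
        compare (inj₂ ρ∈)     = chain ρ∈ i∈
      ... | inj₁ ρ≤i = element i , inj₂ i∈ , λ
        { τ (here τ≡i) _ → ≡.subst (_≤ element i) (≡.trans (≡.sym (≡.cong element τ≡i)) (element-index τ)) ≤-refl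
        ; τ (there τ∈l) τ∈ → ≤-trans (≤ρ τ τ∈l τ∈) ρ≤i }
      ... | inj₂ i≤ρ = ρ , top , λ
        { τ (here τ≡i) _ → ≡.subst (_≤ ρ) (≡.trans (≡.sym (≡.cong element τ≡i)) (element-index τ)) i≤ρ
        ; τ (there τ∈l) τ∈ → ≤ρ τ τ∈l τ∈ }

-- Homogeneous parts of elements of a graded module

module Terms {ℓ : Level} (em : ExcludedMiddle ℓ) (K : Field ℓ) (P : FinitePoset ℓ) (M : GradedModule K P) where

  open GradedModule M
  open CommutativeSemigroupProperties (CommutativeMonoid.commutativeSemigroup +ᴹ-commutativeMonoid)
    using (x∙yz≈y∙xz)

  Term : Set ℓ
  Term = Σ[ d ∈ Degree K P ] ∃ (Component d)

  value : Term → Carrierᴹ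
  value t = proj₁ (proj₂ t)

  total : List Term → Carrierᴹ
  total []      = 0ᴹ
  total (t ∷ L) = value t +ᴹ total L

  keep : {A : Set ℓ} → Dec A → Carrierᴹ → Carrierᴹ
  keep (yes _) x = x
  keep (no _)  x = 0ᴹ

  keep-yes : {A : Set ℓ} (A? : Dec A) → A → ∀ {x} → keep A? x ≈ᴹ x
  keep-yes (yes _) a = ≈ᴹ-refl
  keep-yes (no ¬a) a = ⊥-elim (¬a a)

  keep-no : {A : Set ℓ} (A? : Dec A) → ¬ A → ∀ {x} → keep A? x ≈ᴹ 0ᴹ
  keep-no (yes a) ¬a = ⊥-elim (¬a a)
  keep-no (no _)  ¬a = ≈ᴹ-refl

  part : Degree K P → List Term → Carrierᴹ
  part d []      = 0ᴹ
  part d (t ∷ L) = keep (em {proj₁ t ≗ d}) (value t) +ᴹ part d L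

  others : Degree K P → List Term → List Term
  others d []      = []
  others d (t ∷ L) with em {proj₁ t ≗ d}
  ... | yes _ = others d L
  ... | no  _ = t ∷ others d L

  part-∈ : ∀ d L → part d L ∈ Component d
  part-∈ d []      = 0∈
  part-∈ d (t ∷ L) with em {proj₁ t ≗ d}
  ... | yes t≗d = +∈ (∈-resp t≗d ≈ᴹ-refl (proj₂ (proj₂ t))) (part-∈ d L)
  ... | no  _   = +∈ 0∈ (part-∈ d L)

  total-++ : ∀ L L′ → total (L ++ L′) ≈ᴹ total L +ᴹ total L′
  total-++ []      L′ = ≈ᴹ-sym (+ᴹ-identityˡ _)
  total-++ (t ∷ L) L′ = ≈ᴹ-trans (+ᴹ-congˡ (total-++ L L′)) (≈ᴹ-sym (+ᴹ-assoc _ _ _))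

  part-++ : ∀ d L L′ → part d (L ++ L′) ≈ᴹ part d L +ᴹ part d L′
  part-++ d []      L′ = ≈ᴹ-sym (+ᴹ-identityˡ _)
  part-++ d (t ∷ L) L′ = ≈ᴹ-trans (+ᴹ-congˡ (part-++ d L L′)) (≈ᴹ-sym (+ᴹ-assoc _ _ _))

  part-absent : ∀ d {L} → All (λ t → ¬ (proj₁ t ≗ d)) L → part d L ≈ᴹ 0ᴹ
  part-absent d []        = ≈ᴹ-refl
  part-absent d (t≢d ∷ p) = ≈ᴹ-trans (+ᴹ-cong (keep-no em t≢d) (part-absent d p)) (+ᴹ-identityˡ _)

  total-others : ∀ d L → total L ≈ᴹ part d L +ᴹ total (others d L)
  total-others d []      = ≈ᴹ-sym (+ᴹ-identityˡ _)
  total-others d (t ∷ L) with em {proj₁ t ≗ d}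
  ... | yes _ = ≈ᴹ-trans (+ᴹ-congˡ (total-others d L)) (≈ᴹ-sym (+ᴹ-assoc _ _ _))
  ... | no  _ = ≈ᴹ-trans (+ᴹ-congˡ (total-others d L))
                  (≈ᴹ-trans (x∙yz≈y∙xz _ _ _) (+ᴹ-congʳ (≈ᴹ-sym (+ᴹ-identityˡ _))))

  others-≢ : ∀ d L → All (λ t → ¬ (proj₁ t ≗ d)) (others d L)
  others-≢ d []      = []
  others-≢ d (t ∷ L) with em {proj₁ t ≗ d}
  ... | yes _   = others-≢ d L
  ... | no  t≢d = t≢d ∷ others-≢ d L

  others-All : ∀ {q} {Q : Pred Term q} d {L} → All Q L → All Q (others d L)
  others-All d []                = []
  others-All d {t ∷ L} (q ∷ qs) with em {proj₁ t ≗ d}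
  ... | yes _ = others-All d qs
  ... | no  _ = q ∷ others-All d qs

  part-others : ∀ d e L → ¬ (d ≗ e) → part e (others d L) ≈ᴹ part e L
  part-others d e []      d≢e = ≈ᴹ-refl
  part-others d e (t ∷ L) d≢e with em {proj₁ t ≗ d}
  ... | yes t≗d = ≈ᴹ-trans (part-others d e L d≢e) (≈ᴹ-trans (≈ᴹ-sym (+ᴹ-identityˡ _))
                    (+ᴹ-congʳ (≈ᴹ-sym (keep-no em (λ t≗e → d≢e (λ x → ≡.trans (≡.sym (t≗d x)) (t≗e x)))))))
  ... | no _    = +ᴹ-congˡ (part-others d e L d≢e)

  Distinct : List Term → Set ℓ
  Distinct = AllPairs (λ s t → ¬ (proj₁ t ≗ proj₁ s))

  others-distinct : ∀ d {L} → Distinct L → Distinct (others d L)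
  others-distinct d []                = []
  others-distinct d {t ∷ L} (p ∷ ps) with em {proj₁ t ≗ d}
  ... | yes _ = others-distinct d ps
  ... | no  _ = others-All d p ∷ others-distinct d ps

  -- Merges the terms of equal degree, which brings a decomposition into the form that `independent`
  -- requires.
  normalise : List Term → List Term
  normalise []      = []
  normalise (t ∷ L) = (proj₁ t , part (proj₁ t) (t ∷ L) , part-∈ _ (t ∷ L)) ∷ others (proj₁ t) (normalise L)

  normalise-distinct : ∀ L → Distinct (normalise L)
  normalise-distinct []      = []
  normalise-distinct (t ∷ L) = others-≢ _ (normalise L) ∷ others-distinct _ (normalise-distinct L)

  part-resp : ∀ {d e} L → d ≗ e → part d L ≈ᴹ part e L
  part-resp []      d≗e = ≈ᴹ-refl
  part-resp {d} {e} (t ∷ L) d≗e = +ᴹ-cong (keep-resp em em) (part-resp L d≗e)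
    where
    keep-resp : (d? : Dec (proj₁ t ≗ d)) (e? : Dec (proj₁ t ≗ e)) → keep d? (value t) ≈ᴹ keep e? (value t)
    keep-resp (yes t≗d) e? = ≈ᴹ-sym (keep-yes e? (λ x → ≡.trans (t≗d x) (d≗e x)))
    keep-resp (no t≢d)  e? = ≈ᴹ-sym (keep-no e? (λ t≗e → t≢d (λ x → ≡.trans (t≗e x) (≡.sym (d≗e x)))))

  part-normalise : ∀ d L → part d (normalise L) ≈ᴹ part d L
  part-normalise d []      = ≈ᴹ-refl
  part-normalise d (t ∷ L) with em {proj₁ t ≗ d}
  ... | yes t≗d = ≈ᴹ-trans (+ᴹ-cong (+ᴹ-cong (keep-yes em (λ _ → ≡.refl)) (part-resp L t≗d))
                    (part-absent d (All.map (λ s≢t s≗d → s≢t (λ x → ≡.trans (s≗d x) (≡.sym (t≗d x))))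
                      (others-≢ (proj₁ t) (normalise L)))))
                    (+ᴹ-identityʳ _)
  ... | no t≢d  = +ᴹ-congˡ (≈ᴹ-trans (part-others (proj₁ t) d (normalise L) t≢d) (part-normalise d L))

  total-normalise : ∀ L → total (normalise L) ≈ᴹ total L
  total-normalise []      = ≈ᴹ-refl
  total-normalise (t ∷ L) = ≈ᴹ-trans (+ᴹ-congʳ (+ᴹ-congʳ (keep-yes em (λ _ → ≡.refl)))) (≈ᴹ-trans (+ᴹ-assoc _ _ _)
    (+ᴹ-congˡ (≈ᴹ-trans (+ᴹ-congʳ (≈ᴹ-sym (part-normalise (proj₁ t) L)))
      (≈ᴹ-trans (≈ᴹ-sym (total-others (proj₁ t) (normalise L))) (total-normalise L)))))

  part-distinct : ∀ {L} → Distinct L → All (λ t → part (proj₁ t) L ≈ᴹ value t) L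
  part-distinct []                  = []
  part-distinct {t ∷ L} (t≢L ∷ ps) =
    ≈ᴹ-trans (+ᴹ-cong (keep-yes em (λ _ → ≡.refl)) (part-absent _ t≢L)) (+ᴹ-identityʳ _) ∷
    All.zipWith (λ (s≢t , p) → ≈ᴹ-trans (+ᴹ-congʳ (keep-no em (λ t≗s → s≢t (λ x → ≡.sym (t≗s x)))))
      (≈ᴹ-trans (+ᴹ-identityˡ _) p)) (t≢L , part-distinct ps)

  total-zero : ∀ {L} → All (λ t → value t ≈ᴹ 0ᴹ) L → total L ≈ᴹ 0ᴹ
  total-zero []       = ≈ᴹ-refl
  total-zero (p ∷ ps) = ≈ᴹ-trans (+ᴹ-cong p (total-zero ps)) (+ᴹ-identityˡ _)

  part-zero : ∀ d {L} → All (λ t → value t ≈ᴹ 0ᴹ) L → part d L ≈ᴹ 0ᴹ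
  part-zero d []                = ≈ᴹ-refl
  part-zero d {t ∷ L} (p ∷ ps) with em {proj₁ t ≗ d}
  ... | yes _ = ≈ᴹ-trans (+ᴹ-cong p (part-zero d ps)) (+ᴹ-identityˡ _)
  ... | no  _ = ≈ᴹ-trans (+ᴹ-congˡ (part-zero d ps)) (+ᴹ-identityˡ _)

  -- After normalisation each term is the part of its own degree, so vanishing parts leave only zero
  -- terms.
  parts≈0⇒total≈0 : ∀ L → (∀ d → part d L ≈ᴹ 0ᴹ) → total L ≈ᴹ 0ᴹ
  parts≈0⇒total≈0 L p = ≈ᴹ-trans (≈ᴹ-sym (total-normalise L)) (total-zero
    (All.map (λ q → ≈ᴹ-trans (≈ᴹ-sym q) (≈ᴹ-trans (part-normalise _ L) (p _))) (part-distinct (normalise-distinct L))))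

  private
    sum-lookup : ∀ L → sum (value ∘ lookup L) ≈ᴹ total L
    sum-lookup []      = ≈ᴹ-refl
    sum-lookup (t ∷ L) = +ᴹ-congˡ (sum-lookup L)

    lookup-injective : ∀ {L} → Distinct L → ∀ {i j} → proj₁ (lookup L i) ≗ proj₁ (lookup L j) → i ≡ j
    lookup-injective (p ∷ ps) {zero}  {zero}  eq = ≡.refl
    lookup-injective (p ∷ ps) {zero}  {suc j} eq = ⊥-elim (All.lookup p (∈-lookup j) (≡.sym ∘ eq))
    lookup-injective (p ∷ ps) {suc i} {zero}  eq = ⊥-elim (All.lookup p (∈-lookup i) eq)
    lookup-injective (p ∷ ps) {suc i} {suc j} eq = ≡.cong suc (lookup-injective ps eq)

    All-lookup : ∀ {q} {Q : Pred Term q} L → (∀ i → Q (lookup L i)) → All Q L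
    All-lookup []      q = []
    All-lookup (t ∷ L) q = q zero ∷ All-lookup L (q ∘ suc)

  -- This is where `independent` enters: applied to the normalised list, whose degrees are distinct,
  -- it annihilates every term.
  total≈0⇒part≈0 : ∀ d L → total L ≈ᴹ 0ᴹ → part d L ≈ᴹ 0ᴹ
  total≈0⇒part≈0 d L p = ≈ᴹ-trans (≈ᴹ-sym (part-normalise d L)) (part-zero d (All-lookup (normalise L)
    (independent (proj₁ ∘ lookup (normalise L)) (value ∘ lookup (normalise L))
      (lookup-injective (normalise-distinct L)) (λ i → proj₂ (proj₂ (lookup (normalise L) i)))
      (≈ᴹ-trans (sum-lookup (normalise L)) (≈ᴹ-trans (total-normalise L) p)))))

  private
    decomposition : ∀ x → ∃[ L ] total L ≈ᴹ x
    decomposition x = let n , d , y , y∈ , x≈ = span x in fromFin n d y y∈ x≈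
      where
      total-tabulate : ∀ n (t : Fin n → Term) → total (tabulate t) ≈ᴹ sum (value ∘ t)
      total-tabulate zero    t = ≈ᴹ-refl
      total-tabulate (suc n) t = +ᴹ-congˡ (total-tabulate n (t ∘ suc))

      fromFin : ∀ n (d : Fin n → Degree K P) (y : Fin n → Carrierᴹ) (y∈ : ∀ i → y i ∈ Component (d i)) →
                x ≈ᴹ sum y → ∃[ L ] total L ≈ᴹ x
      fromFin n d y y∈ x≈ = tabulate (λ i → d i , y i , y∈ i) , ≈ᴹ-trans (total-tabulate n _) (≈ᴹ-sym x≈)

  terms : Carrierᴹ → List Term
  terms x = proj₁ (decomposition x)

  total-terms : ∀ x → total (terms x) ≈ᴹ x
  total-terms x = proj₂ (decomposition x)

module _ {ℓ : Level} (em : ExcludedMiddle ℓ) (K : Field ℓ) (P : FinitePoset ℓ) (M N : GradedModule K P) where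
  private
    module M where
      open GradedModule M public
      open Terms em K P M public
    module N where
      open GradedModule N public
      open Terms em K P N public

  module _ (f : M.Carrierᴹ → N.Carrierᴹ) (f-0 : f M.0ᴹ N.≈ᴹ N.0ᴹ) (f-+ : ∀ x y → f (x M.+ᴹ y) N.≈ᴹ f x N.+ᴹ f y)
           (shift : Degree K P → Degree K P) (shift-resp : ∀ {d e} → d ≗ e → shift d ≗ shift e)
           (shift-inj : ∀ {d e} → shift d ≗ shift e → d ≗ e)
           (f-∈ : ∀ {d x} → x ∈ M.Component d → f x ∈ N.Component (shift d)) where

    mapTerms : List M.Term → List N.Term
    mapTerms = map (λ t → shift (proj₁ t) , f (M.value t) , f-∈ (proj₂ (proj₂ t)))

    total-map : ∀ L → N.total (mapTerms L) N.≈ᴹ f (M.total L)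
    total-map []      = N.≈ᴹ-sym f-0
    total-map (t ∷ L) = N.≈ᴹ-trans (N.+ᴹ-congˡ (total-map L)) (N.≈ᴹ-sym (f-+ _ _))

    -- Because `shift` is injective, terms of different degrees cannot merge under the map.
    part-map : ∀ d L → N.part (shift d) (mapTerms L) N.≈ᴹ f (M.part d L)
    part-map d []      = N.≈ᴹ-sym f-0
    part-map d (t ∷ L) = N.≈ᴹ-trans (N.+ᴹ-cong keep-map (part-map d L)) (N.≈ᴹ-sym (f-+ _ _))
      where
      keep-map : N.keep (em {shift (proj₁ t) ≗ shift d}) (f (M.value t)) N.≈ᴹ f (M.keep (em {proj₁ t ≗ d}) (M.value t))
      keep-map with em {proj₁ t ≗ d}
      ... | yes t≗d = N.keep-yes em (shift-resp t≗d)
      ... | no  t≢d = N.≈ᴹ-trans (N.keep-no em (t≢d ∘ shift-inj)) (N.≈ᴹ-sym f-0)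

module Projections {ℓ : Level} (em : ExcludedMiddle ℓ) (K : Field ℓ) (P : FinitePoset ℓ) (M : GradedModule K P) where

  open GradedModule M
  open Terms em K P M
  open LeftModuleProperties leftModule using (inverseˡ-uniqueᴹ; inverseʳ-uniqueᴹ; -ᴹ-involutive)
  open CommutativeSemigroupProperties (CommutativeMonoid.commutativeSemigroup +ᴹ-commutativeMonoid)
    using (interchange)

  π : Degree K P → Carrierᴹ → Carrierᴹ
  π d x = part d (terms x)

  π-∈ : ∀ d x → π d x ∈ Component d
  π-∈ d x = part-∈ d (terms x)

  private
    -0≈0 : -ᴹ 0ᴹ ≈ᴹ 0ᴹ
    -0≈0 = ≈ᴹ-sym (inverseʳ-uniqueᴹ 0ᴹ 0ᴹ (+ᴹ-identityˡ 0ᴹ))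

    -‿+ : ∀ x y → -ᴹ (x +ᴹ y) ≈ᴹ -ᴹ x +ᴹ -ᴹ y
    -‿+ x y = ≈ᴹ-sym (inverseʳ-uniqueᴹ _ _ (≈ᴹ-trans (interchange _ _ _ _)
      (≈ᴹ-trans (+ᴹ-cong (-ᴹ‿inverseʳ x) (-ᴹ‿inverseʳ y)) (+ᴹ-identityˡ 0ᴹ))))

    negTerms : List Term → List Term
    negTerms = mapTerms em K P M M -ᴹ_ -0≈0 -‿+ (λ d → d) (λ p → p) (λ p → p) -∈

  -- Two decompositions of x differ by one of 0, whose parts vanish by independence.
  part≈π : ∀ d L {x} → total L ≈ᴹ x → part d L ≈ᴹ π d x
  part≈π d L {x} p = ≈ᴹ-trans
    (inverseˡ-uniqueᴹ _ _ (≈ᴹ-trans (+ᴹ-congˡ (≈ᴹ-sym (part-map em K P M M -ᴹ_ -0≈0 -‿+ _ (λ p → p) (λ p → p) -∈ d (terms x))))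
      (≈ᴹ-trans (≈ᴹ-sym (part-++ d L (negTerms (terms x)))) (total≈0⇒part≈0 d (L ++ negTerms (terms x)) total≈0))))
    (-ᴹ-involutive _)
    where
    total≈0 : total (L ++ negTerms (terms x)) ≈ᴹ 0ᴹ
    total≈0 = ≈ᴹ-trans (total-++ L _) (≈ᴹ-trans (+ᴹ-cong p
      (≈ᴹ-trans (total-map em K P M M -ᴹ_ -0≈0 -‿+ _ (λ p → p) (λ p → p) -∈ (terms x)) (-ᴹ‿cong (total-terms x)))) (-ᴹ‿inverseʳ x))

  π-cong : ∀ d {x y} → x ≈ᴹ y → π d x ≈ᴹ π d y
  π-cong d {x} x≈y = part≈π d (terms x) (≈ᴹ-trans (total-terms x) x≈y)

  π-resp : ∀ {d e} x → d ≗ e → π d x ≈ᴹ π e x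
  π-resp x = part-resp (terms x)

  π-+ : ∀ d x y → π d (x +ᴹ y) ≈ᴹ π d x +ᴹ π d y
  π-+ d x y = ≈ᴹ-trans (≈ᴹ-sym (part≈π d (terms x ++ terms y) (≈ᴹ-trans (total-++ (terms x) (terms y)) (+ᴹ-cong (total-terms x) (total-terms y)))))
    (part-++ d (terms x) (terms y))

  private
    π-homogeneous : ∀ {d e x} (x∈ : x ∈ Component d) → keep (em {d ≗ e}) x ≈ᴹ π e x
    π-homogeneous {d} {e} {x} x∈ = ≈ᴹ-trans (≈ᴹ-sym (+ᴹ-identityʳ _)) (part≈π e ((d , x , x∈) ∷ []) (+ᴹ-identityʳ x))

  π-same : ∀ {d e x} → x ∈ Component d → d ≗ e → π e x ≈ᴹ x
  π-same x∈ d≗e = ≈ᴹ-trans (≈ᴹ-sym (π-homogeneous x∈)) (keep-yes em d≗e)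

  π-other : ∀ {d e x} → x ∈ Component d → ¬ (d ≗ e) → π e x ≈ᴹ 0ᴹ
  π-other x∈ d≢e = ≈ᴹ-trans (≈ᴹ-sym (π-homogeneous x∈)) (keep-no em d≢e)

  π-0 : ∀ d → π d 0ᴹ ≈ᴹ 0ᴹ
  π-0 d = π-same {d} 0∈ (λ _ → ≡.refl)

  ≈0-byParts : ∀ {x} → (∀ d → π d x ≈ᴹ 0ᴹ) → x ≈ᴹ 0ᴹ
  ≈0-byParts {x} p = ≈ᴹ-trans (≈ᴹ-sym (total-terms x)) (parts≈0⇒total≈0 (terms x) p)

  ≈-byParts : ∀ {x y} → (∀ d → π d x ≈ᴹ π d y) → x ≈ᴹ y
  ≈-byParts {x} {y} p = ≈ᴹ-trans (inverseˡ-uniqueᴹ x (-ᴹ y) (≈0-byParts (λ d → ≈ᴹ-trans (π-+ d x (-ᴹ y))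
      (≈ᴹ-trans (+ᴹ-congʳ (p d)) (≈ᴹ-trans (≈ᴹ-sym (π-+ d y (-ᴹ y))) (≈ᴹ-trans (π-cong d (-ᴹ‿inverseʳ y)) (π-0 d)))))))
    (-ᴹ-involutive y)

  -- Such an `x` has the same parts as `π d x`, hence equals it.
  ∈-byParts : ∀ {d x} → (∀ e → ¬ (d ≗ e) → π e x ≈ᴹ 0ᴹ) → x ∈ Component d
  ∈-byParts {d} {x} p = ∈-resp (λ _ → ≡.refl) (≈-byParts agree) (π-∈ d x)
    where
    agree : ∀ e → π e (π d x) ≈ᴹ π e x
    agree e with em {d ≗ e}
    ... | yes d≗e = ≈ᴹ-trans (π-same (π-∈ d x) d≗e) (π-resp x d≗e)
    ... | no  d≢e = ≈ᴹ-trans (π-other (π-∈ d x) d≢e) (≈ᴹ-sym (p e d≢e))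

  -- Bounds the degrees that occur in `x` by a finite list; this becomes the finite support of the
  -- section attached to `x`.
  π-support : ∀ d x → ¬ Any (λ t → proj₁ t ≗ d) (terms x) → π d x ≈ᴹ 0ᴹ
  π-support d x ∉ = part-absent d (¬Any⇒All¬ _ ∉)

module _ {ℓ : Level} (em : ExcludedMiddle ℓ) (K : Field ℓ) (P : FinitePoset ℓ) (M N : GradedModule K P) where
  private
    module M where
      open GradedModule M public
      open Terms em K P M public
      open Projections em K P M public
    module N where
      open GradedModule N public
      open Projections em K P N public

  module _ (f : M.Carrierᴹ → N.Carrierᴹ) (f-cong : ∀ {x y} → x M.≈ᴹ y → f x N.≈ᴹ f y)
           (f-0 : f M.0ᴹ N.≈ᴹ N.0ᴹ) (f-+ : ∀ x y → f (x M.+ᴹ y) N.≈ᴹ f x N.+ᴹ f y)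
           (shift : Degree K P → Degree K P) (shift-resp : ∀ {d e} → d ≗ e → shift d ≗ shift e)
           (shift-inj : ∀ {d e} → shift d ≗ shift e → d ≗ e)
           (f-∈ : ∀ {d x} → x ∈ M.Component d → f x ∈ N.Component (shift d)) where

    -- The images of the terms of `x` decompose `f x`, and any decomposition computes the
    -- projections.
    π-shift : ∀ d x → N.π (shift d) (f x) N.≈ᴹ f (M.π d x)
    π-shift d x = N.≈ᴹ-trans (N.≈ᴹ-sym (N.part≈π (shift d) (mapTerms em K P M N f f-0 f-+ shift shift-resp shift-inj f-∈ (M.terms x))
        (N.≈ᴹ-trans (total-map em K P M N f f-0 f-+ shift shift-resp shift-inj f-∈ (M.terms x)) (f-cong (M.total-terms x)))))
      (part-map em K P M N f f-0 f-+ shift shift-resp shift-inj f-∈ d (M.terms x))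

  π-GradedHom : ∀ (f : GradedHom K P M N) d x → let open GradedHom f in N.π d (⟦ x ⟧) N.≈ᴹ ⟦ M.π d x ⟧
  π-GradedHom f d x = π-shift (GradedHom.⟦_⟧ f) (GradedHom.⟦⟧-cong f) (GradedHom.0ᴹ-homo f) (GradedHom.+ᴹ-homo f)
    (λ d → d) (λ p → p) (λ p → p) (GradedHom.preserves f) d x

module _ {ℓ : Level} (em : ExcludedMiddle ℓ) (K : Field ℓ) (P : FinitePoset ℓ) (M : GradedModule K P) where
  open GradedModule M
  open Projections em K P M

  con-∈ : ∀ a {d x} → x ∈ Component d → con a *ₗ x ∈ Component d
  con-∈ a x∈ = ∈-resp (λ _ → ℤ.+-identityˡ _) ≈ᴹ-refl (*∈ (con a) x∈)

  π-con : ∀ a d x → π d (con a *ₗ x) ≈ᴹ con a *ₗ π d x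
  π-con a = π-shift em K P M M (con a *ₗ_) *ₗ-congˡ (*ₗ-zeroʳ _) (*ₗ-distribˡ _) (λ d → d) (λ p → p) (λ p → p) (con-∈ a)

  π-var : ∀ τ d x → π (_⊕_ K P (ι K P (unit K P τ)) d) (var τ *ₗ x) ≈ᴹ var τ *ₗ π d x
  π-var τ = π-shift em K P M M (var τ *ₗ_) *ₗ-congˡ (*ₗ-zeroʳ _) (*ₗ-distribˡ _) (_⊕_ K P (ι K P (unit K P τ)))
    (λ d≗e σ → ≡.cong₂ ℤ._+_ {x = ι K P (unit K P τ) σ} ≡.refl (d≗e σ))
    (λ p σ → GroupProperties.∙-cancelˡ (AbelianGroup.group ℤ.+-0-abelianGroup) (ι K P (unit K P τ) σ) _ _ (p σ))
    (*∈ (var τ))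

-- Modules over the polynomial ring; the category of cosheaves

module _ {ℓ : Level} (K : Field ℓ) (P : FinitePoset ℓ) where

  private
    module K = Field K
    module R = CommutativeRing (polynomialRing K P)
    open FinitePoset P

  restrictScalars : LeftModule (R K P) ℓ ℓ → LeftModule K.ring ℓ ℓ
  restrictScalars M = record
    { Carrierᴹ = Carrierᴹ
    ; _≈ᴹ_     = _≈ᴹ_
    ; _+ᴹ_     = _+ᴹ_
    ; _*ₗ_     = λ a x → con a *ₗ x
    ; 0ᴹ       = 0ᴹ
    ; -ᴹ_      = -ᴹ_
    ; isLeftModule = record
      { isLeftSemimodule = record
        { +ᴹ-isCommutativeMonoid = +ᴹ-isCommutativeMonoid
        ; isPreleftSemimodule = record
          { *ₗ-cong      = λ p q → *ₗ-cong (con-cong p) q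
          ; *ₗ-zeroˡ     = *ₗ-zeroˡ
          ; *ₗ-distribʳ  = λ x a b → ≈ᴹ-trans (*ₗ-congʳ (con-+ a b)) (*ₗ-distribʳ x _ _)
          ; *ₗ-identityˡ = *ₗ-identityˡ
          ; *ₗ-assoc     = λ a b x → ≈ᴹ-trans (*ₗ-congʳ (con-* a b)) (*ₗ-assoc _ _ x)
          ; *ₗ-zeroʳ     = λ a → *ₗ-zeroʳ _
          ; *ₗ-distribˡ  = λ a → *ₗ-distribˡ _
          }
        }
      ; -ᴹ‿cong    = -ᴹ‿cong
      ; -ᴹ‿inverse = -ᴹ‿inverse
      }
    }
    where open LeftModule M

  module _ (M : LeftModule (R K P) ℓ ℓ) where
    open LeftModule M
    open LeftModuleProperties M using (inverseˡ-uniqueᴹ)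

    neg-*ₗ : ∀ p x → (-ᴿ p) *ₗ x ≈ᴹ con (K.- K.1#) *ₗ (p *ₗ x)
    neg-*ₗ p x = ≈ᴹ-trans (inverseˡ-uniqueᴹ _ _ (≈ᴹ-trans (≈ᴹ-sym (*ₗ-distribʳ x _ _))
        (≈ᴹ-trans (*ₗ-congʳ (R.-‿inverseˡ p)) (*ₗ-zeroˡ x))))
      (≈ᴹ-sym (-1*≈-ᴹ (restrictScalars M) (p *ₗ x)))

    *ₗ-comm : ∀ p q x → p *ₗ (q *ₗ x) ≈ᴹ q *ₗ (p *ₗ x)
    *ₗ-comm p q x = ≈ᴹ-trans (≈ᴹ-sym (*ₗ-assoc p q x)) (≈ᴹ-trans (*ₗ-congʳ (R.*-comm p q)) (*ₗ-assoc q p x))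

    -- Polynomials are expressions in constants and variables, and a negation acts as the constant
    -- -1, so closure under constants and variables suffices.
    isSubmodule : ∀ {q} {S : Pred Carrierᴹ q} → (∀ {x y} → x ≈ᴹ y → x ∈ S → y ∈ S) → 0ᴹ ∈ S →
      (∀ {x y} → x ∈ S → y ∈ S → x +ᴹ y ∈ S) → (∀ a {x} → x ∈ S → con a *ₗ x ∈ S) →
      (∀ τ {x} → x ∈ S → var τ *ₗ x ∈ S) → IsSubmodule M S
    isSubmodule {S = S} resp∈ 0∈ +∈ con∈ var∈ = record { resp = resp∈ ; 0∈ = 0∈ ; +∈ = +∈ ; *∈ = *∈ }
      where
      *∈ : ∀ p {x} → x ∈ S → p *ₗ x ∈ S
      *∈ (con a)  x∈ = con∈ a x∈
      *∈ (var τ)  x∈ = var∈ τ x∈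
      *∈ (p +ᴿ q) x∈ = resp∈ (≈ᴹ-sym (*ₗ-distribʳ _ p q)) (+∈ (*∈ p x∈) (*∈ q x∈))
      *∈ (p *ᴿ q) x∈ = resp∈ (≈ᴹ-sym (*ₗ-assoc p q _)) (*∈ p (*∈ q x∈))
      *∈ (-ᴿ p)   x∈ = resp∈ (≈ᴹ-sym (neg-*ₗ p _)) (con∈ _ (*∈ p x∈))

  module _ {M N : LeftModule (R K P) ℓ ℓ} where
    private
      module M = LeftModule M
      module N = LeftModule N

    R-linear : (f : LinearMap (restrictScalars M) (restrictScalars N)) → let open LinearMap f in
               (∀ τ x → ⟦ var τ M.*ₗ x ⟧ N.≈ᴹ var τ N.*ₗ ⟦ x ⟧) → LinearMap M N
    R-linear f f-var = linear ⟦_⟧ ⟦⟧-cong +ᴹ-homo f-*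
      where
      open LinearMap f
      f-* : ∀ p x → ⟦ p M.*ₗ x ⟧ N.≈ᴹ p N.*ₗ ⟦ x ⟧
      f-* (con a)  x = *ₗ-homo a x
      f-* (var τ)  x = f-var τ x
      f-* (p +ᴿ q) x = N.≈ᴹ-trans (⟦⟧-cong (M.*ₗ-distribʳ x p q)) (N.≈ᴹ-trans (+ᴹ-homo _ _)
        (N.≈ᴹ-trans (N.+ᴹ-cong (f-* p x) (f-* q x)) (N.≈ᴹ-sym (N.*ₗ-distribʳ _ p q))))
      f-* (p *ᴿ q) x = N.≈ᴹ-trans (⟦⟧-cong (M.*ₗ-assoc p q x)) (N.≈ᴹ-trans (f-* p _)
        (N.≈ᴹ-trans (N.*ₗ-congˡ (f-* q x)) (N.≈ᴹ-sym (N.*ₗ-assoc p q _))))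
      f-* (-ᴿ p)   x = N.≈ᴹ-trans (⟦⟧-cong (neg-*ₗ M p x)) (N.≈ᴹ-trans (*ₗ-homo _ _)
        (N.≈ᴹ-trans (N.*ₗ-congˡ (f-* p x)) (N.≈ᴹ-sym (neg-*ₗ N p _))))

  infixl 6 _-unit_
  _-unit_ : Degree K P → P̂ → Degree K P
  (d -unit τ) σ = ℤ.- ι K P (unit K P τ) σ ℤ.+ d σ

  -- With integer entries every degree is e_τ plus another one, so `π-var` computes the part of x_τ
  -- x in any degree. The other degree may have negative entries.
  unit⊕-unit : ∀ d τ → _⊕_ K P (ι K P (unit K P τ)) (d -unit τ) ≗ d
  unit⊕-unit d τ σ = ≡.trans (≡.sym (ℤ.+-assoc i (ℤ.- i) (d σ)))
    (≡.trans (≡.cong (ℤ._+ d σ) (ℤ.+-inverseʳ i)) (ℤ.+-identityˡ (d σ)))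
    where i = ι K P (unit K P τ) σ

  componentModule : (M : GradedModule K P) → Degree K P → LeftModule K.ring ℓ ℓ
  componentModule M d = induced (restrictScalars leftModule) {C = ∃ (Component d)} proj₁
    (λ (x , x∈) (y , y∈) → x +ᴹ y , +∈ x∈ y∈)
    (λ a (x , x∈) → con a *ₗ x , ∈-resp (λ _ → ℤ.+-identityˡ _) ≈ᴹ-refl (*∈ (con a) x∈))
    (0ᴹ , 0∈) (λ (x , x∈) → -ᴹ x , -∈ x∈)
    (λ _ _ → ≈ᴹ-refl) (λ _ _ → ≈ᴹ-refl) ≈ᴹ-refl (λ _ → ≈ᴹ-refl)
    where open GradedModule M

  -- Sheaves with the arrows reversed, except that the maps `ext` are given for all σ ≤ τ
  -- and not only for σ < τ.
  record Cosheaf : Set (lsuc ℓ) where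
    no-eta-equality
    field
      stalk             : Carrier → LeftModule K.ring ℓ ℓ
      finiteDimensional : ∀ σ → FiniteDimensional (stalk σ)
      ext               : ∀ {σ τ} → .(σ ≤ τ) → LinearMap (stalk σ) (stalk τ)
      ext-id            : ∀ {σ} .(σ≤σ : σ ≤ σ) x → LeftModule._≈ᴹ_ (stalk σ) (LinearMap.⟦_⟧ (ext σ≤σ) x) x
      ext-∘             : ∀ {σ τ ρ} .(σ≤τ : σ ≤ τ) .(τ≤ρ : τ ≤ ρ) .(σ≤ρ : σ ≤ ρ) x →
                          LeftModule._≈ᴹ_ (stalk ρ)
                            (LinearMap.⟦_⟧ (ext τ≤ρ) (LinearMap.⟦_⟧ (ext σ≤τ) x))
                            (LinearMap.⟦_⟧ (ext σ≤ρ) x)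

  record CosheafHom (F G : Cosheaf) : Set ℓ where
    private
      module F = Cosheaf F
      module G = Cosheaf G
    field
      at      : ∀ σ → LinearMap (F.stalk σ) (G.stalk σ)
      natural : ∀ {σ τ} .(σ≤τ : σ ≤ τ) x →
                LeftModule._≈ᴹ_ (G.stalk τ)
                  (LinearMap.⟦_⟧ (at τ) (LinearMap.⟦_⟧ (F.ext σ≤τ) x))
                  (LinearMap.⟦_⟧ (G.ext σ≤τ) (LinearMap.⟦_⟧ (at σ) x))

  CoSh : Category (lsuc ℓ) ℓ ℓ
  CoSh = record
    { Obj           = Cosheaf
    ; Hom           = CosheafHom
    ; _≈_           = λ {_} {G} f g → ∀ σ x →
      LeftModule._≈ᴹ_ (stalk G σ) (⟦ at f σ ⟧ x) (⟦ at g σ ⟧ x)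
    ; id            = λ {F} → record
      { at = λ _ → idₗ ; natural = λ {_} {τ} _ _ → LeftModule.≈ᴹ-refl (stalk F τ) }
    ; _⊚_           = λ {_} {_} {H} f g → record
      { at      = λ σ → at f σ ∘ₗ at g σ
      ; natural = λ {σ} {τ} σ≤τ x → LeftModule.≈ᴹ-trans (stalk H τ)
          (⟦⟧-cong (at f τ) (natural g σ≤τ x)) (natural f σ≤τ (⟦ at g σ ⟧ x))
      }
    ; isEquivalence = λ {_} {G} → record
      { refl  = λ σ _ → LeftModule.≈ᴹ-refl (stalk G σ)
      ; sym   = λ p σ x → LeftModule.≈ᴹ-sym (stalk G σ) (p σ x)
      ; trans = λ p q σ x → LeftModule.≈ᴹ-trans (stalk G σ) (p σ x) (q σ x)
      }
    ; ⊚-cong        = λ {_} {_} {H} {f} {_} {_} {g′} p q σ x →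
      LeftModule.≈ᴹ-trans (stalk H σ) (⟦⟧-cong (at f σ) (q σ x)) (p σ (⟦ at g′ σ ⟧ x))
    ; assoc         = λ {_} {_} {_} {H} _ _ _ σ _ → LeftModule.≈ᴹ-refl (stalk H σ)
    ; identityˡ     = λ {_} {G} _ σ _ → LeftModule.≈ᴹ-refl (stalk G σ)
    ; identityʳ     = λ {_} {G} _ σ _ → LeftModule.≈ᴹ-refl (stalk G σ)
    }
    where
    open Cosheaf
    open CosheafHom
    open LinearMap

-- The cosheaf of a squarefree module

module FromModule {ℓ : Level} (em : ExcludedMiddle ℓ) (K : Field ℓ) (P : FinitePoset ℓ)
                  (M : GradedModule K P) (sq : IsSquarefree K P M) where

  open FinitePoset P
  open Exponents K P
  open GradedModule M
  open IsSquarefree sq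
  open Projections em K P M
  open Terms em K P M using (Term; total; terms; total-terms)
  private
    module K = Field K

    infixl 6 _⊕′_
    _⊕′_ : Degree K P → Degree K P → Degree K P
    _⊕′_ = _⊕_ K P

    𝒊 : Exponent → Degree K P
    𝒊 = ι K P

  𝒊-cong : ∀ {u v} → u ≗ v → 𝒊 u ≗ 𝒊 v
  𝒊-cong u≗v σ = ≡.cong +_ (u≗v σ)

  monomial-∈ : ∀ u v {x} → x ∈ Component (𝒊 u) → monomial v *ₗ x ∈ Component (𝒊 (u ⊹ v))
  monomial-∈ u v x∈ = ∈-resp (λ σ → ≡.cong +_ (ℕ.+-comm (v σ) (u σ))) ≈ᴹ-refl (*∈ (monomial-homogeneous v) x∈)

  monomial-step-*ₗ : ∀ u τ x → monomial (u ⊹ unit K P τ) *ₗ x ≈ᴹ var τ *ₗ (monomial u *ₗ x)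
  monomial-step-*ₗ u τ x = ≈ᴹ-trans (*ₗ-congʳ (monomial-step u τ)) (*ₗ-assoc _ _ x)

  private
    IsBijection : Exponent → Exponent → Set ℓ
    IsBijection v u =
      (∀ {x y} → x ∈ Component (𝒊 v) → y ∈ Component (𝒊 v) → monomial u *ₗ x ≈ᴹ monomial u *ₗ y → x ≈ᴹ y) ×
      (∀ {z} → z ∈ Component (𝒊 (v ⊹ u)) → ∃[ x ] x ∈ Component (𝒊 v) × monomial u *ₗ x ≈ᴹ z)

  -- Induction on `u`: each variable x_τ of x^u satisfies τ ≤ ρ, and ρ remains the largest element
  -- of the support throughout, so squarefreeness makes every single multiplication bijective.
  monomial-bijection : ∀ {v ρ} → Top v ρ → ∀ u → Below (v ⊹ u) ρ → IsBijection v u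
  monomial-bijection {v} {ρ} ((_ , v≤ρ) , top) = exponent-induction (λ u → Below (v ⊹ u) ρ → IsBijection v u)
    respects
    (λ _ → (λ x∈ y∈ eq → ≈ᴹ-trans (≈ᴹ-sym (𝟎* _)) (≈ᴹ-trans eq (𝟎* _))) ,
      (λ {z} z∈ → z , ∈-resp (𝒊-cong (λ σ → ℕ.+-identityʳ (v σ))) ≈ᴹ-refl z∈ , 𝟎* z))
    step
    where
    𝟎* : ∀ x → monomial 𝟎 *ₗ x ≈ᴹ x
    𝟎* x = ≈ᴹ-trans (*ₗ-congʳ monomial-𝟎) (*ₗ-identityˡ x)

    respects : ∀ {u u′} → u ≗ u′ → (Below (v ⊹ u) ρ → IsBijection v u) → Below (v ⊹ u′) ρ → IsBijection v u′
    respects {u} {u′} u≗u′ bij below =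
      (λ x∈ y∈ eq → inj x∈ y∈ (≈ᴹ-trans (u≈u′ _) (≈ᴹ-trans eq (≈ᴹ-sym (u≈u′ _))))) ,
      (λ z∈ → let x , x∈ , eq = surj (∈-resp (𝒊-cong v+u′≗v+u) ≈ᴹ-refl z∈) in
        x , x∈ , ≈ᴹ-trans (≈ᴹ-sym (u≈u′ x)) eq)
      where
      v+u′≗v+u : v ⊹ u′ ≗ v ⊹ u
      v+u′≗v+u σ = ≡.cong (v σ ℕ.+_) (≡.sym (u≗u′ σ))

      u≈u′ : ∀ x → monomial u *ₗ x ≈ᴹ monomial u′ *ₗ x
      u≈u′ x = *ₗ-congʳ (monomial-cong u≗u′)

      inj  = proj₁ (bij (Below-resp v+u′≗v+u below))
      surj = proj₂ (bij (Below-resp v+u′≗v+u below))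

    step : ∀ {u} τ → (Below (v ⊹ u) ρ → IsBijection v u) → Below (v ⊹ (u ⊹ unit K P τ)) ρ → IsBijection v (u ⊹ unit K P τ)
    step {u} τ bij below =
      (λ x∈ y∈ eq → inj x∈ y∈ (proj₁ var-bijective {_ , monomial-∈ v u x∈} {_ , monomial-∈ v u y∈}
        (≈ᴹ-trans (≈ᴹ-sym (monomial-step-*ₗ u τ _)) (≈ᴹ-trans eq (monomial-step-*ₗ u τ _))))) ,
      (λ {z} z∈ → let (y , y∈) , y↦z = proj₂ var-bijective (z , ∈-resp (𝒊-cong assoc) ≈ᴹ-refl z∈)
                      x , x∈ , x↦y = surj y∈ in
        x , x∈ , ≈ᴹ-trans (monomial-step-*ₗ u τ x) (y↦z {_ , monomial-∈ v u x∈} x↦y))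
      where
      assoc : v ⊹ (u ⊹ unit K P τ) ≗ v ⊹ u ⊹ unit K P τ
      assoc σ = ≡.sym (ℕ.+-assoc (v σ) (u σ) _)

      below₁ : Below (v ⊹ u ⊹ unit K P τ) ρ
      below₁ = Below-resp assoc below

      below₀ : Below (v ⊹ u) ρ
      below₀ = Below-⊆ (supp-⊹ˡ (v ⊹ u) (unit K P τ)) below₁

      τ≤ρ : proj₁ τ ≤ ρ
      τ≤ρ = proj₂ below₁ (supp-⊹ʳ (v ⊹ u) (unit K P τ) (supp-δ (proj₂ τ)))

      ρ∈ : ρ ≡ 0̂ ⊎ ρ ∈ supp K P v → ρ ∈ supp K P (v ⊹ u)
      -- No variable lies below ρ = 0̂, so in degree 0 the induction never reaches a step and
      -- multiplication is by 1.
      ρ∈ (inj₁ ≡.refl) = ⊥-elim (proj₂ τ (≤-antisym τ≤ρ (minimum _)))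
      ρ∈ (inj₂ ρ∈v)    = supp-⊹ˡ v u ρ∈v

      var-bijective = bijective (v ⊹ u) (proj₁ below₀) ρ (ρ∈ top , proj₂ below₀) τ (proj₁ below₁) τ≤ρ
      inj  = proj₁ (bij below₀)
      surj = proj₂ (bij below₀)

  Stalk : Carrier → LeftModule K.ring ℓ ℓ
  Stalk σ = componentModule K P M (𝒊 (δ σ))

  -- y is the image of x under the map M_u → M_{δ σ} given formally by x_σ / x^u.
  IsLift : Exponent → Carrier → Carrierᴹ → Carrierᴹ → Set ℓ
  IsLift u σ x y = monomial u *ₗ y ≈ᴹ monomial (δ σ) *ₗ x

  private
    Below-δ⊹ : ∀ {u σ} → Below u σ → Below (δ σ ⊹ u) σ
    Below-δ⊹ {u} {σ} b = Below-resp (λ τ → ℕ.+-comm (u τ) (δ σ τ)) (Below-⊹δ b ≤-refl)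

  IsLift-unique : ∀ {u σ} → Below u σ → ∀ {x y y′} → y ∈ Component (𝒊 (δ σ)) → y′ ∈ Component (𝒊 (δ σ)) →
                  IsLift u σ x y → IsLift u σ x y′ → y ≈ᴹ y′
  IsLift-unique {u} {σ} b y∈ y′∈ p q = proj₁ (monomial-bijection (Top-δ σ) u (Below-δ⊹ b)) y∈ y′∈ (≈ᴹ-trans p (≈ᴹ-sym q))

  private
    -- The element x_σ x lies in degree `δ σ ⊹ u`, and multiplication by x^u maps M_σ bijectively
    -- onto that component because `δ σ` has top σ.
    lift : ∀ {u σ} → Below u σ → ∀ {x} → x ∈ Component (𝒊 u) → ∃[ y ] y ∈ Component (𝒊 (δ σ)) × IsLift u σ x y
    lift {u} {σ} b x∈ = proj₂ (monomial-bijection (Top-δ σ) u (Below-δ⊹ b))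
      (∈-resp (𝒊-cong (λ τ → ℕ.+-comm (u τ) (δ σ τ))) ≈ᴹ-refl (monomial-∈ u (δ σ) x∈))

  IsLift-cong : ∀ {u σ x x′ y y′} → x ≈ᴹ x′ → y ≈ᴹ y′ → IsLift u σ x y → IsLift u σ x′ y′
  IsLift-cong p q l = ≈ᴹ-trans (*ₗ-congˡ (≈ᴹ-sym q)) (≈ᴹ-trans l (*ₗ-congˡ p))

  IsLift-+ : ∀ {u σ x x′ y y′} → IsLift u σ x y → IsLift u σ x′ y′ → IsLift u σ (x +ᴹ x′) (y +ᴹ y′)
  IsLift-+ p q = ≈ᴹ-trans (*ₗ-distribˡ _ _ _) (≈ᴹ-trans (+ᴹ-cong p q) (≈ᴹ-sym (*ₗ-distribˡ _ _ _)))

  IsLift-* : ∀ {u σ x y} a → IsLift u σ x y → IsLift u σ (a *ₗ x) (a *ₗ y)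
  IsLift-* a p = ≈ᴹ-trans (*ₗ-comm K P leftModule _ _ _) (≈ᴹ-trans (*ₗ-congˡ p) (*ₗ-comm K P leftModule _ _ _))

  IsLift-id : ∀ {σ x} → IsLift (δ σ) σ x x
  IsLift-id = ≈ᴹ-refl

  -- The required equation holds after multiplication by x_σ, by commuting monomials: x_σ x^u z =
  -- x^u x_ρ y = x_ρ x_σ x. The factor x_σ cancels because the degree `δ ρ ⊹ u` has top ρ and σ ≤ ρ.
  IsLift-∘ : ∀ {u σ ρ x y z} → Below u σ → σ ≤ ρ →
             x ∈ Component (𝒊 u) → z ∈ Component (𝒊 (δ ρ)) →
             IsLift u σ x y → IsLift (δ σ) ρ y z → IsLift u ρ x z
  IsLift-∘ {u} {σ} {ρ} {x} {y} {z} b σ≤ρ x∈ z∈ x↦y y↦z = proj₁ (monomial-bijection {δ ρ ⊹ u} top (δ σ) below)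
    (monomial-∈ (δ ρ) u z∈) (∈-resp (𝒊-cong (λ τ → ℕ.+-comm (u τ) (δ ρ τ))) ≈ᴹ-refl (monomial-∈ u (δ ρ) x∈))
    (≈ᴹ-trans (comm _ _ z) (≈ᴹ-trans (*ₗ-congˡ y↦z) (≈ᴹ-trans (comm _ _ y) (≈ᴹ-trans (*ₗ-congˡ x↦y) (comm _ _ x)))))
    where
    comm = *ₗ-comm K P leftModule

    below : Below (δ ρ ⊹ u ⊹ δ σ) ρ
    below = Below-resp
      (λ τ → ≡.trans (ℕ.+-comm (u τ ℕ.+ δ σ τ) (δ ρ τ)) (≡.sym (ℕ.+-assoc (δ ρ τ) (u τ) (δ σ τ))))
      (Below-⊹δ (Below-⊹δ b σ≤ρ) ≤-refl)

    top : Top (δ ρ ⊹ u) ρ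
    top = Below-⊆ (supp-⊹ˡ (δ ρ ⊹ u) (δ σ)) below , Sum.map₂ (supp-⊹ˡ (δ ρ) u) (proj₂ (Top-δ ρ))

  -- A lift is used below only through its defining equation and its uniqueness, so its construction
  -- is kept opaque.
  abstract
    Lift : ∀ u σ → Below u σ → LinearMap (componentModule K P M (𝒊 u)) (Stalk σ)
    Lift u σ b = linear (λ (x , x∈) → let y , y∈ , _ = lift b x∈ in y , y∈)
      (λ {(x , x∈)} {(x′ , x′∈)} x≈x′ → let y , y∈ , p = lift b x∈ ; y′ , y′∈ , p′ = lift b x′∈ in
        IsLift-unique b y∈ y′∈ (IsLift-cong x≈x′ ≈ᴹ-refl p) p′)
      (λ (x , x∈) (x′ , x′∈) → let y , y∈ , p = lift b x∈ ; y′ , y′∈ , p′ = lift b x′∈ ; z , z∈ , q = lift b (+∈ x∈ x′∈) in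
        IsLift-unique b z∈ (+∈ y∈ y′∈) q (IsLift-+ p p′))
      (λ a (x , x∈) → let y , y∈ , p = lift b x∈ ; z , z∈ , q = lift b (con-∈ em K P M a x∈) in
        IsLift-unique b z∈ (con-∈ em K P M a y∈) q (IsLift-* (con a) p))

    Lift-IsLift : ∀ u σ b x → IsLift u σ (proj₁ x) (proj₁ (LinearMap.⟦_⟧ (Lift u σ b) x))
    Lift-IsLift u σ b (x , x∈) = let y , y∈ , p = lift b x∈ in p

  IsLift⇒Lift≈ : ∀ {u σ b x y} → y ∈ Component (𝒊 (δ σ)) → IsLift u σ (proj₁ x) y →
                 proj₁ (LinearMap.⟦_⟧ (Lift u σ b) x) ≈ᴹ y
  IsLift⇒Lift≈ {u} {σ} {b} {x} y∈ p = IsLift-unique b (proj₂ (LinearMap.⟦_⟧ (Lift u σ b) x)) y∈ (Lift-IsLift u σ b x) p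

  private
    -- The given generators need not be homogeneous; their terms are, and they generate as well.
    Y : List Term
    Y = concat (tabulate (terms ∘ proj₁ (proj₂ finitelyGenerated)))

    multiple : Degree K P → Term → Exponent → Set ℓ
    multiple d t v = (𝒊 v ⊕′ proj₁ t) ≗ d

    -- The component of degree d is spanned over K by the multiples of degree d of the generators.
    multipleOf : ∀ d t → Dec (∃ (multiple d t)) → ∃ (Component d)
    multipleOf d (_ , y , y∈) (yes (v , eq)) = monomial v *ₗ y , ∈-resp eq ≈ᴹ-refl (*∈ (monomial-homogeneous v) y∈)
    multipleOf d _            (no _)         = 0ᴹ , 0∈

    -- The two degrees determine the exponent, so the witness that excluded middle happens to
    -- provide gives the same monomial as `v`.
    multipleOf-resp : ∀ {d t v} → multiple d t v → (v? : Dec (∃ (multiple d t))) →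
                      proj₁ (multipleOf d t v?) ≈ᴹ monomial v *ₗ proj₁ (proj₂ t)
    multipleOf-resp {d} {t} {v} eq (no ∄v)          = ⊥-elim (∄v (v , eq))
    multipleOf-resp {d} {t} {v} eq (yes (v′ , eq′)) = *ₗ-congʳ (monomial-cong (λ σ → ℤ.+-injective
      (GroupProperties.∙-cancelʳ (AbelianGroup.group ℤ.+-0-abelianGroup) (proj₁ t σ) _ _ (≡.trans (eq′ σ) (≡.sym (eq σ))))))

    generators : ∀ d → Fin (length Y) → Carrierᴹ
    generators d i = proj₁ (multipleOf d (lookup Y i) em)

    |M| : LeftModule K.ring ℓ ℓ
    |M| = restrictScalars K P leftModule

    Spanned : ∀ d → Carrierᴹ → Set ℓ
    Spanned d = InSpan |M| (generators d)

    module Spanned d = IsSubmodule (InSpan-isSubmodule |M| (generators d))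

    multipleOf-Spanned : ∀ d {t} → t ∈ₗ Y → Spanned d (proj₁ (multipleOf d t em))
    multipleOf-Spanned d t∈ = ≡.subst (λ t → Spanned d (proj₁ (multipleOf d t em))) (≡.sym (lookup-index t∈))
      (∈-InSpan |M| (generators d) (Any.index t∈))

    -- Multiplication by x_τ turns the multiple of degree `d` of a generator into its multiple of
    -- degree `e`; where there is none in degree `d`, the product is zero.
    var-Spanned : ∀ τ {d e} → (𝒊 (unit K P τ) ⊕′ d) ≗ e → ∀ {x} → Spanned d x → Spanned e (var τ *ₗ x)
    var-Spanned τ {d} {e} eq (c , p) = Spanned.resp e
      (≈ᴹ-sym (≈ᴹ-trans (*ₗ-congˡ p) (LinearMap-linearCombination var* c (generators d))))
      (submodule-∋-linearCombination |M| (InSpan-isSubmodule |M| (generators e)) c (λ i → generator i em))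
      where
      var* : LinearMap |M| |M|
      var* = linear (var τ *ₗ_) *ₗ-congˡ (*ₗ-distribˡ _) (λ _ _ → *ₗ-comm K P leftModule _ _ _)

      generator : ∀ i v? → Spanned e (var τ *ₗ proj₁ (multipleOf d (lookup Y i) v?))
      generator i (no _)          = Spanned.resp e (≈ᴹ-sym (*ₗ-zeroʳ _)) (Spanned.0∈ e)
      generator i (yes (v , eq′)) = Spanned.resp e
        (≈ᴹ-trans (multipleOf-resp {v = v ⊹ unit K P τ} v+1 em) (monomial-step-*ₗ v τ _))
        (∈-InSpan |M| (generators e) i)
        where
        dᵢ = proj₁ (lookup Y i)

        v+1 : multiple e (lookup Y i) (v ⊹ unit K P τ)
        v+1 σ = ≡.trans (≡.cong (ℤ._+ dᵢ σ) (ℤ.+-comm (𝒊 v σ) (𝒊 (unit K P τ) σ)))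
          (≡.trans (ℤ.+-assoc (𝒊 (unit K P τ) σ) (𝒊 v σ) (dᵢ σ))
            (≡.trans (≡.cong (λ z → 𝒊 (unit K P τ) σ ℤ.+ z) (eq′ σ)) (eq σ)))

    -- All degrees are treated at once because x_τ mixes them: the part of x_τ x in degree d comes
    -- from the part of x in degree d - e_τ. Only so is the condition stable under the polynomial
    -- ring.
    AllSpanned : Carrierᴹ → Set ℓ
    AllSpanned x = ∀ d → Spanned d (π d x)

    AllSpanned-isSubmodule : IsSubmodule leftModule AllSpanned
    AllSpanned-isSubmodule = isSubmodule K P leftModule
      (λ x≈y x∈ d → Spanned.resp d (π-cong d x≈y) (x∈ d))
      (λ d → Spanned.resp d (≈ᴹ-sym (π-0 d)) (Spanned.0∈ d))
      (λ x∈ y∈ d → Spanned.resp d (≈ᴹ-sym (π-+ d _ _)) (Spanned.+∈ d (x∈ d) (y∈ d)))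
      (λ a x∈ d → Spanned.resp d (≈ᴹ-sym (π-con em K P M a d _)) (Spanned.*∈ d a (x∈ d)))
      (λ τ {x} x∈ d → Spanned.resp d
        (≈ᴹ-trans (≈ᴹ-sym (π-var em K P M τ (_-unit_ K P d τ) x)) (π-resp _ (unit⊕-unit K P d τ)))
        (var-Spanned τ (unit⊕-unit K P d τ) (x∈ (_-unit_ K P d τ))))

    module AllSpanned = IsSubmodule AllSpanned-isSubmodule

    AllSpanned-Y : ∀ {t} → t ∈ₗ Y → AllSpanned (proj₁ (proj₂ t))
    AllSpanned-Y {e , y , y∈} t∈ d with em {e ≗ d}
    ... | no e≢d  = Spanned.resp d (≈ᴹ-sym (π-other y∈ e≢d)) (Spanned.0∈ d)
    ... | yes e≗d = Spanned.resp d
      (≈ᴹ-trans (multipleOf-resp {v = 𝟎} (λ σ → ≡.trans (ℤ.+-identityˡ (e σ)) (e≗d σ)) em)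
        (≈ᴹ-trans (*ₗ-congʳ monomial-𝟎) (≈ᴹ-trans (*ₗ-identityˡ y) (≈ᴹ-sym (π-same y∈ e≗d)))))
      (multipleOf-Spanned d t∈)

    AllSpanned-total : ∀ L → (∀ {t} → t ∈ₗ L → t ∈ₗ Y) → AllSpanned (total L)
    AllSpanned-total []      L⊆Y = AllSpanned.0∈
    AllSpanned-total (t ∷ L) L⊆Y = AllSpanned.+∈ (AllSpanned-Y (L⊆Y (here ≡.refl))) (AllSpanned-total L (L⊆Y ∘ there))

    allSpanned : ∀ x → AllSpanned x
    allSpanned x = let n , b , b-spans = finitelyGenerated ; c , x≈ = b-spans x in
      AllSpanned.resp (≈ᴹ-sym x≈) (submodule-∋-linearCombination leftModule AllSpanned-isSubmodule c λ i →
        AllSpanned.resp (total-terms (b i)) (AllSpanned-total (terms (b i)) λ t∈ →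
          ∈-concat⁺′ t∈ (∈-tabulate⁺ {f = terms ∘ b} i)))

  abstract
    component-finiteDimensional : ∀ d → FiniteDimensional (componentModule K P M d)
    component-finiteDimensional d = spanning⇒finiteDimensional K em (componentModule K P M d) _ generators′
      λ (x , x∈) → let c , p = allSpanned x d in
        c , ≈ᴹ-trans (≈ᴹ-sym (π-same x∈ (λ _ → ≡.refl))) (≈ᴹ-trans p (≈ᴹ-sym (LinearMap-linearCombination inclusion c generators′)))
      where
      generators′ : Fin (length Y) → ∃ (Component d)
      generators′ i = multipleOf d (lookup Y i) em

      inclusion : LinearMap (componentModule K P M d) |M|
      inclusion = linear proj₁ (λ p → p) (λ _ _ → ≈ᴹ-refl) (λ _ _ → ≈ᴹ-refl)

  cosheaf : Cosheaf K P
  Cosheaf.stalk             cosheaf   = Stalk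
  Cosheaf.finiteDimensional cosheaf σ = component-finiteDimensional (𝒊 (δ σ))
  -- The order proof is an irrelevant argument; excluded middle recovers a usable one.
  Cosheaf.ext               cosheaf {σ} {τ} σ≤τ = Lift (δ σ) τ (Below-δ (recompute em σ≤τ))
  Cosheaf.ext-id            cosheaf _ x = IsLift⇒Lift≈ (proj₂ x) IsLift-id
  Cosheaf.ext-∘             cosheaf {σ} {τ} {ρ} σ≤τ τ≤ρ σ≤ρ x = ≈ᴹ-sym (IsLift⇒Lift≈ (proj₂ z)
    (IsLift-∘ (Below-δ (recompute em σ≤τ)) (recompute em τ≤ρ) (proj₂ x) (proj₂ z)
      (Lift-IsLift (δ σ) τ _ x) (Lift-IsLift (δ τ) ρ _ y)))
    where
    y = LinearMap.⟦_⟧ (Lift (δ σ) τ (Below-δ (recompute em σ≤τ))) x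
    z = LinearMap.⟦_⟧ (Lift (δ τ) ρ (Below-δ (recompute em τ≤ρ))) y

module _ {ℓ : Level} (em : ExcludedMiddle ℓ) (K : Field ℓ) (P : FinitePoset ℓ) where
  open Exponents K P

  restrictHom : ∀ {M N} → GradedHom K P M N → ∀ u → LinearMap (componentModule K P M (ι K P u)) (componentModule K P N (ι K P u))
  restrictHom f u = linear (λ (x , x∈) → ⟦ x ⟧ , preserves x∈) ⟦⟧-cong (λ _ _ → +ᴹ-homo _ _) (λ _ _ → *ₗ-homo _ _)
    where open GradedHom f

  -- A linear map over the polynomial ring preserves the equation that defines a lift, and lifts are
  -- unique.
  restrictHom-Lift : ∀ {M N} (sqM : IsSquarefree K P M) (sqN : IsSquarefree K P N) (f : GradedHom K P M N) {u σ} b x →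
    LeftModule._≈ᴹ_ (componentModule K P N (ι K P (δ σ)))
      (LinearMap.⟦_⟧ (restrictHom f (δ σ)) (LinearMap.⟦_⟧ (FromModule.Lift em K P M sqM u σ b) x))
      (LinearMap.⟦_⟧ (FromModule.Lift em K P N sqN u σ b) (LinearMap.⟦_⟧ (restrictHom f u) x))
  restrictHom-Lift {M} {N} sqM sqN f {u} {σ} b x = ≈ᴹ-sym (FromModule.IsLift⇒Lift≈ em K P N sqN
    (preserves (proj₂ (LinearMap.⟦_⟧ (FromModule.Lift em K P M sqM u σ b) x)))
    (≈ᴹ-trans (≈ᴹ-sym (*ₗ-homo _ _)) (≈ᴹ-trans (⟦⟧-cong (FromModule.Lift-IsLift em K P M sqM u σ b x)) (*ₗ-homo _ _))))
    where
    open GradedHom f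
    open GradedModule N using (≈ᴹ-sym; ≈ᴹ-trans)

  mapCosheaf : ∀ {M N} (sqM : IsSquarefree K P M) (sqN : IsSquarefree K P N) → GradedHom K P M N →
               CosheafHom K P (FromModule.cosheaf em K P M sqM) (FromModule.cosheaf em K P N sqN)
  mapCosheaf sqM sqN f = record
    { at      = λ σ → restrictHom f (δ σ)
    ; natural = λ σ≤τ x → restrictHom-Lift sqM sqN f _ x
    }

  toCosheaf : Functor (Sq K P) (CoSh K P)
  toCosheaf = record
    { F₀     = λ (M , sq) → FromModule.cosheaf em K P M sq
    ; F₁     = λ {(M , sqM)} {(N , sqN)} f → mapCosheaf sqM sqN f
    ; F-cong = λ f≈g σ x → f≈g (proj₁ x)
    ; F-id   = λ {(M , _)} σ x → GradedModule.≈ᴹ-refl M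
    ; F-⊚    = λ {_} {_} {(N , _)} f g σ x → GradedModule.≈ᴹ-refl N
    }

-- The squarefree module of a cosheaf

module CommutingAction {ℓ : Level} (K : Field ℓ) (P : FinitePoset ℓ) (V : LeftModule (Field.ring K) ℓ ℓ)
  (X : FinitePoset.P̂ P → LinearMap V V)
  (X-comm : ∀ σ τ x → LeftModule._≈ᴹ_ V (LinearMap.⟦_⟧ (X σ) (LinearMap.⟦_⟧ (X τ) x))
                                        (LinearMap.⟦_⟧ (X τ) (LinearMap.⟦_⟧ (X σ) x))) where

  open LeftModule V
  open LinearMap using (⟦_⟧; ⟦⟧-cong; +ᴹ-homo; *ₗ-homo; 0ᴹ-homo)
  open CommutativeSemigroupProperties (CommutativeMonoid.commutativeSemigroup +ᴹ-commutativeMonoid)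
    using (interchange)
  private
    module K = Field K

    *ₗ-swap : ∀ a b x → a *ₗ (b *ₗ x) ≈ᴹ b *ₗ (a *ₗ x)
    *ₗ-swap a b x = ≈ᴹ-trans (≈ᴹ-sym (*ₗ-assoc a b x)) (≈ᴹ-trans (*ₗ-congʳ (K.*-comm a b)) (*ₗ-assoc b a x))

  scale : K.Carrier → LinearMap V V
  scale a = linear (a *ₗ_) *ₗ-congˡ (*ₗ-distribˡ a) (λ b x → *ₗ-swap a b x)

  action : Polynomial K P → LinearMap V V
  action (con a)  = scale a
  action (var τ)  = X τ
  action (p +ᴿ q) = linear (λ x → ⟦ action p ⟧ x +ᴹ ⟦ action q ⟧ x)
    (λ x≈y → +ᴹ-cong (⟦⟧-cong (action p) x≈y) (⟦⟧-cong (action q) x≈y))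
    (λ x y → ≈ᴹ-trans (+ᴹ-cong (+ᴹ-homo (action p) x y) (+ᴹ-homo (action q) x y)) (interchange _ _ _ _))
    (λ a x → ≈ᴹ-trans (+ᴹ-cong (*ₗ-homo (action p) a x) (*ₗ-homo (action q) a x)) (≈ᴹ-sym (*ₗ-distribˡ a _ _)))
  action (p *ᴿ q) = action p ∘ₗ action q
  action (-ᴿ p)   = scale (K.- K.1#) ∘ₗ action p

  private
    commutes : (Y : LinearMap V V) → (∀ τ x → ⟦ Y ⟧ (⟦ X τ ⟧ x) ≈ᴹ ⟦ X τ ⟧ (⟦ Y ⟧ x)) →
               ∀ p x → ⟦ Y ⟧ (⟦ action p ⟧ x) ≈ᴹ ⟦ action p ⟧ (⟦ Y ⟧ x)
    commutes Y YX (con a)  x = *ₗ-homo Y a x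
    commutes Y YX (var τ)  x = YX τ x
    commutes Y YX (p +ᴿ q) x = ≈ᴹ-trans (+ᴹ-homo Y _ _) (+ᴹ-cong (commutes Y YX p x) (commutes Y YX q x))
    commutes Y YX (p *ᴿ q) x = ≈ᴹ-trans (commutes Y YX p _) (⟦⟧-cong (action p) (commutes Y YX q x))
    commutes Y YX (-ᴿ p)   x = ≈ᴹ-trans (*ₗ-homo Y _ _) (*ₗ-congˡ (commutes Y YX p x))

  -- `commutes` is used twice: first each `X τ` commutes with `action p`, and therefore `action p`
  -- commutes with every polynomial.
  action-comm : ∀ p q x → ⟦ action p ⟧ (⟦ action q ⟧ x) ≈ᴹ ⟦ action q ⟧ (⟦ action p ⟧ x)
  action-comm p = commutes (action p) (λ τ x → ≈ᴹ-sym (commutes (X τ) (X-comm τ) p x))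

  private
    neg≈ : ∀ p x → ⟦ action (-ᴿ p) ⟧ x ≈ᴹ -ᴹ ⟦ action p ⟧ x
    neg≈ p x = -1*≈-ᴹ V _

  -- Induction on the derivation of the congruence. The commuting of the operators enters in the
  -- case `*-comm`; the other axioms are module laws or linearity.
  action-resp : ∀ {p q} → _≈ᴿ_ K P p q → ∀ x → ⟦ action p ⟧ x ≈ᴹ ⟦ action q ⟧ x
  action-resp ≈ᴿ-refl            x = ≈ᴹ-refl
  action-resp (≈ᴿ-sym e)         x = ≈ᴹ-sym (action-resp e x)
  action-resp (≈ᴿ-trans e e′)    x = ≈ᴹ-trans (action-resp e x) (action-resp e′ x)
  action-resp (+-cong e e′)      x = +ᴹ-cong (action-resp e x) (action-resp e′ x)
  action-resp (*-cong {p} e e′)  x = ≈ᴹ-trans (⟦⟧-cong (action p) (action-resp e′ x)) (action-resp e _)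
  action-resp (-‿cong e)         x = *ₗ-congˡ (action-resp e x)
  action-resp (+-assoc p q s)    x = +ᴹ-assoc _ _ _
  action-resp (+-comm p q)       x = +ᴹ-comm _ _
  action-resp (+-identityˡ p)    x = ≈ᴹ-trans (+ᴹ-congʳ (*ₗ-zeroˡ x)) (+ᴹ-identityˡ _)
  action-resp (-‿inverseˡ p)     x = ≈ᴹ-trans (+ᴹ-congʳ (neg≈ p x)) (≈ᴹ-trans (-ᴹ‿inverseˡ _) (≈ᴹ-sym (*ₗ-zeroˡ x)))
  action-resp (*-assoc p q s)    x = ≈ᴹ-refl
  action-resp (*-comm p q)       x = action-comm p q x
  action-resp (*-identityˡ p)    x = *ₗ-identityˡ _
  action-resp (distribˡ p q s)   x = +ᴹ-homo (action p) _ _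
  action-resp (con-cong e)       x = *ₗ-congʳ e
  action-resp (con-+ a b)        x = *ₗ-distribʳ x a b
  action-resp (con-* a b)        x = *ₗ-assoc a b x

  private
    abstract
      isPolynomialModule : IsLeftModule (R K P) _≈ᴹ_ _+ᴹ_ 0ᴹ -ᴹ_ (λ p x → ⟦ action p ⟧ x)
      isPolynomialModule = record
        { isLeftSemimodule = record
          { +ᴹ-isCommutativeMonoid = +ᴹ-isCommutativeMonoid
          ; isPreleftSemimodule = record
            { *ₗ-cong      = λ {p} e x≈y → ≈ᴹ-trans (⟦⟧-cong (action p) x≈y) (action-resp e _)
            ; *ₗ-zeroˡ     = *ₗ-zeroˡ
            ; *ₗ-distribʳ  = λ x p q → ≈ᴹ-refl
            ; *ₗ-identityˡ = *ₗ-identityˡ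
            ; *ₗ-assoc     = λ p q x → ≈ᴹ-refl
            ; *ₗ-zeroʳ     = λ p → 0ᴹ-homo (action p)
            ; *ₗ-distribˡ  = λ p x y → +ᴹ-homo (action p) x y
            }
          }
        ; -ᴹ‿cong    = -ᴹ‿cong
        ; -ᴹ‿inverse = -ᴹ‿inverse
        }

  polynomialModule : LeftModule (R K P) ℓ ℓ
  polynomialModule = record { isLeftModule = isPolynomialModule }

-- An element of degree u of the module of a cosheaf W is a compatible family of elements of the
-- stalks W_σ for σ above the chain supp u, that is, an element of the stalk at the top of u.
-- Families make multiplication by x_τ a mere shift in u.
module FromCosheaf {ℓ : Level} (em : ExcludedMiddle ℓ) (K : Field ℓ) (P : FinitePoset ℓ) (W : Cosheaf K P) where

  open FinitePoset P
  open Exponents K P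
  open Cosheaf W
  private
    module K = Field K
    module W σ = LeftModule (stalk σ)

    𝒊 : Exponent → Degree K P
    𝒊 = ι K P

  Family : LeftModule K.ring ℓ ℓ
  Family = ΠModule {I = Exponent} (λ _ → ΠModule stalk)

  module Family = LeftModule Family

  extend : ∀ {σ τ} → .(σ ≤ τ) → W.Carrierᴹ σ → W.Carrierᴹ τ
  extend σ≤τ = LinearMap.⟦_⟧ (ext σ≤τ)

  -- `vanishes` fixes the otherwise meaningless values, so that equality of sections can be
  -- pointwise equality of families; `support` makes the module a direct sum of its degrees and not
  -- a product.
  record IsSection (g : Family.Carrierᴹ) : Set ℓ where
    field
      respects   : ∀ {u v} → u ≗ v → ∀ σ → W._≈ᴹ_ σ (g u σ) (g v σ)
      vanishes   : ∀ {u σ} → ¬ Below u σ → W._≈ᴹ_ σ (g u σ) (W.0ᴹ σ)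
      compatible : ∀ {u σ ρ} → Below u σ → (σ≤ρ : σ ≤ ρ) → W._≈ᴹ_ ρ (extend σ≤ρ (g u σ)) (g u ρ)
      support    : ∃[ L ] ∀ u → ¬ Any (u ≗_) L → ∀ σ → W._≈ᴹ_ σ (g u σ) (W.0ᴹ σ)

  Section : Set ℓ
  Section = ∃ IsSection

  private
    module S (g : Section) = IsSection (proj₂ g)

    abstract
      0-isSection : IsSection Family.0ᴹ
      0-isSection = record
        { respects   = λ _ σ → W.≈ᴹ-refl σ
        ; vanishes   = λ {_} {σ} _ → W.≈ᴹ-refl σ
        ; compatible = λ _ σ≤ρ → LinearMap.0ᴹ-homo (ext σ≤ρ)
        ; support    = [] , λ _ _ σ → W.≈ᴹ-refl σ
        }

      +-isSection : ∀ (g h : Section) → IsSection (proj₁ g Family.+ᴹ proj₁ h)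
      +-isSection g h = record
        { respects   = λ u≗v σ → W.+ᴹ-cong σ (S.respects g u≗v σ) (S.respects h u≗v σ)
        ; vanishes   = λ {_} {σ} ¬b → W.≈ᴹ-trans σ (W.+ᴹ-cong σ (S.vanishes g ¬b) (S.vanishes h ¬b)) (W.+ᴹ-identityˡ σ _)
        ; compatible = λ {_} {σ} {ρ} b σ≤ρ → W.≈ᴹ-trans ρ (LinearMap.+ᴹ-homo (ext σ≤ρ) _ _)
            (W.+ᴹ-cong ρ (S.compatible g b σ≤ρ) (S.compatible h b σ≤ρ))
        ; support    = proj₁ (S.support g) ++ proj₁ (S.support h) , λ u u∉ σ → W.≈ᴹ-trans σ
            (W.+ᴹ-cong σ (proj₂ (S.support g) u (u∉ ∘ ++⁺ˡ) σ) (proj₂ (S.support h) u (u∉ ∘ ++⁺ʳ (proj₁ (S.support g))) σ))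
            (W.+ᴹ-identityˡ σ _)
        }

      *-isSection : ∀ a (g : Section) → IsSection (a Family.*ₗ proj₁ g)
      *-isSection a g = record
        { respects   = λ u≗v σ → W.*ₗ-congˡ σ (S.respects g u≗v σ)
        ; vanishes   = λ {_} {σ} ¬b → W.≈ᴹ-trans σ (W.*ₗ-congˡ σ (S.vanishes g ¬b)) (W.*ₗ-zeroʳ σ a)
        ; compatible = λ {_} {σ} {ρ} b σ≤ρ → W.≈ᴹ-trans ρ (LinearMap.*ₗ-homo (ext σ≤ρ) _ _)
            (W.*ₗ-congˡ ρ (S.compatible g b σ≤ρ))
        ; support    = proj₁ (S.support g) , λ u u∉ σ →
            W.≈ᴹ-trans σ (W.*ₗ-congˡ σ (proj₂ (S.support g) u u∉ σ)) (W.*ₗ-zeroʳ σ a)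
        }

    0ˢ : Section
    0ˢ = Family.0ᴹ , 0-isSection

    infixl 6 _+ˢ_
    _+ˢ_ : Section → Section → Section
    g +ˢ h = (proj₁ g Family.+ᴹ proj₁ h) , +-isSection g h

    infixr 7 _*ˢ_
    _*ˢ_ : K.Carrier → Section → Section
    a *ˢ g = (a Family.*ₗ proj₁ g) , *-isSection a g

  infix 4 _≈ˢ_
  _≈ˢ_ : Section → Section → Set ℓ
  g ≈ˢ h = proj₁ g Family.≈ᴹ proj₁ h

  private
    abstract
      isSectionSpace : IsLeftModule K.ring _≈ˢ_ _+ˢ_ 0ˢ (K.- K.1# *ˢ_) _*ˢ_
      isSectionSpace = LeftModule.isLeftModule (induced Family {C = Section} proj₁ _+ˢ_ _*ˢ_ 0ˢ (K.- K.1# *ˢ_)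
        (λ _ _ _ σ → W.≈ᴹ-refl σ) (λ _ _ _ σ → W.≈ᴹ-refl σ) (λ _ σ → W.≈ᴹ-refl σ) (λ g → -1*≈-ᴹ Family (proj₁ g)))

  sectionSpace : LeftModule K.ring ℓ ℓ
  sectionSpace = record { isLeftModule = isSectionSpace }

  private
    choose : ∀ {A : Set ℓ} σ → Dec A → (A → W.Carrierᴹ σ) → W.Carrierᴹ σ
    choose σ (yes a) f = f a
    choose σ (no _)  f = W.0ᴹ σ

    choose-yes : ∀ {A : Set ℓ} {σ} (a? : Dec A) {f : A → W.Carrierᴹ σ} {x} → (∀ a → W._≈ᴹ_ σ (f a) x) → A →
                 W._≈ᴹ_ σ (choose σ a? f) x
    choose-yes (yes a) p _ = p a
    choose-yes (no ¬a) p a = ⊥-elim (¬a a)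

    choose-no : ∀ {A : Set ℓ} {σ} (a? : Dec A) {f : A → W.Carrierᴹ σ} → (∀ a → W._≈ᴹ_ σ (f a) (W.0ᴹ σ)) →
                W._≈ᴹ_ σ (choose σ a? f) (W.0ᴹ σ)
    choose-no (yes a) p = p a
    choose-no {σ = σ} (no _)  p = W.≈ᴹ-refl σ

  module Concentrated (v : Exponent) (w : ∀ σ → W.Carrierᴹ σ)
                      (w-vanishes : ∀ {σ} → ¬ Below v σ → W._≈ᴹ_ σ (w σ) (W.0ᴹ σ))
                      (w-compatible : ∀ {σ ρ} → Below v σ → (σ≤ρ : σ ≤ ρ) → W._≈ᴹ_ ρ (extend σ≤ρ (w σ)) (w ρ)) where

    private
      g : Family.Carrierᴹ
      g u σ = choose σ (em {u ≗ v}) (λ _ → w σ)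

    concentrated-at : ∀ {u} → u ≗ v → ∀ σ → W._≈ᴹ_ σ (g u σ) (w σ)
    concentrated-at u≗v σ = choose-yes em (λ _ → W.≈ᴹ-refl σ) u≗v

    concentrated-off : ∀ {u} → ¬ (u ≗ v) → ∀ σ → W._≈ᴹ_ σ (g u σ) (W.0ᴹ σ)
    concentrated-off u≢v σ = choose-no em (λ u≗v → ⊥-elim (u≢v u≗v))

    concentrated : Section
    concentrated = g , record
      { respects   = λ {u} {u′} u≗u′ σ → respects u≗u′ σ em
      ; vanishes   = λ ¬b → choose-no em (λ u≗v → w-vanishes (λ b → ¬b (Below-resp (≡.sym ∘ u≗v) b)))
      ; compatible = λ b σ≤ρ → compatible b σ≤ρ em
      ; support    = v ∷ [] , λ u u∉ σ → concentrated-off (u∉ ∘ here) σ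
      }
      where
      respects : ∀ {u u′} → u ≗ u′ → ∀ σ → Dec (u ≗ v) → W._≈ᴹ_ σ (g u σ) (g u′ σ)
      respects u≗u′ σ (yes u≗v) = W.≈ᴹ-trans σ (concentrated-at u≗v σ)
        (W.≈ᴹ-sym σ (concentrated-at (λ x → ≡.trans (≡.sym (u≗u′ x)) (u≗v x)) σ))
      respects u≗u′ σ (no u≢v)  = W.≈ᴹ-trans σ (concentrated-off u≢v σ)
        (W.≈ᴹ-sym σ (concentrated-off (λ u′≗v → u≢v (λ x → ≡.trans (u≗u′ x) (u′≗v x))) σ))

      compatible : ∀ {u σ ρ} → Below u σ → (σ≤ρ : σ ≤ ρ) → Dec (u ≗ v) → W._≈ᴹ_ ρ (extend σ≤ρ (g u σ)) (g u ρ)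
      compatible {u} {σ} {ρ} b σ≤ρ (yes u≗v) = W.≈ᴹ-trans ρ (LinearMap.⟦⟧-cong (ext σ≤ρ) (concentrated-at u≗v σ))
        (W.≈ᴹ-trans ρ (w-compatible (Below-resp u≗v b) σ≤ρ) (W.≈ᴹ-sym ρ (concentrated-at u≗v ρ)))
      compatible {u} {σ} {ρ} b σ≤ρ (no u≢v)  = W.≈ᴹ-trans ρ (LinearMap.⟦⟧-cong (ext σ≤ρ) (concentrated-off u≢v σ))
        (W.≈ᴹ-trans ρ (LinearMap.0ᴹ-homo (ext σ≤ρ)) (W.≈ᴹ-sym ρ (concentrated-off u≢v ρ)))

    concentrated-Homog : ∀ u → ¬ (𝒊 u ≗ 𝒊 v) → ∀ σ → W._≈ᴹ_ σ (g u σ) (W.0ᴹ σ)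
    concentrated-Homog u u≢v = concentrated-off (λ u≗v → u≢v (λ x → ≡.cong +_ (u≗v x)))

  open Concentrated public

  -- x_τ must divide x^u, and `u` itself must be bounded by σ: adding τ to the chain of the quotient
  -- may destroy the chain or exceed σ, and then the value has to be 0.
  Shiftable : P̂ → Exponent → Carrier → Set ℓ
  Shiftable τ u σ = (Σ[ v ∈ Exponent ] v ⊹ unit K P τ ≗ u) × Below u σ

  private
    shiftF : P̂ → Family.Carrierᴹ → Family.Carrierᴹ
    shiftF τ g u σ = choose σ (em {Shiftable τ u σ}) (λ ((v , _) , _) → g v σ)

    ⊹-cancelʳ : ∀ {u v} w → u ⊹ w ≗ v ⊹ w → u ≗ v
    ⊹-cancelʳ {u} {v} w eq σ = ℕ.+-cancelʳ-≡ (w σ) (u σ) (v σ) (eq σ)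

    Below-summand : ∀ {u v σ} w → v ⊹ w ≗ u → Below u σ → Below v σ
    Below-summand {u} {v} w eq b = Below-⊆ (supp-resp eq ∘ supp-⊹ˡ v w) b

  -- The quotient exponent is unique by cancellation, so the value does not depend on the witness
  -- found by `em`.
  shift-yes : ∀ τ (g : Section) {u v σ} → v ⊹ unit K P τ ≗ u → Below u σ → W._≈ᴹ_ σ (shiftF τ (proj₁ g) u σ) (proj₁ g v σ)
  shift-yes τ g {u} {v} {σ} eq b = choose-yes em
    (λ ((v′ , eq′) , _) → S.respects g (⊹-cancelʳ (unit K P τ) (λ x → ≡.trans (eq′ x) (≡.sym (eq x)))) σ) ((v , eq) , b)

  shift-no : ∀ τ g {u σ} → ¬ Shiftable τ u σ → W._≈ᴹ_ σ (shiftF τ g u σ) (W.0ᴹ σ)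
  shift-no τ g ¬s = choose-no em (λ s → ⊥-elim (¬s s))

  private
    abstract
      shift-isSection : ∀ τ (g : Section) → IsSection (shiftF τ (proj₁ g))
      shift-isSection τ g = record
        { respects   = λ u≗u′ σ → respects u≗u′ σ em
        ; vanishes   = λ ¬b → shift-no τ (proj₁ g) (¬b ∘ proj₂)
        ; compatible = λ b σ≤ρ → compatible b σ≤ρ em
        ; support    = map (_⊹ unit K P τ) (proj₁ (S.support g)) , λ u u∉ σ → choose-no em λ ((v , eq) , _) →
            proj₂ (S.support g) v (λ v∈ → u∉ (map⁺ (Any.map
              (λ v≗v′ x → ≡.trans (≡.sym (eq x)) (≡.cong (ℕ._+ unit K P τ x) (v≗v′ x))) v∈))) σ
        }
        where
        respects : ∀ {u u′} → u ≗ u′ → ∀ σ → Dec (Shiftable τ u σ) → W._≈ᴹ_ σ (shiftF τ (proj₁ g) u σ) (shiftF τ (proj₁ g) u′ σ)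
        respects u≗u′ σ (yes ((v , eq) , b)) = W.≈ᴹ-trans σ (shift-yes τ g eq b)
          (W.≈ᴹ-sym σ (shift-yes τ g (λ x → ≡.trans (eq x) (u≗u′ x)) (Below-resp u≗u′ b)))
        respects u≗u′ σ (no ¬s) = W.≈ᴹ-trans σ (shift-no τ (proj₁ g) ¬s) (W.≈ᴹ-sym σ (shift-no τ (proj₁ g)
          λ ((v , eq) , b) → ¬s ((v , λ x → ≡.trans (eq x) (≡.sym (u≗u′ x))) , Below-resp (≡.sym ∘ u≗u′) b)))

        compatible : ∀ {u σ ρ} → Below u σ → (σ≤ρ : σ ≤ ρ) → Dec (Σ[ v ∈ Exponent ] v ⊹ unit K P τ ≗ u) →
                     W._≈ᴹ_ ρ (extend σ≤ρ (shiftF τ (proj₁ g) u σ)) (shiftF τ (proj₁ g) u ρ)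
        compatible {u} {σ} {ρ} b σ≤ρ (yes (v , eq)) = W.≈ᴹ-trans ρ (LinearMap.⟦⟧-cong (ext σ≤ρ) (shift-yes τ g eq b))
          (W.≈ᴹ-trans ρ (S.compatible g (Below-summand (unit K P τ) eq b) σ≤ρ)
            (W.≈ᴹ-sym ρ (shift-yes τ g eq (Below-≤ b σ≤ρ))))
        compatible {u} {σ} {ρ} b σ≤ρ (no ∄v) = W.≈ᴹ-trans ρ (LinearMap.⟦⟧-cong (ext σ≤ρ) (shift-no τ (proj₁ g) (∄v ∘ proj₁)))
          (W.≈ᴹ-trans ρ (LinearMap.0ᴹ-homo (ext σ≤ρ)) (W.≈ᴹ-sym ρ (shift-no τ (proj₁ g) (∄v ∘ proj₁))))

  shift : P̂ → Section → Section
  shift τ g = shiftF τ (proj₁ g) , shift-isSection τ g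

  private
    abstract
      shift-cong : ∀ τ g h → g Family.≈ᴹ h → shiftF τ g Family.≈ᴹ shiftF τ h
      shift-cong τ g h g≈h u σ with em {Shiftable τ u σ}
      ... | yes ((v , _) , _) = g≈h v σ
      ... | no _              = W.≈ᴹ-refl σ

      shift-+ : ∀ τ g h → shiftF τ (g Family.+ᴹ h) Family.≈ᴹ (shiftF τ g Family.+ᴹ shiftF τ h)
      shift-+ τ g h u σ with em {Shiftable τ u σ}
      ... | yes _ = W.≈ᴹ-refl σ
      ... | no _  = W.≈ᴹ-sym σ (W.+ᴹ-identityˡ σ _)

      shift-* : ∀ τ a g → shiftF τ (a Family.*ₗ g) Family.≈ᴹ (a Family.*ₗ shiftF τ g)
      shift-* τ a g u σ with em {Shiftable τ u σ}
      ... | yes _ = W.≈ᴹ-refl σ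
      ... | no _  = W.≈ᴹ-sym σ (W.*ₗ-zeroʳ σ a)

    shiftMap : P̂ → LinearMap sectionSpace sectionSpace
    shiftMap τ = linear (shift τ) (λ {g} {h} → shift-cong τ (proj₁ g) (proj₁ h))
      (λ g h → shift-+ τ (proj₁ g) (proj₁ h)) (λ a g → shift-* τ a (proj₁ g))

    Shiftable₂ : P̂ → P̂ → Exponent → Carrier → Set ℓ
    Shiftable₂ τ τ′ u σ = (Σ[ v ∈ Exponent ] v ⊹ unit K P τ′ ⊹ unit K P τ ≗ u) × Below u σ

    Shiftable₂-swap : ∀ {τ τ′ u σ} → Shiftable₂ τ τ′ u σ → Shiftable₂ τ′ τ u σ
    Shiftable₂-swap {τ} {τ′} ((v , eq) , b) = (v , λ x → ≡.trans (CommutativeSemigroupProperties.xy∙z≈xz∙y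
      ℕ.+-commutativeSemigroup (v x) (unit K P τ x) (unit K P τ′ x)) (eq x)) , b

    shift₂-yes : ∀ τ τ′ g {u σ} (s : Shiftable₂ τ τ′ u σ) →
                 W._≈ᴹ_ σ (shiftF τ (proj₁ (shift τ′ g)) u σ) (proj₁ g (proj₁ (proj₁ s)) σ)
    shift₂-yes τ τ′ g {u} {σ} ((v , eq) , b) = W.≈ᴹ-trans σ (shift-yes τ (shift τ′ g) eq b)
      (shift-yes τ′ g (λ _ → ≡.refl) (Below-summand (unit K P τ) eq b))

    shift₂-no : ∀ τ τ′ g {u σ} → ¬ Shiftable₂ τ τ′ u σ → W._≈ᴹ_ σ (shiftF τ (shiftF τ′ g) u σ) (W.0ᴹ σ)
    shift₂-no τ τ′ g ¬s = choose-no em λ ((v , eq) , b) → shift-no τ′ g λ ((v′ , eq′) , _) →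
      ¬s ((v′ , λ x → ≡.trans (≡.cong (ℕ._+ unit K P τ x) (eq′ x)) (eq x)) , b)

    abstract
      -- Both orders read `g` at the exponent left after removing τ and τ′ from `u`, and both give 0
      -- if there is no such exponent.
      shift-comm : ∀ τ τ′ g u σ → W._≈ᴹ_ σ (proj₁ (shift τ (shift τ′ g)) u σ) (proj₁ (shift τ′ (shift τ g)) u σ)
      shift-comm τ τ′ g u σ with em {Shiftable₂ τ τ′ u σ}
      ... | yes s = W.≈ᴹ-trans σ (shift₂-yes τ τ′ g s) (W.≈ᴹ-sym σ (shift₂-yes τ′ τ g (Shiftable₂-swap {τ} {τ′} s)))
      ... | no ¬s = W.≈ᴹ-trans σ (shift₂-no τ τ′ (proj₁ g) ¬s)
                      (W.≈ᴹ-sym σ (shift₂-no τ′ τ (proj₁ g) (¬s ∘ Shiftable₂-swap {τ′} {τ})))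

  -- This is `action`, but its normal forms mention W only, which keeps conversion checking cheap.
  infixr 7 _·_
  _·_ : Polynomial K P → Section → Section
  con a    · g = a *ˢ g
  var τ    · g = shift τ g
  (p +ᴿ q) · g = p · g +ˢ q · g
  (p *ᴿ q) · g = p · q · g
  (-ᴿ p)   · g = K.- K.1# *ˢ p · g

  private
    abstract
      isSectionModule : IsLeftModule (R K P) _≈ˢ_ _+ˢ_ 0ˢ (K.- K.1# *ˢ_) _·_
      isSectionModule = LeftModule.isLeftModule (induced A.polynomialModule (λ g → g) _+ˢ_ _·_ 0ˢ (K.- K.1# *ˢ_)
        (λ g h → ≈ˢ-refl {g +ˢ h}) (λ p g → ≈ˢ-reflexive (·≡action p g)) (≈ˢ-refl {0ˢ}) (λ g → ≈ˢ-refl {K.- K.1# *ˢ g}))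
        where
        module A = CommutingAction K P sectionSpace shiftMap shift-comm

        ≈ˢ-refl : ∀ {g} → g ≈ˢ g
        ≈ˢ-refl {g} = LeftModule.≈ᴹ-refl sectionSpace {g}

        ≈ˢ-reflexive : ∀ {g h} → g ≡ h → g ≈ˢ h
        ≈ˢ-reflexive {g} ≡.refl = ≈ˢ-refl {g}

        ·≡action : ∀ p g → p · g ≡ LinearMap.⟦_⟧ (A.action p) g
        ·≡action (con a)  g = ≡.refl
        ·≡action (var τ)  g = ≡.refl
        ·≡action (p +ᴿ q) g = ≡.cong₂ _+ˢ_ (·≡action p g) (·≡action q g)
        ·≡action (p *ᴿ q) g = ≡.trans (≡.cong (p ·_) (·≡action q g)) (·≡action p _)
        ·≡action (-ᴿ p)   g = ≡.cong (K.- K.1# *ˢ_) (·≡action p g)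

  polynomialModule : LeftModule (R K P) ℓ ℓ
  polynomialModule = record { isLeftModule = isSectionModule }

  module 𝕄 = LeftModule polynomialModule

  ·-resp : ∀ {p q} → _≈ᴿ_ K P p q → ∀ g → p · g ≈ˢ q · g
  ·-resp p≈q g = 𝕄.*ₗ-congʳ {g} p≈q

  Homog : Degree K P → Pred Section ℓ
  Homog d g = ∀ u → ¬ (𝒊 u ≗ d) → ∀ σ → W._≈ᴹ_ σ (proj₁ g u σ) (W.0ᴹ σ)

  private
    infixl 6 _⊕′_
    _⊕′_ : Degree K P → Degree K P → Degree K P
    _⊕′_ = _⊕_ K P

  abstract
    Homog-resp : ∀ {d e} g h → d ≗ e → g 𝕄.≈ᴹ h → Homog d g → Homog e h
    Homog-resp g h d≗e g≈h g∈ u u≢e σ = W.≈ᴹ-trans σ (W.≈ᴹ-sym σ (g≈h u σ))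
      (g∈ u (λ u≗d → u≢e (λ x → ≡.trans (u≗d x) (d≗e x))) σ)

    Homog-* : ∀ {d e p} → Homogeneous K P d p → ∀ g → Homog e g → Homog (d ⊕′ e) (p 𝕄.*ₗ g)
    Homog-* (con a) g g∈ u u≢ σ = W.≈ᴹ-trans σ
      (W.*ₗ-congˡ σ (g∈ u (λ u≗e → u≢ (λ x → ≡.trans (u≗e x) (≡.sym (ℤ.+-identityˡ _)))) σ)) (W.*ₗ-zeroʳ σ a)
    Homog-* (var τ) g g∈ u u≢ σ = choose-no em λ ((v , eq) , _) → g∈ v (λ v≗e → u≢ λ x →
      ≡.trans (≡.cong +_ (≡.sym (eq x))) (≡.trans (ℤ.+-comm (𝒊 v x) (𝒊 (unit K P τ) x)) (≡.cong (λ z → 𝒊 (unit K P τ) x ℤ.+ z) (v≗e x)))) σ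
    Homog-* zero    g g∈ u u≢ σ = W.*ₗ-zeroˡ σ _
    Homog-* (add {p = p} {q} hp hq) g g∈ u u≢ σ = W.≈ᴹ-trans σ
      (W.+ᴹ-cong σ (Homog-* hp g g∈ u u≢ σ) (Homog-* hq g g∈ u u≢ σ)) (W.+ᴹ-identityˡ σ _)
    Homog-* (neg hp) g g∈ u u≢ σ = W.≈ᴹ-trans σ (W.*ₗ-congˡ σ (Homog-* hp g g∈ u u≢ σ)) (W.*ₗ-zeroʳ σ _)
    Homog-* (mul {d} {d′} {p} {q} hp hq) g g∈ = Homog-resp (p 𝕄.*ₗ (q 𝕄.*ₗ g)) (p 𝕄.*ₗ (q 𝕄.*ₗ g))
      (λ x → ≡.sym (ℤ.+-assoc (d x) (d′ x) _)) (λ _ σ → W.≈ᴹ-refl σ) (Homog-* hp (q 𝕄.*ₗ g) (Homog-* hq g g∈))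
    Homog-* (resp {p = p} {q} d≗d′ p≈q hp) g g∈ = Homog-resp (p 𝕄.*ₗ g) (q 𝕄.*ₗ g)
      (λ x → ≡.cong (ℤ._+ _) (d≗d′ x)) (·-resp p≈q g) (Homog-* hp g g∈)

  private
    module Restrict (v : Exponent) (g : Section) where
      restrict : Section
      restrict = concentrated v (proj₁ g v) (S.vanishes g) (S.compatible g)

      -- Subtracting the part of degree `v` takes `v` off the support list, which drives the
      -- recursion of `section-induction`.
      remove : Section
      remove = g +ˢ (K.- K.1#) *ˢ restrict

      restrict+remove : g 𝕄.≈ᴹ (restrict 𝕄.+ᴹ remove)
      restrict+remove = 𝕄.≈ᴹ-trans {g} {restrict +ˢ (𝕄.-ᴹ restrict +ˢ g)} {restrict +ˢ remove}
        (𝕄.≈ᴹ-trans {g} {(restrict +ˢ 𝕄.-ᴹ restrict) +ˢ g} {restrict +ˢ (𝕄.-ᴹ restrict +ˢ g)}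
          (𝕄.≈ᴹ-sym {(restrict +ˢ 𝕄.-ᴹ restrict) +ˢ g} {g} (𝕄.≈ᴹ-trans {(restrict +ˢ 𝕄.-ᴹ restrict) +ˢ g} {0ˢ +ˢ g} {g}
            (𝕄.+ᴹ-congʳ {g} {restrict +ˢ 𝕄.-ᴹ restrict} {0ˢ} (𝕄.-ᴹ‿inverseʳ restrict)) (𝕄.+ᴹ-identityˡ g)))
          (𝕄.+ᴹ-assoc restrict (𝕄.-ᴹ restrict) g))
        (𝕄.+ᴹ-congˡ {restrict} {𝕄.-ᴹ restrict +ˢ g} {remove} (𝕄.+ᴹ-comm (𝕄.-ᴹ restrict) g))

      remove-at : ∀ {u} → u ≗ v → ∀ σ → W._≈ᴹ_ σ (proj₁ remove u σ) (W.0ᴹ σ)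
      remove-at u≗v σ = W.≈ᴹ-trans σ (W.+ᴹ-congˡ σ (W.≈ᴹ-trans σ (-1*≈-ᴹ (stalk σ) _)
          (W.-ᴹ‿cong σ (W.≈ᴹ-trans σ (concentrated-at v (proj₁ g v) (S.vanishes g) (S.compatible g) u≗v σ)
            (S.respects g (≡.sym ∘ u≗v) σ)))))
        (W.-ᴹ‿inverseʳ σ _)

      remove-off : ∀ {u} → ¬ (u ≗ v) → ∀ σ → W._≈ᴹ_ σ (proj₁ remove u σ) (proj₁ g u σ)
      remove-off u≢v σ = W.≈ᴹ-trans σ (W.+ᴹ-congˡ σ (W.≈ᴹ-trans σ
          (W.*ₗ-congˡ σ (concentrated-off v (proj₁ g v) (S.vanishes g) (S.compatible g) u≢v σ)) (W.*ₗ-zeroʳ σ _)))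
        (W.+ᴹ-identityʳ σ _)

  open Restrict using (restrict; remove; restrict+remove; remove-at; remove-off)

  -- Every section is a finite sum of homogeneous ones.
  section-induction : ∀ {q} (Q : Pred Section q) → (∀ g h → g 𝕄.≈ᴹ h → Q g → Q h) → Q 𝕄.0ᴹ →
    (∀ g h → Q g → Q h → Q (g 𝕄.+ᴹ h)) → (∀ v g → Homog (𝒊 v) g → Q g) → ∀ g → Q g
  section-induction Q Q-resp Q-0 Q-+ Q-homog g = on-support (proj₁ (S.support g)) g (proj₂ (S.support g))
    where
    on-support : ∀ L g → (∀ u → ¬ Any (u ≗_) L → ∀ σ → W._≈ᴹ_ σ (proj₁ g u σ) (W.0ᴹ σ)) → Q g
    on-support []      g g≈0 = Q-resp 𝕄.0ᴹ g (λ u σ → W.≈ᴹ-sym σ (g≈0 u (λ ()) σ)) Q-0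
    on-support (v ∷ L) g g≈0 = Q-resp (restrict v g +ˢ remove v g) g
      (𝕄.≈ᴹ-sym {g} {restrict v g +ˢ remove v g} (restrict+remove v g))
      (Q-+ (restrict v g) (remove v g)
        (Q-homog v (restrict v g) (concentrated-Homog v (proj₁ g v) (S.vanishes g) (S.compatible g)))
        (on-support L (remove v g) λ u u∉ σ → remove≈0 u u∉ σ em))
      where
      remove≈0 : ∀ u → ¬ Any (u ≗_) L → ∀ σ → Dec (u ≗ v) → W._≈ᴹ_ σ (proj₁ (remove v g) u σ) (W.0ᴹ σ)
      remove≈0 u u∉ σ (yes u≗v) = remove-at v g u≗v σ
      remove≈0 u u∉ σ (no u≢v)  = W.≈ᴹ-trans σ (remove-off v g u≢v σ)
        (g≈0 u (λ { (here u≗v) → u≢v u≗v ; (there u∈) → u∉ u∈ }) σ)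

  private
    open MonoidSum 𝕄.+ᴹ-monoid using (sum)

    HomogTerm : Set ℓ
    HomogTerm = Σ[ d ∈ Degree K P ] ∃ (Homog d)

    section : HomogTerm → Section
    section t = proj₁ (proj₂ t)

    total : List HomogTerm → Section
    total L = sum (section ∘ lookup L)

    total-++ : ∀ L L′ → total (L ++ L′) 𝕄.≈ᴹ (total L 𝕄.+ᴹ total L′)
    total-++ []      L′ = 𝕄.≈ᴹ-sym {0ˢ +ˢ total L′} {total L′} (𝕄.+ᴹ-identityˡ (total L′))
    total-++ (t ∷ L) L′ u σ = W.≈ᴹ-trans σ (W.+ᴹ-congˡ σ (total-++ L L′ u σ)) (W.≈ᴹ-sym σ (W.+ᴹ-assoc σ _ _ _))

    homogeneous-sum : ∀ g → ∃[ L ] g 𝕄.≈ᴹ total L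
    homogeneous-sum = section-induction (λ g → ∃[ L ] g 𝕄.≈ᴹ total L)
      (λ g h g≈h (L , p) → L , λ u σ → W.≈ᴹ-trans σ (W.≈ᴹ-sym σ (g≈h u σ)) (p u σ))
      ([] , λ _ σ → W.≈ᴹ-refl σ)
      (λ g h (L , p) (L′ , q) → L ++ L′ , λ u σ →
        W.≈ᴹ-trans σ (W.+ᴹ-cong σ (p u σ) (q u σ)) (W.≈ᴹ-sym σ (total-++ L L′ u σ)))
      (λ v g g∈ → (𝒊 v , g , g∈) ∷ [] , λ u σ → W.≈ᴹ-sym σ (W.+ᴹ-identityʳ σ _))

    sum-at : ∀ {n} (y : Fin n → Section) u σ →
             W._≈ᴹ_ σ (proj₁ (sum y) u σ) (MonoidSum.sum (W.+ᴹ-monoid σ) (λ i → proj₁ (y i) u σ))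
    sum-at {zero}  y u σ = W.≈ᴹ-refl σ
    sum-at {suc n} y u σ = W.+ᴹ-congˡ σ (sum-at (y ∘ suc) u σ)

    abstract
      -- At a fixed exponent at most one summand can be nonzero, as the degrees are distinct; so the
      -- vanishing sum is that summand's value.
      homogeneous-independent : ∀ {n} (d : Fin n → Degree K P) (y : Fin n → Section) → (∀ {i j} → d i ≗ d j → i ≡ j) →
        (∀ i → Homog (d i) (y i)) → sum y 𝕄.≈ᴹ 𝕄.0ᴹ → ∀ i → y i 𝕄.≈ᴹ 𝕄.0ᴹ
      homogeneous-independent d y d-inj y∈ Σy≈0 i u σ with em {𝒊 u ≗ d i}
      ... | no u≢dᵢ  = y∈ i u u≢dᵢ σ
      ... | yes u≗dᵢ = W.≈ᴹ-trans σ (W.≈ᴹ-sym σ (sum-single (stalk σ) (λ j → proj₁ (y j) u σ) i λ j j≢i →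
            y∈ j u (λ u≗dⱼ → j≢i (d-inj (λ x → ≡.trans (≡.sym (u≗dⱼ x)) (u≗dᵢ x)))) σ))
          (W.≈ᴹ-trans σ (W.≈ᴹ-sym σ (sum-at y u σ)) (Σy≈0 u σ))

  private
    abstract
      homogeneous-span : ∀ g → ∃[ n ] Σ[ d ∈ (Fin n → Degree K P) ] Σ[ y ∈ (Fin n → Section) ]
                         (∀ i → Homog (d i) (y i)) × g 𝕄.≈ᴹ sum y
      homogeneous-span g = let L , p = homogeneous-sum g in
        length L , proj₁ ∘ lookup L , section ∘ lookup L , (λ i → proj₂ (proj₂ (lookup L i))) , p

      Homog-0 : ∀ {d} → Homog d 𝕄.0ᴹ
      Homog-0 _ _ σ = W.≈ᴹ-refl σ

      Homog-+ : ∀ {d} g h → Homog d g → Homog d h → Homog d (g 𝕄.+ᴹ h)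
      Homog-+ g h g∈ h∈ u u≢ σ = W.≈ᴹ-trans σ (W.+ᴹ-cong σ (g∈ u u≢ σ) (h∈ u u≢ σ)) (W.+ᴹ-identityˡ σ _)

      Homog-neg : ∀ {d} g → Homog d g → Homog d (𝕄.-ᴹ g)
      Homog-neg g g∈ u u≢ σ = W.≈ᴹ-trans σ (W.*ₗ-congˡ σ (g∈ u u≢ σ)) (W.*ₗ-zeroʳ σ _)

  gradedModule : GradedModule K P
  gradedModule = record
    { leftModule  = polynomialModule
    ; Component   = Homog
    ; ∈-resp      = λ {_} {_} {g} {h} → Homog-resp g h
    ; 0∈          = Homog-0
    ; +∈          = λ {_} {g} {h} → Homog-+ g h
    ; -∈          = λ {_} {g} → Homog-neg g
    ; *∈          = λ {_} {_} {_} {g} hp g∈ → Homog-* hp g g∈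
    ; span        = homogeneous-span
    ; independent = homogeneous-independent
    }

  Below-δ⁻ : ∀ {σ ρ} → Below (δ σ) ρ → σ ≤ ρ
  Below-δ⁻ {σ} (_ , δ≤ρ) with σ ≟ 0̂
  ... | yes ≡.refl = minimum _
  ... | no σ≢0̂    = δ≤ρ (supp-δ σ≢0̂)

  module Embed (σ : Carrier) (w : W.Carrierᴹ σ) where
    value : ∀ ρ → Dec (σ ≤ ρ) → W.Carrierᴹ ρ
    value ρ σ≤ρ? = choose ρ σ≤ρ? (λ σ≤ρ → extend σ≤ρ w)

    value-yes : ∀ {ρ} (σ≤ρ : σ ≤ ρ) σ≤ρ? → W._≈ᴹ_ ρ (value ρ σ≤ρ?) (extend σ≤ρ w)
    value-yes σ≤ρ σ≤ρ? = choose-yes σ≤ρ? (λ _ → W.≈ᴹ-refl _) σ≤ρ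

    value-compatible : ∀ {ρ ρ′} → Below (δ σ) ρ → (ρ≤ρ′ : ρ ≤ ρ′) → W._≈ᴹ_ ρ′ (extend ρ≤ρ′ (value ρ em)) (value ρ′ em)
    value-compatible {ρ} {ρ′} b ρ≤ρ′ = W.≈ᴹ-trans ρ′ (LinearMap.⟦⟧-cong (ext ρ≤ρ′) (value-yes σ≤ρ em))
      (W.≈ᴹ-trans ρ′ (ext-∘ σ≤ρ ρ≤ρ′ (≤-trans σ≤ρ ρ≤ρ′) w) (W.≈ᴹ-sym ρ′ (value-yes (≤-trans σ≤ρ ρ≤ρ′) em)))
      where σ≤ρ = Below-δ⁻ b

    value-vanishes : ∀ {ρ} → ¬ Below (δ σ) ρ → W._≈ᴹ_ ρ (value ρ em) (W.0ᴹ ρ)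
    value-vanishes ¬b = choose-no em (λ σ≤ρ → ⊥-elim (¬b (Below-δ σ≤ρ)))

    -- Inverse to evaluating sections of degree `δ σ` at σ: compatibility forces the value at every
    -- ρ above σ to be the extension of `w`.
    embed : Section
    embed = concentrated (δ σ) (λ ρ → value ρ em) value-vanishes value-compatible

    embed-Homog : Homog (𝒊 (δ σ)) embed
    embed-Homog = concentrated-Homog (δ σ) (λ ρ → value ρ em) value-vanishes value-compatible

    embed-at : ∀ {u ρ} → u ≗ δ σ → (σ≤ρ : σ ≤ ρ) → W._≈ᴹ_ ρ (proj₁ embed u ρ) (extend σ≤ρ w)
    embed-at {u} {ρ} u≗δ σ≤ρ = W.≈ᴹ-trans ρ
      (concentrated-at (δ σ) (λ ρ → value ρ em) value-vanishes value-compatible u≗δ ρ) (value-yes σ≤ρ em)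

  open Embed using (embed; embed-Homog; embed-at) public

  ≈-onDegree : ∀ v g h → Homog (𝒊 v) g → Homog (𝒊 v) h →
               (∀ σ → Below v σ → W._≈ᴹ_ σ (proj₁ g v σ) (proj₁ h v σ)) → g 𝕄.≈ᴹ h
  ≈-onDegree v g h g∈ h∈ g≈h u σ with em {u ≗ v} | em {Below v σ}
  ... | no u≢v  | _ = W.≈ᴹ-trans σ (g∈ u 𝒊u≢𝒊v σ) (W.≈ᴹ-sym σ (h∈ u 𝒊u≢𝒊v σ))
    where
    𝒊u≢𝒊v : ¬ (𝒊 u ≗ 𝒊 v)
    𝒊u≢𝒊v p = u≢v (λ x → ℤ.+-injective (p x))
  ... | yes u≗v | no ¬b = W.≈ᴹ-trans σ (S.vanishes g (¬b ∘ Below-resp u≗v)) (W.≈ᴹ-sym σ (S.vanishes h (¬b ∘ Below-resp u≗v)))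
  ... | yes u≗v | yes b = W.≈ᴹ-trans σ (S.respects g u≗v σ) (W.≈ᴹ-trans σ (g≈h σ b) (W.≈ᴹ-sym σ (S.respects h u≗v σ)))

  -- Every σ bounding the chain lies above its top ρ, so compatibility determines the value at σ
  -- from the one at ρ.
  ≈-onTop : ∀ v ρ g h → Top v ρ → Homog (𝒊 v) g → Homog (𝒊 v) h →
            W._≈ᴹ_ ρ (proj₁ g v ρ) (proj₁ h v ρ) → g 𝕄.≈ᴹ h
  ≈-onTop v ρ g h (b , top) g∈ h∈ g≈h = ≈-onDegree v g h g∈ h∈ λ σ b′ → let ρ≤σ = below top b′ in
    W.≈ᴹ-trans σ (W.≈ᴹ-sym σ (S.compatible g b ρ≤σ)) (W.≈ᴹ-trans σ (LinearMap.⟦⟧-cong (ext ρ≤σ) g≈h) (S.compatible h b ρ≤σ))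
    where
    below : ρ ≡ 0̂ ⊎ ρ ∈ supp K P v → ∀ {σ} → Below v σ → ρ ≤ σ
    below (inj₁ ≡.refl) b′ = minimum _
    below (inj₂ ρ∈)     b′ = proj₂ b′ ρ∈

  monomial-at : ∀ v g u σ → Below (u ⊹ v) σ → W._≈ᴹ_ σ (proj₁ (monomial v 𝕄.*ₗ g) (u ⊹ v) σ) (proj₁ g u σ)
  monomial-at v g u σ = exponent-induction
    (λ v → Below (u ⊹ v) σ → W._≈ᴹ_ σ (proj₁ (monomial v 𝕄.*ₗ g) (u ⊹ v) σ) (proj₁ g u σ))
    (λ {v} {v′} v≗v′ p b → W.≈ᴹ-trans σ (·-resp (monomial-cong (≡.sym ∘ v≗v′)) g (u ⊹ v′) σ)
      (W.≈ᴹ-trans σ (S.respects (monomial v 𝕄.*ₗ g) (λ x → ≡.cong (u x ℕ.+_) (≡.sym (v≗v′ x))) σ)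
        (p (Below-resp (λ x → ≡.cong (u x ℕ.+_) (≡.sym (v≗v′ x))) b))))
    (λ _ → W.≈ᴹ-trans σ (·-resp monomial-𝟎 g (u ⊹ 𝟎) σ)
      (W.≈ᴹ-trans σ (W.*ₗ-identityˡ σ _) (S.respects g (λ x → ℕ.+-identityʳ (u x)) σ)))
    (λ {v} τ p b → W.≈ᴹ-trans σ (·-resp (monomial-step v τ) g (u ⊹ (v ⊹ unit K P τ)) σ)
      (W.≈ᴹ-trans σ (shift-yes τ (monomial v 𝕄.*ₗ g) {v = u ⊹ v} (λ x → ℕ.+-assoc (u x) (v x) _) b)
        (p (Below-summand (unit K P τ) (λ x → ℕ.+-assoc (u x) (v x) _) b))))
    v

  embed-onTop : ∀ {σ} w g → Homog (𝒊 (δ σ)) g → W._≈ᴹ_ σ w (proj₁ g (δ σ) σ) → embed σ w 𝕄.≈ᴹ g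
  embed-onTop {σ} w g g∈ w≈ = ≈-onTop (δ σ) σ (embed σ w) g (Top-δ σ) (embed-Homog σ w) g∈
    (W.≈ᴹ-trans σ (embed-at σ w (λ _ → ≡.refl) ≤-refl) (W.≈ᴹ-trans σ (ext-id ≤-refl w) w≈))

  embed-value : ∀ σ w → W._≈ᴹ_ σ w (proj₁ (embed σ w) (δ σ) σ)
  embed-value σ w = W.≈ᴹ-sym σ (W.≈ᴹ-trans σ (embed-at σ w (λ _ → ≡.refl) ≤-refl) (ext-id ≤-refl w))

  private
    basis : ∀ σ → Fin (proj₁ (finiteDimensional σ)) → W.Carrierᴹ σ
    basis σ = proj₁ (proj₂ (finiteDimensional σ))

    element : Fin size → Carrier
    element = Inverse.to enumeration

    generators : List Section
    generators = concat (tabulate λ i → tabulate (embed (element i) ∘ basis (element i)))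

    Generated : Pred Section ℓ
    Generated = InSpan polynomialModule (lookup generators)

    module Generated = IsSubmodule (InSpan-isSubmodule polynomialModule (lookup generators))

    generator-Generated : ∀ {g} → g ∈ₗ generators → Generated g
    generator-Generated g∈ = ≡.subst Generated (≡.sym (lookup-index g∈)) (∈-InSpan polynomialModule (lookup generators) (Any.index g∈))

    -- Embedding is linear up to equality of sections, so the vectors whose embedding is generated
    -- form a subspace, and it contains a basis.
    embed-Generated : ∀ σ w → Generated (embed σ w)
    embed-Generated σ w = let c , w≈ = proj₁ (proj₂ (proj₂ (finiteDimensional σ))) w in
      isS.resp (W.≈ᴹ-sym σ w≈) (submodule-∋-linearCombination (stalk σ) isS c basis-Generated)
      where
      module M = GradedModule gradedModule

      isS : IsSubmodule (stalk σ) (λ w → Generated (embed σ w))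
      isS = record
        { resp = λ {x} {y} x≈y → Generated.resp {embed σ x} {embed σ y}
            (embed-onTop x (embed σ y) (embed-Homog σ y) (W.≈ᴹ-trans σ x≈y (embed-value σ y)))
        ; 0∈   = Generated.resp {0ˢ} {embed σ (W.0ᴹ σ)}
            (𝕄.≈ᴹ-sym {embed σ (W.0ᴹ σ)} {0ˢ} (embed-onTop (W.0ᴹ σ) 0ˢ M.0∈ (W.≈ᴹ-refl σ))) Generated.0∈
        ; +∈   = λ {x} {y} x∈ y∈ → Generated.resp {embed σ x +ˢ embed σ y} {embed σ (W._+ᴹ_ σ x y)}
            (𝕄.≈ᴹ-sym {embed σ (W._+ᴹ_ σ x y)} {embed σ x +ˢ embed σ y} (embed-onTop (W._+ᴹ_ σ x y) (embed σ x +ˢ embed σ y)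
              (M.+∈ {_} {embed σ x} {embed σ y} (embed-Homog σ x) (embed-Homog σ y)) (W.+ᴹ-cong σ (embed-value σ x) (embed-value σ y))))
            (Generated.+∈ {embed σ x} {embed σ y} x∈ y∈)
        ; *∈   = λ a {x} x∈ → Generated.resp {a *ˢ embed σ x} {embed σ (W._*ₗ_ σ a x)}
            (𝕄.≈ᴹ-sym {embed σ (W._*ₗ_ σ a x)} {a *ˢ embed σ x} (embed-onTop (W._*ₗ_ σ a x) (a *ˢ embed σ x)
              (con-∈ em K P gradedModule a {_} {embed σ x} (embed-Homog σ x)) (W.*ₗ-congˡ σ (embed-value σ x))))
            (Generated.*∈ (con a) {embed σ x} x∈)
        }
      module isS = IsSubmodule isS

      basis-Generated : ∀ k → Generated (embed σ (basis σ k))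
      -- The generators are listed for `element (index σ)`, which equals σ only propositionally.
      basis-Generated = ≡.subst (λ σ → ∀ k → Generated (embed σ (basis σ k))) (Inverse.strictlyInverseˡ enumeration σ) λ k →
        generator-Generated (∈-concat⁺′ (∈-tabulate⁺ {f = embed (element i) ∘ basis (element i)} k)
          (∈-tabulate⁺ {f = λ i → tabulate (embed (element i) ∘ basis (element i))} i))
        where i = index σ

    -- If σ is the top of `v`, then `g` is the monomial of exponent `v` minus `δ σ` times the
    -- embedding of its value at σ, since the two agree at the top. If supp v is no chain, `g`
    -- vanishes.
    homogeneous-Generated : ∀ v g → Homog (𝒊 v) g → Generated g
    homogeneous-Generated v g g∈ with em {_∈Δ K P (supp K P v)}
    ... | no ¬chain = Generated.resp {0ˢ} {g} (𝕄.≈ᴹ-sym {g} {0ˢ}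
      (≈-onDegree v g 0ˢ g∈ (λ _ _ σ → W.≈ᴹ-refl σ) (λ σ b → ⊥-elim (¬chain (proj₁ b))))) Generated.0∈
    ... | yes chain = Generated.resp {monomial v′ 𝕄.*ₗ embed σ w} {g}
      (≈-onTop v σ (monomial v′ 𝕄.*ₗ embed σ w) g top monomial-Homog g∈ agree)
      (Generated.*∈ (monomial v′) {embed σ w} (embed-Generated σ w))
      where
      σ   = proj₁ (∃-Top em v chain)
      top = proj₂ (∃-Top em v chain)
      v′  = proj₁ (Top⇒δ-summand top)

      v′+δ≗v : v′ ⊹ δ σ ≗ v
      v′+δ≗v = proj₂ (Top⇒δ-summand top)

      v≗δ+v′ : v ≗ δ σ ⊹ v′
      v≗δ+v′ x = ≡.trans (≡.sym (v′+δ≗v x)) (ℕ.+-comm (v′ x) (δ σ x))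

      w : W.Carrierᴹ σ
      w = proj₁ g v σ

      monomial-Homog : Homog (𝒊 v) (monomial v′ 𝕄.*ₗ embed σ w)
      monomial-Homog = Homog-resp (monomial v′ 𝕄.*ₗ embed σ w) (monomial v′ 𝕄.*ₗ embed σ w)
        (λ x → ≡.cong +_ (v′+δ≗v x)) (λ _ σ → W.≈ᴹ-refl σ)
        (Homog-* (monomial-homogeneous v′) (embed σ w) (embed-Homog σ w))

      agree : W._≈ᴹ_ σ (proj₁ (monomial v′ 𝕄.*ₗ embed σ w) v σ) w
      agree = W.≈ᴹ-trans σ (S.respects (monomial v′ 𝕄.*ₗ embed σ w) v≗δ+v′ σ)
        (W.≈ᴹ-trans σ (monomial-at v′ (embed σ w) (δ σ) σ (Below-resp v≗δ+v′ (proj₁ top)))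
          (W.≈ᴹ-sym σ (embed-value σ w)))

    -- As ρ already lies in supp u and τ ≤ ρ, adding τ does not change which elements bound the
    -- chain. The components of degrees `u` and `u ⊹ unit K P τ` thus consist of the same families.
    shift-bijective : ∀ u ρ → IsMaximum K P (supp K P u) ρ → ∀ τ → _∈Δ K P (supp K P (u ⊹ unit K P τ)) → proj₁ τ ≤ ρ →
      Bijective (λ (g , _) (h , _) → g 𝕄.≈ᴹ h) (λ (g , _) (h , _) → g 𝕄.≈ᴹ h) (multiplication K P gradedModule τ u)
    shift-bijective u ρ (ρ∈ , u≤ρ) τ chain τ≤ρ = (λ {x} {y} → injective (proj₁ x) (proj₁ y) (proj₂ x) (proj₂ y)) , surjective
      where
      uτ = u ⊹ unit K P τ

      Below-uτ : ∀ {σ} → Below u σ → Below uτ σ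
      Below-uτ {σ} (_ , u≤σ) = chain , λ {α} α∈ → bounded (supp-⊹⁻ u (unit K P τ) α∈)
        where
        bounded : ∀ {α} → α ∈ supp K P u ⊎ α ∈ supp K P (unit K P τ) → α ≤ σ
        bounded (inj₁ α∈) = u≤σ α∈
        bounded (inj₂ α∈) = ≤-trans (≡.subst (_≤ ρ) (≡.sym (supp-δ⁻ α∈)) τ≤ρ) (u≤σ ρ∈)

      injective : ∀ g h → Homog (𝒊 u) g → Homog (𝒊 u) h → shift τ g 𝕄.≈ᴹ shift τ h → g 𝕄.≈ᴹ h
      injective g h g∈ h∈ p = ≈-onDegree u g h g∈ h∈ λ σ b →
        W.≈ᴹ-trans σ (W.≈ᴹ-sym σ (shift-yes τ g (λ _ → ≡.refl) (Below-uτ b)))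
          (W.≈ᴹ-trans σ (p uτ σ) (shift-yes τ h (λ _ → ≡.refl) (Below-uτ b)))

      surjective : Surjective (λ ((g , _) : ∃ (Homog (𝒊 u))) (h , _) → g 𝕄.≈ᴹ h) (λ (g , _) (h , _) → g 𝕄.≈ᴹ h)
                     (multiplication K P gradedModule τ u)
      surjective (h , h∈) = (preimage , preimage-Homog) , λ {(g , g∈)} g≈preimage →
        ≈-onDegree uτ (shift τ g) h (proj₂ (multiplication K P gradedModule τ u (g , g∈))) h∈ λ σ b →
          W.≈ᴹ-trans σ (shift-yes τ g (λ _ → ≡.refl) b)
            (W.≈ᴹ-trans σ (g≈preimage u σ) (concentrated-at u (proj₁ h uτ) h-vanishes h-compatible (λ _ → ≡.refl) σ))
        where
        h-vanishes : ∀ {σ} → ¬ Below u σ → W._≈ᴹ_ σ (proj₁ h uτ σ) (W.0ᴹ σ)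
        h-vanishes ¬b = S.vanishes h (¬b ∘ Below-summand (unit K P τ) (λ _ → ≡.refl))

        h-compatible : ∀ {σ ρ} → Below u σ → (σ≤ρ : σ ≤ ρ) → W._≈ᴹ_ ρ (extend σ≤ρ (proj₁ h uτ σ)) (proj₁ h uτ ρ)
        h-compatible b σ≤ρ = S.compatible h (Below-uτ b) σ≤ρ

        preimage : Section
        preimage = concentrated u (proj₁ h uτ) h-vanishes h-compatible

        preimage-Homog : Homog (𝒊 u) preimage
        preimage-Homog = concentrated-Homog u (proj₁ h uτ) h-vanishes h-compatible

  abstract
    isSquarefree : IsSquarefree K P gradedModule
    isSquarefree = record
      { finitelyGenerated = length generators , lookup generators , section-induction Generated
          (λ g h → Generated.resp {g} {h}) Generated.0∈ (λ g h → Generated.+∈ {g} {h}) homogeneous-Generated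
      ; ℕ-graded  = λ d d≱0 {g} g∈ u → g∈ u (λ u≗d → d≱0 (λ x → ≡.subst (0ℤ ℤ.≤_) (u≗d x) (ℤ.+≤+ ℕ.z≤n)))
      ; vanishing = λ u ¬chain {g} g∈ →
          ≈-onDegree u g 0ˢ g∈ (λ _ _ σ → W.≈ᴹ-refl σ) (λ σ b → ⊥-elim (¬chain (proj₁ b)))
      ; bijective = λ u _ → shift-bijective u
      }

-- Functoriality, and the two isomorphisms between modules and cosheaves

module _ {ℓ : Level} (em : ExcludedMiddle ℓ) (K : Field ℓ) (P : FinitePoset ℓ) where

  open FinitePoset P
  open Exponents K P

  module _ (W W′ : Cosheaf K P) (φ : CosheafHom K P W W′) where
    private
      module W = FromCosheaf em K P W
      module W′ = FromCosheaf em K P W′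
      module L σ = LeftModule (Cosheaf.stalk W′ σ)
      module φ σ = LinearMap (CosheafHom.at φ σ)

      mapSection : W.Section → W′.Section
      mapSection (g , isSection) = (λ u σ → φ.⟦_⟧ σ (g u σ)) , record
        { respects   = λ u≗v σ → φ.⟦⟧-cong σ (respects u≗v σ)
        ; vanishes   = λ {_} {σ} ¬b → L.≈ᴹ-trans σ (φ.⟦⟧-cong σ (vanishes ¬b)) (φ.0ᴹ-homo σ)
        ; compatible = λ {_} {σ} {ρ} b σ≤ρ → L.≈ᴹ-trans ρ (L.≈ᴹ-sym ρ (CosheafHom.natural φ σ≤ρ _))
            (φ.⟦⟧-cong ρ (compatible b σ≤ρ))
        ; support    = proj₁ support , λ u u∉ σ → L.≈ᴹ-trans σ (φ.⟦⟧-cong σ (proj₂ support u u∉ σ)) (φ.0ᴹ-homo σ)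
        }
        where open W.IsSection isSection

      -- `Shiftable` mentions exponents only and not the cosheaf, so one case distinction settles
      -- both sides.
      mapSection-shift : ∀ τ g → mapSection (W.shift τ g) W′.𝕄.≈ᴹ W′.shift τ (mapSection g)
      mapSection-shift τ g u σ with em {W.Shiftable τ u σ}
      ... | yes _ = L.≈ᴹ-refl σ
      ... | no _  = φ.0ᴹ-homo σ

    mapGraded : GradedHom K P W.gradedModule W′.gradedModule
    mapGraded = record
      { linearMap = R-linear K P {W.polynomialModule} {W′.polynomialModule}
          (linear mapSection (λ p u σ → φ.⟦⟧-cong σ (p u σ)) (λ _ _ u σ → φ.+ᴹ-homo σ _ _) (λ _ _ u σ → φ.*ₗ-homo σ _ _))
          mapSection-shift
      ; preserves = λ g∈ u u≢ σ → L.≈ᴹ-trans σ (φ.⟦⟧-cong σ (g∈ u u≢ σ)) (φ.0ᴹ-homo σ)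
      }

  private
    module CoSh = Category (CoSh K P)
    module Sq = Category (Sq K P)

    squarefree : Cosheaf K P → Sq.Obj
    squarefree W = FromCosheaf.gradedModule em K P W , FromCosheaf.isSquarefree em K P W

    mapGraded-cong : ∀ {A B} {φ ψ : CosheafHom K P A B} → CoSh._≈_ {A} {B} φ ψ →
                     Sq._≈_ {squarefree A} {squarefree B} (mapGraded A B φ) (mapGraded A B ψ)
    mapGraded-cong φ≈ψ g u σ = φ≈ψ σ (proj₁ g u σ)

    mapGraded-id : ∀ {A} → Sq._≈_ {squarefree A} {squarefree A} (mapGraded A A (CoSh.id {A})) (Sq.id {squarefree A})
    mapGraded-id {A} g u σ = LeftModule.≈ᴹ-refl (Cosheaf.stalk A σ)

    mapGraded-⊚ : ∀ {A B C} (φ : CosheafHom K P B C) (ψ : CosheafHom K P A B) →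
      Sq._≈_ {squarefree A} {squarefree C} (mapGraded A C (CoSh._⊚_ {A} {B} {C} φ ψ))
        (Sq._⊚_ {squarefree A} {squarefree B} {squarefree C} (mapGraded B C φ) (mapGraded A B ψ))
    mapGraded-⊚ {_} {_} {C} φ ψ g u σ = LeftModule.≈ᴹ-refl (Cosheaf.stalk C σ)

  fromCosheaf : Functor (CoSh K P) (Sq K P)
  fromCosheaf = record
    { F₀     = squarefree
    ; F₁     = λ {A} {B} → mapGraded A B
    ; F-cong = λ {A} {B} {φ} {ψ} → mapGraded-cong {A} {B} {φ} {ψ}
    ; F-id   = λ {A} → mapGraded-id {A}
    ; F-⊚    = λ {A} {B} {C} → mapGraded-⊚ {A} {B} {C}
    }

  -- The stalk at σ of the cosheaf of the module of W consists of the sections of degree δ σ,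
  -- and these are determined by their value at σ.
  module Counit (W : Cosheaf K P) where
    open Cosheaf W
    open FromCosheaf em K P W
    private
      module V = FromModule em K P gradedModule isSquarefree
      module L σ = LeftModule (stalk σ)
      module V∙ σ = LeftModule (V.Stalk σ)

    valueAt : ∀ σ → LinearMap (V.Stalk σ) (stalk σ)
    valueAt σ = linear (λ (g , _) → proj₁ g (δ σ) σ) (λ p → p (δ σ) σ) (λ _ _ → L.≈ᴹ-refl σ) (λ _ _ → L.≈ᴹ-refl σ)

    -- The equation defining the lift is read off in degree `δ τ ⊹ δ σ` at τ. By `monomial-at` its
    -- left side is the value of the lift, and its right side is `g` at `δ σ` and τ, which by
    -- compatibility extends the value at σ.
    valueAt-natural : ∀ {σ τ} .(σ≤τ : σ ≤ τ) x →
      L._≈ᴹ_ τ (LinearMap.⟦_⟧ (valueAt τ) (LinearMap.⟦_⟧ (Cosheaf.ext V.cosheaf σ≤τ) x))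
               (extend σ≤τ (LinearMap.⟦_⟧ (valueAt σ) x))
    valueAt-natural {σ} {τ} σ≤τ′ x@(g , g∈) = L.≈ᴹ-trans τ (L.≈ᴹ-sym τ (monomial-at (δ σ) g′ (δ τ) τ
        (Below-resp (λ υ → ℕ.+-comm (δ σ υ) (δ τ υ)) (Below-⊹δ (Below-δ σ≤τ) ≤-refl))))
      (L.≈ᴹ-trans τ (V.Lift-IsLift (δ σ) τ (Below-δ σ≤τ) x (δ τ ⊹ δ σ) τ)
        (L.≈ᴹ-trans τ (IsSection.respects (proj₂ (monomial (δ τ) 𝕄.*ₗ g)) (λ υ → ℕ.+-comm (δ τ υ) (δ σ υ)) τ)
          (L.≈ᴹ-trans τ (monomial-at (δ τ) g (δ σ) τ (Below-⊹δ (Below-δ σ≤τ) ≤-refl))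
            (L.≈ᴹ-sym τ (IsSection.compatible (proj₂ g) (Below-δ ≤-refl) σ≤τ)))))
      where
      σ≤τ : σ ≤ τ
      σ≤τ = recompute em σ≤τ′

      g′ : Section
      g′ = proj₁ (LinearMap.⟦_⟧ (V.Lift (δ σ) τ (Below-δ σ≤τ)) x)

    valueAt-injective : ∀ σ {x y} → L._≈ᴹ_ σ (LinearMap.⟦_⟧ (valueAt σ) x) (LinearMap.⟦_⟧ (valueAt σ) y) → V∙._≈ᴹ_ σ x y
    valueAt-injective σ {g , g∈} {h , h∈} p = ≈-onTop (δ σ) σ g h (Top-δ σ) g∈ h∈ p

    embedAt : ∀ σ → LinearMap (stalk σ) (V.Stalk σ)
    embedAt σ = linear⁻¹ (valueAt σ) (λ {x} {y} → valueAt-injective σ {x} {y})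
      (λ w → embed σ w , embed-Homog σ w) (λ w → L.≈ᴹ-sym σ (embed-value σ w))

    counit : CosheafHom K P V.cosheaf W
    counit = record { at = valueAt ; natural = valueAt-natural }

    counit⁻¹ : CosheafHom K P W V.cosheaf
    counit⁻¹ = record
      { at      = embedAt
      ; natural = λ {σ} {τ} σ≤τ w → let x = embed σ w , embed-Homog σ w in
          valueAt-injective τ {LinearMap.⟦_⟧ (embedAt τ) (extend σ≤τ w)} {LinearMap.⟦_⟧ (Cosheaf.ext V.cosheaf σ≤τ) x}
            (L.≈ᴹ-trans τ (L.≈ᴹ-sym τ (embed-value τ (extend σ≤τ w)))
              (L.≈ᴹ-sym τ (L.≈ᴹ-trans τ (valueAt-natural σ≤τ x)
                (LinearMap.⟦⟧-cong (ext σ≤τ) (L.≈ᴹ-sym σ (embed-value σ w))))))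
      }

  counitIsomorphism : NaturalIsomorphism (toCosheaf em K P ∘ᶠ fromCosheaf) (Idᶠ (CoSh K P))
  counitIsomorphism = record
    { to       = Counit.counit
    ; from     = Counit.counit⁻¹
    ; inverseˡ = λ W σ w → LeftModule.≈ᴹ-sym (Cosheaf.stalk W σ) (FromCosheaf.embed-value em K P W σ w)
    ; inverseʳ = λ W σ (g , g∈) → FromCosheaf.embed-onTop em K P W _ g g∈ (LeftModule.≈ᴹ-refl (Cosheaf.stalk W σ))
    ; natural  = λ {_} {W′} φ σ x → LeftModule.≈ᴹ-refl (Cosheaf.stalk W′ σ)
    }
 

-- A squarefree module is identified with the module of its cosheaf by sending x to the family
-- of the lifts of its homogeneous parts.
module Unit {ℓ : Level} (em : ExcludedMiddle ℓ) (K : Field ℓ) (P : FinitePoset ℓ)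
            (M : GradedModule K P) (sq : IsSquarefree K P M) where

  open FinitePoset P
  open Exponents K P
  open GradedModule M
  open IsSquarefree sq
  open Projections em K P M
  open Terms em K P M using (terms)
  open FromModule em K P M sq
  private
    module G = FromCosheaf em K P cosheaf
    module N = GradedModule G.gradedModule

    𝒊 : Exponent → Degree K P
    𝒊 = ι K P

    -- The decision is an argument so that lemmas can split on it directly.
    family : Carrierᴹ → ∀ u σ → Dec (Below u σ) → ∃ (Component (𝒊 (δ σ)))
    family x u σ (yes b) = LinearMap.⟦_⟧ (Lift u σ b) (π (𝒊 u) x , π-∈ (𝒊 u) x)
    family x u σ (no _)  = 0ᴹ , 0∈

    family-IsLift : ∀ x u σ → Below u σ → (b? : Dec (Below u σ)) → IsLift u σ (π (𝒊 u) x) (proj₁ (family x u σ b?))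
    family-IsLift x u σ b (yes b′) = Lift-IsLift u σ b′ (π (𝒊 u) x , π-∈ (𝒊 u) x)
    family-IsLift x u σ b (no ¬b)  = ⊥-elim (¬b b)

    family-no : ∀ x u σ → ¬ Below u σ → (b? : Dec (Below u σ)) → proj₁ (family x u σ b?) ≈ᴹ 0ᴹ
    family-no x u σ ¬b (yes b) = ⊥-elim (¬b b)
    family-no x u σ ¬b (no _)  = ≈ᴹ-refl

  at : Carrierᴹ → ∀ u σ → ∃ (Component (𝒊 (δ σ)))
  at x u σ = family x u σ em

  at-IsLift : ∀ x {u σ} → Below u σ → IsLift u σ (π (𝒊 u) x) (proj₁ (at x u σ))
  at-IsLift x {u} {σ} b = family-IsLift x u σ b em

  at-unique : ∀ x {u σ} → Below u σ → ∀ {y} → y ∈ Component (𝒊 (δ σ)) → IsLift u σ (π (𝒊 u) x) y → proj₁ (at x u σ) ≈ᴹ y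
  at-unique x {u} {σ} b y∈ l = IsLift-unique b (proj₂ (at x u σ)) y∈ (at-IsLift x b) l

  at-no : ∀ x {u σ} → ¬ Below u σ → proj₁ (at x u σ) ≈ᴹ 0ᴹ
  at-no x {u} {σ} ¬b = family-no x u σ ¬b em

  private
    IsLift-0 : ∀ {u σ} → IsLift u σ 0ᴹ 0ᴹ
    IsLift-0 = ≈ᴹ-trans (*ₗ-zeroʳ _) (≈ᴹ-sym (*ₗ-zeroʳ _))

    at-zero : ∀ x {u} → π (𝒊 u) x ≈ᴹ 0ᴹ → ∀ σ → proj₁ (at x u σ) ≈ᴹ 0ᴹ
    at-zero x {u} πx≈0 σ with em {Below u σ}
    ... | no _  = ≈ᴹ-refl
    ... | yes b = IsLift-unique b (proj₂ (family x u σ (yes b))) 0∈ (family-IsLift x u σ b (yes b))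
                    (IsLift-cong {u} {σ} (≈ᴹ-sym πx≈0) ≈ᴹ-refl IsLift-0)

    at-resp : ∀ x {u v} → u ≗ v → ∀ σ → proj₁ (at x u σ) ≈ᴹ proj₁ (at x v σ)
    at-resp x {u} {v} u≗v σ with em {Below u σ}
    ... | no ¬b = ≈ᴹ-sym (at-no x (¬b ∘ Below-resp (≡.sym ∘ u≗v)))
    ... | yes b = ≈ᴹ-sym (at-unique x (Below-resp u≗v b) (proj₂ (family x u σ (yes b)))
        (≈ᴹ-trans (*ₗ-congʳ (monomial-cong (≡.sym ∘ u≗v))) (≈ᴹ-trans (family-IsLift x u σ b (yes b))
          (*ₗ-congˡ (π-resp x (𝒊-cong u≗v))))))

    section : Carrierᴹ → G.Section
    section x = at x , record
      { respects   = at-resp x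
      ; vanishes   = at-no x
      ; compatible = λ {u} {σ} {ρ} b σ≤ρ → ≈ᴹ-sym (at-unique x (Below-≤ b σ≤ρ) (proj₂ (G.extend σ≤ρ (at x u σ)))
          (IsLift-∘ b σ≤ρ (π-∈ (𝒊 u) x) (proj₂ (G.extend σ≤ρ (at x u σ))) (at-IsLift x b)
            (Lift-IsLift (δ σ) ρ (Below-δ (recompute em σ≤ρ)) (at x u σ))))
      ; support    = map (λ t σ → ∣ proj₁ t σ ∣) (terms x) , λ u u∉ → at-zero x (π-support (𝒊 u) x
          (λ u∈ → u∉ (map⁺ (Any.map (λ t≗u σ → ≡.sym (≡.cong ∣_∣ (t≗u σ))) u∈))))
      }

    -- If x_τ divides x^u, the lift equation for the quotient exponent times x_τ is the one for `u`.
    -- If it does not, the part of `x` concerned has a degree with a negative entry and vanishes.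
    section-var : ∀ τ x u σ → proj₁ (proj₁ (section (var τ *ₗ x)) u σ) ≈ᴹ proj₁ (proj₁ (G.shift τ (section x)) u σ)
    section-var τ x u σ = go em em
      where
      u-τ = _-unit_ K P (𝒊 u) τ

      π-var′ : π (𝒊 u) (var τ *ₗ x) ≈ᴹ var τ *ₗ π u-τ x
      π-var′ = ≈ᴹ-trans (≈ᴹ-sym (π-resp (var τ *ₗ x) (unit⊕-unit K P (𝒊 u) τ))) (π-var em K P M τ u-τ x)

      go : Dec (Below u σ) → Dec (Σ[ v ∈ Exponent ] v ⊹ unit K P τ ≗ u) →
           proj₁ (at (var τ *ₗ x) u σ) ≈ᴹ proj₁ (proj₁ (G.shift τ (section x)) u σ)
      go (no ¬b) _ = ≈ᴹ-trans (at-no (var τ *ₗ x) ¬b) (≈ᴹ-sym (G.shift-no τ (at x) (¬b ∘ proj₂)))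
      go (yes b) (no ∄v) = ≈ᴹ-trans (at-zero (var τ *ₗ x) (≈ᴹ-trans π-var′ (≈ᴹ-trans (*ₗ-congˡ π≈0) (*ₗ-zeroʳ _))) σ)
        (≈ᴹ-sym (G.shift-no τ (at x) (∄v ∘ proj₁)))
        where
        -- Were this degree nonnegative, its absolute values would form an exponent `v` with
        -- `v ⊹ unit K P τ` equal to `u`.
        π≈0 : π u-τ x ≈ᴹ 0ᴹ
        π≈0 = ℕ-graded u-τ (λ u-τ≥0 → ∄v ((λ υ → ∣ u-τ υ ∣) , λ υ → ℤ.+-injective
          (≡.trans (≡.cong (ℤ._+ 𝒊 (unit K P τ) υ) (ℤ.0≤i⇒+∣i∣≡i (u-τ≥0 υ)))
            (≡.trans (ℤ.+-comm (u-τ υ) (𝒊 (unit K P τ) υ)) (unit⊕-unit K P (𝒊 u) τ υ))))) (π-∈ u-τ x)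
      go (yes b) (yes (v , eq)) = ≈ᴹ-trans (at-unique (var τ *ₗ x) b (proj₂ (at x v σ)) lift)
        (≈ᴹ-sym (G.shift-yes τ (section x) eq b))
        where
        v≗u-τ : 𝒊 v ≗ u-τ
        v≗u-τ υ = GroupProperties.∙-cancelˡ (AbelianGroup.group ℤ.+-0-abelianGroup) (𝒊 (unit K P τ) υ) _ _
          (≡.trans (ℤ.+-comm (𝒊 (unit K P τ) υ) (𝒊 v υ)) (≡.trans (≡.cong +_ (eq υ)) (≡.sym (unit⊕-unit K P (𝒊 u) τ υ))))

        lift : IsLift u σ (π (𝒊 u) (var τ *ₗ x)) (proj₁ (at x v σ))
        lift = ≈ᴹ-trans (*ₗ-congʳ (monomial-cong (≡.sym ∘ eq))) (≈ᴹ-trans (monomial-step-*ₗ v τ _)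
          (≈ᴹ-trans (*ₗ-congˡ (at-IsLift x (Below-⊆ (supp-resp eq ∘ supp-⊹ˡ v (unit K P τ)) b)))
            (≈ᴹ-trans (*ₗ-comm K P leftModule _ _ _)
              (*ₗ-congˡ (≈ᴹ-sym (≈ᴹ-trans π-var′ (*ₗ-congˡ (π-resp x (≡.sym ∘ v≗u-τ)))))))))

  unit-hom : GradedHom K P M G.gradedModule
  unit-hom = record
    { linearMap = R-linear K P {leftModule} {G.polynomialModule} (linear section cong plus times) section-var
    ; preserves = λ {d} {x} x∈ u u≢d σ → at-zero x (π-other x∈ (λ d≗u → u≢d (≡.sym ∘ d≗u))) σ
    }
    where
    cong : ∀ {x y} → x ≈ᴹ y → section x G.𝕄.≈ᴹ section y
    cong {x} {y} x≈y u σ with em {Below u σ}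
    ... | no ¬b = ≈ᴹ-refl
    ... | yes b = IsLift-unique b (proj₂ (family x u σ (yes b))) (proj₂ (family y u σ (yes b)))
      (family-IsLift x u σ b (yes b))
      (IsLift-cong {u} {σ} (π-cong (𝒊 u) (≈ᴹ-sym x≈y)) ≈ᴹ-refl (family-IsLift y u σ b (yes b)))

    plus : ∀ x y → section (x +ᴹ y) G.𝕄.≈ᴹ (section x G.𝕄.+ᴹ section y)
    plus x y u σ with em {Below u σ}
    ... | no ¬b = ≈ᴹ-sym (+ᴹ-identityˡ _)
    ... | yes b = IsLift-unique b (proj₂ (family (x +ᴹ y) u σ (yes b)))
      (+∈ (proj₂ (family x u σ (yes b))) (proj₂ (family y u σ (yes b))))
      (family-IsLift (x +ᴹ y) u σ b (yes b))
      (IsLift-cong {u} {σ} (≈ᴹ-sym (π-+ (𝒊 u) x y)) ≈ᴹ-refl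
        (IsLift-+ {u} {σ} (family-IsLift x u σ b (yes b)) (family-IsLift y u σ b (yes b))))

    times : ∀ a x → section (con a *ₗ x) G.𝕄.≈ᴹ (con a G.𝕄.*ₗ section x)
    times a x u σ with em {Below u σ}
    ... | no ¬b = ≈ᴹ-sym (*ₗ-zeroʳ _)
    ... | yes b = IsLift-unique b (proj₂ (family (con a *ₗ x) u σ (yes b))) (con-∈ em K P M a (proj₂ (family x u σ (yes b))))
      (family-IsLift (con a *ₗ x) u σ b (yes b))
      (IsLift-cong {u} {σ} (≈ᴹ-sym (π-con em K P M a (𝒊 u) x)) ≈ᴹ-refl (IsLift-* {u} {σ} (con a) (family-IsLift x u σ b (yes b))))

  private
    module η = GradedHom unit-hom
    open LeftModuleProperties leftModule using (inverseˡ-uniqueᴹ; -ᴹ-involutive)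

    -- Degrees with negative entries or with a support that is no chain carry nothing. In any other
    -- degree multiplication by x_σ is injective for σ the top of the support, so a part whose lift
    -- to σ is zero is zero.
    part-vanishes : ∀ d x → (∀ u → 𝒊 u ≗ d → ∀ σ → proj₁ (at x u σ) ≈ᴹ 0ᴹ) → π d x ≈ᴹ 0ᴹ
    part-vanishes d x at≈0 with em {∀ σ → 0ℤ ℤ.≤ d σ}
    ... | no d≱0 = ℕ-graded d d≱0 (π-∈ d x)
    ... | yes d≥0 with em {_∈Δ K P (supp K P (λ σ → ∣ d σ ∣))}
    ...   | no ¬chain = vanishing (λ σ → ∣ d σ ∣) ¬chain
              (∈-resp (λ σ → ≡.sym (ℤ.0≤i⇒+∣i∣≡i (d≥0 σ))) ≈ᴹ-refl (π-∈ d x))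
    ...   | yes chain = ≈ᴹ-trans (π-resp x (≡.sym ∘ u≗d)) (proj₁ (monomial-bijection top (δ σ) (Below-⊹δ (proj₁ top) ≤-refl))
              (π-∈ (𝒊 u) x) 0∈ (≈ᴹ-trans (≈ᴹ-sym (at-IsLift x (proj₁ top)))
                (≈ᴹ-trans (*ₗ-congˡ (at≈0 u u≗d σ)) (IsLift-0 {u} {σ}))))
      where
      u : Exponent
      u σ = ∣ d σ ∣

      u≗d : 𝒊 u ≗ d
      u≗d σ = ℤ.0≤i⇒+∣i∣≡i (d≥0 σ)

      σ   = proj₁ (∃-Top em u chain)
      top = proj₂ (∃-Top em u chain)

  unit-kernel : ∀ x → η.⟦ x ⟧ N.≈ᴹ N.0ᴹ → x ≈ᴹ 0ᴹ
  unit-kernel x ηx≈0 = ≈0-byParts (λ d → part-vanishes d x (λ u _ σ → ηx≈0 u σ))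

  unit-injective : ∀ {x y} → η.⟦ x ⟧ N.≈ᴹ η.⟦ y ⟧ → x ≈ᴹ y
  unit-injective {x} {y} ηx≈ηy = ≈ᴹ-trans (inverseˡ-uniqueᴹ x (-ᴹ y) (unit-kernel (x +ᴹ -ᴹ y) λ u σ →
      ≈ᴹ-trans (η.+ᴹ-homo x (-ᴹ y) u σ) (≈ᴹ-trans (+ᴹ-cong (ηx≈ηy u σ) (η.-ᴹ-homo y u σ)) (N.-ᴹ‿inverseʳ (section y) u σ))))
    (-ᴹ-involutive y)

  -- Needed for the inverse to preserve degrees: the parts of `x` in degrees other than `d` have
  -- zero lifts.
  unit-reflects : ∀ {d x} → η.⟦ x ⟧ ∈ N.Component d → x ∈ Component d
  unit-reflects {d} {x} ηx∈ = ∈-byParts λ e d≢e → part-vanishes e x λ u u≗e σ →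
    ηx∈ u (λ u≗d → d≢e (λ υ → ≡.trans (≡.sym (u≗d υ)) (u≗e υ))) σ

  private
    surjective : ∀ g → ∃[ x ] η.⟦ x ⟧ N.≈ᴹ g
    surjective = G.section-induction (λ g → ∃[ x ] η.⟦ x ⟧ N.≈ᴹ g)
      (λ g h g≈h (x , p) → x , λ u σ → ≈ᴹ-trans (p u σ) (g≈h u σ))
      (0ᴹ , η.0ᴹ-homo)
      (λ g h (x , p) (y , q) → x +ᴹ y , λ u σ → ≈ᴹ-trans (η.+ᴹ-homo x y u σ) (+ᴹ-cong (p u σ) (q u σ)))
      homogeneous
      where
      homogeneous : ∀ v g → G.Homog (𝒊 v) g → ∃[ x ] η.⟦ x ⟧ N.≈ᴹ g
      homogeneous v g g∈ with em {_∈Δ K P (supp K P v)}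
      ... | no ¬chain = 0ᴹ , G.≈-onDegree v (section 0ᴹ) g (η.preserves {𝒊 v} {0ᴹ} 0∈) g∈ (λ σ b → ⊥-elim (¬chain (proj₁ b)))
      ... | yes chain = x , G.≈-onTop v σ (section x) g top (η.preserves {𝒊 v} {x} x∈) g∈
          (at-unique x (proj₁ top) (proj₂ (proj₁ g v σ))
            (≈ᴹ-trans (≈ᴹ-sym x↦) (*ₗ-congˡ (≈ᴹ-sym (π-same x∈ (λ _ → ≡.refl))))))
        where
        σ   = proj₁ (∃-Top em v chain)
        top = proj₂ (∃-Top em v chain)

        -- Solves the lift equation for `x` instead of `y`: x_σ maps M_v bijectively, as σ is the
        -- top of `v`, and x^v times the value of `g` at σ lies in the target.
        preimage = proj₂ (monomial-bijection top (δ σ) (Below-⊹δ (proj₁ top) ≤-refl))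
          (∈-resp (𝒊-cong (λ υ → ℕ.+-comm (δ σ υ) (v υ))) ≈ᴹ-refl (monomial-∈ (δ σ) v (proj₂ (proj₁ g v σ))))
        x  = proj₁ preimage
        x∈ = proj₁ (proj₂ preimage)
        x↦ = proj₂ (proj₂ preimage)

  abstract
    unit-surjective : ∀ g → ∃[ x ] η.⟦ x ⟧ N.≈ᴹ g
    unit-surjective = surjective

  unit-inverse : GradedHom K P G.gradedModule M
  unit-inverse = record
    { linearMap = linear⁻¹ η.linearMap unit-injective (proj₁ ∘ unit-surjective) (proj₂ ∘ unit-surjective)
    ; preserves = λ {d} {g} g∈ → unit-reflects (N.∈-resp {d} {d} {g} {section (proj₁ (unit-surjective g))}
        (λ _ → ≡.refl) (λ u σ → ≈ᴹ-sym (proj₂ (unit-surjective g) u σ)) g∈)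
    }

  unit-inverse-unit : ∀ x → GradedHom.⟦_⟧ unit-inverse η.⟦ x ⟧ ≈ᴹ x
  unit-inverse-unit x = unit-injective (proj₂ (unit-surjective η.⟦ x ⟧))

  unit-unit-inverse : ∀ g → η.⟦ GradedHom.⟦_⟧ unit-inverse g ⟧ N.≈ᴹ g
  unit-unit-inverse g = proj₂ (unit-surjective g)

module _ {ℓ : Level} (em : ExcludedMiddle ℓ) (K : Field ℓ) (P : FinitePoset ℓ) where

  open Exponents K P

  module _ {M N : GradedModule K P} (sqM : IsSquarefree K P M) (sqN : IsSquarefree K P N) (f : GradedHom K P M N) where
    private
      module UM = Unit em K P M sqM
      module UN = Unit em K P N sqN
      module GN = GradedModule (FromCosheaf.gradedModule em K P (FromModule.cosheaf em K P N sqN))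
      module M = GradedModule M
      module N = GradedModule N
      module f = GradedHom f

      Vf : CosheafHom K P (FromModule.cosheaf em K P M sqM) (FromModule.cosheaf em K P N sqN)
      Vf = mapCosheaf em K P sqM sqN f

      GVf : GradedHom K P (FromCosheaf.gradedModule em K P (FromModule.cosheaf em K P M sqM))
                          (FromCosheaf.gradedModule em K P (FromModule.cosheaf em K P N sqN))
      GVf = mapGraded em K P (FromModule.cosheaf em K P M sqM) (FromModule.cosheaf em K P N sqN) Vf

    -- `f` commutes with the projections and with monomials, so it carries the lifts of `x` to lifts
    -- of its image.
    unit-natural : ∀ x → GradedHom.⟦_⟧ UN.unit-hom (f.⟦ x ⟧) GN.≈ᴹ GradedHom.⟦_⟧ GVf (GradedHom.⟦_⟧ UM.unit-hom x)
    unit-natural x u σ = go em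
      where
      go : Dec (Below u σ) → proj₁ (proj₁ (GradedHom.⟦_⟧ UN.unit-hom (f.⟦ x ⟧)) u σ) N.≈ᴹ
                             proj₁ (proj₁ (GradedHom.⟦_⟧ GVf (GradedHom.⟦_⟧ UM.unit-hom x)) u σ)
      go (no ¬b) = N.≈ᴹ-trans (UN.at-no f.⟦ x ⟧ ¬b) (N.≈ᴹ-sym (N.≈ᴹ-trans (f.⟦⟧-cong (UM.at-no x ¬b)) f.0ᴹ-homo))
      go (yes b) = UN.at-unique f.⟦ x ⟧ b (f.preserves (proj₂ (UM.at x u σ)))
        (N.≈ᴹ-trans (N.≈ᴹ-sym (f.*ₗ-homo _ _)) (N.≈ᴹ-trans (f.⟦⟧-cong (UM.at-IsLift x b))
          (N.≈ᴹ-trans (f.*ₗ-homo _ _) (N.*ₗ-congˡ (N.≈ᴹ-sym (π-GradedHom em K P M N f _ x))))))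

    unit-inverse-natural : ∀ g → GradedHom.⟦_⟧ UN.unit-inverse (GradedHom.⟦_⟧ GVf g) N.≈ᴹ f.⟦ GradedHom.⟦_⟧ UM.unit-inverse g ⟧
    unit-inverse-natural g = UN.unit-injective λ u σ → N.≈ᴹ-trans (proj₂ (UN.unit-surjective (GradedHom.⟦_⟧ GVf g)) u σ)
      (N.≈ᴹ-trans (f.⟦⟧-cong (M.≈ᴹ-sym (proj₂ (UM.unit-surjective g) u σ)))
        (N.≈ᴹ-sym (unit-natural (GradedHom.⟦_⟧ UM.unit-inverse g) u σ)))

  private
    module Sq = Category (Sq K P)

    GV : Functor (Sq K P) (Sq K P)
    GV = fromCosheaf em K P ∘ᶠ toCosheaf em K P

    module GV = Functor GV

    η : ∀ A → Sq.Hom A (GV.F₀ A)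
    η (M , sq) = Unit.unit-hom em K P M sq

    η⁻¹ : ∀ A → Sq.Hom (GV.F₀ A) A
    η⁻¹ (M , sq) = Unit.unit-inverse em K P M sq

    η⁻¹-η : ∀ A → Sq._≈_ {A} {A} (Sq._⊚_ {A} {GV.F₀ A} {A} (η⁻¹ A) (η A)) (Sq.id {A})
    η⁻¹-η (M , sq) x = Unit.unit-inverse-unit em K P M sq x

    η-η⁻¹ : ∀ A → Sq._≈_ {GV.F₀ A} {GV.F₀ A} (Sq._⊚_ {GV.F₀ A} {A} {GV.F₀ A} (η A) (η⁻¹ A)) (Sq.id {GV.F₀ A})
    η-η⁻¹ (M , sq) g = Unit.unit-unit-inverse em K P M sq g

    η⁻¹-natural : ∀ {A B} (f : Sq.Hom A B) →
      Sq._≈_ {GV.F₀ A} {B} (Sq._⊚_ {GV.F₀ A} {GV.F₀ B} {B} (η⁻¹ B) (GV.F₁ {A} {B} f)) (Sq._⊚_ {GV.F₀ A} {A} {B} f (η⁻¹ A))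
    η⁻¹-natural {M , sqM} {N , sqN} f = unit-inverse-natural sqM sqN f

  unitIsomorphism : NaturalIsomorphism (fromCosheaf em K P ∘ᶠ toCosheaf em K P) (Idᶠ (Sq K P))
  unitIsomorphism = record
    { to       = η⁻¹
    ; from     = η
    ; inverseˡ = η⁻¹-η
    ; inverseʳ = η-η⁻¹
    ; natural  = λ {A} {B} → η⁻¹-natural {A} {B}
    }


Sq≃CoSh : ∀ {ℓ} (em : ExcludedMiddle ℓ) (K : Field ℓ) (P : FinitePoset ℓ) → Sq K P ≃ᶜ CoSh K P
Sq≃CoSh em K P = equivalence (toCosheaf em K P) (fromCosheaf em K P) (unitIsomorphism em K P) (counitIsomorphism em K P)

-- Duality between cosheaves and sheaves

module _ {ℓ : Level} (K : Field ℓ) (P : FinitePoset ℓ) where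

  open FinitePoset P
  open IsPartialOrder isPartialOrder using () renaming (antisym to ≤-antisym)
  open LinearMap using (⟦_⟧; ⟦⟧-cong)
  private
    module K = Field K

  module _ (S : Sheaf K P) where
    open Sheaf S
    private
      module S σ = LeftModule (stalk σ)

      -- Sheaves restrict along τ < σ only, while cosheaves extend along σ ≤ τ; the identity fills
      -- in the diagonal.
      resAt : ∀ {σ τ} → Dec (τ ≡ σ) → .(τ ≤ σ) → LinearMap (stalk σ) (stalk τ)
      resAt (yes ≡.refl) _   = idₗ
      resAt (no τ≢σ)     τ≤σ = res (τ≤σ , τ≢σ)

      resAt-∘ : ∀ {σ τ ρ} (τ? : Dec (τ ≡ σ)) (ρ? : Dec (ρ ≡ τ)) (ρ?′ : Dec (ρ ≡ σ)) →
        .(τ≤σ : τ ≤ σ) .(ρ≤τ : ρ ≤ τ) .(ρ≤σ : ρ ≤ σ) → ∀ x →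
        S._≈ᴹ_ ρ (⟦ resAt ρ? ρ≤τ ⟧ (⟦ resAt τ? τ≤σ ⟧ x)) (⟦ resAt ρ?′ ρ≤σ ⟧ x)
      resAt-∘ (yes ≡.refl) (yes ≡.refl) (yes ≡.refl) _ _ _ x = S.≈ᴹ-refl _
      resAt-∘ (yes ≡.refl) (yes ≡.refl) (no σ≢σ)     _ _ _ x = ⊥-elim (σ≢σ ≡.refl)
      resAt-∘ (yes ≡.refl) (no ρ≢σ)     (yes ρ≡σ)    _ _ _ x = ⊥-elim (ρ≢σ ρ≡σ)
      resAt-∘ (yes ≡.refl) (no _)       (no _)       _ _ _ x = S.≈ᴹ-refl _
      resAt-∘ (no τ≢σ)     (yes ≡.refl) (yes τ≡σ)    _ _ _ x = ⊥-elim (τ≢σ τ≡σ)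
      resAt-∘ (no _)       (yes ≡.refl) (no _)       _ _ _ x = S.≈ᴹ-refl _
      -- Two strict steps cannot return to σ, by antisymmetry; the order proofs are irrelevant, so
      -- the contradiction has to be eliminated irrelevantly.
      resAt-∘ (no τ≢σ)     (no _)       (yes ≡.refl) τ≤σ σ≤τ _ x = ⊥-elim-irr (τ≢σ (≤-antisym τ≤σ σ≤τ))
      resAt-∘ (no τ≢σ)     (no ρ≢τ)     (no ρ≢σ)     τ≤σ ρ≤τ ρ≤σ x = res-∘ (τ≤σ , τ≢σ) (ρ≤τ , ρ≢τ) (ρ≤σ , ρ≢σ) x

      resAt-id : ∀ {σ} (σ? : Dec (σ ≡ σ)) .(σ≤σ : σ ≤ σ) x → S._≈ᴹ_ σ (⟦ resAt σ? σ≤σ ⟧ x) x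
      resAt-id (yes ≡.refl) _ x = S.≈ᴹ-refl _
      resAt-id (no σ≢σ)     _ x = ⊥-elim (σ≢σ ≡.refl)

      resAt-< : ∀ {σ τ} (τ? : Dec (τ ≡ σ)) .(τ<σ : τ < σ) x → S._≈ᴹ_ τ (⟦ resAt τ? (proj₁ τ<σ) ⟧ x) (⟦ res τ<σ ⟧ x)
      resAt-< (yes ≡.refl) τ<σ x = ⊥-elim-irr (proj₂ τ<σ ≡.refl)
      resAt-< (no _)       τ<σ x = S.≈ᴹ-refl _

    res≤ : ∀ {σ τ} → .(τ ≤ σ) → LinearMap (stalk σ) (stalk τ)
    res≤ {σ} {τ} τ≤σ = resAt (τ ≟ σ) τ≤σ

    res≤-id : ∀ {σ} .(σ≤σ : σ ≤ σ) x → S._≈ᴹ_ σ (⟦ res≤ σ≤σ ⟧ x) x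
    res≤-id {σ} = resAt-id (σ ≟ σ)

    res≤-∘ : ∀ {σ τ ρ} .(τ≤σ : τ ≤ σ) .(ρ≤τ : ρ ≤ τ) .(ρ≤σ : ρ ≤ σ) x →
             S._≈ᴹ_ ρ (⟦ res≤ ρ≤τ ⟧ (⟦ res≤ τ≤σ ⟧ x)) (⟦ res≤ ρ≤σ ⟧ x)
    res≤-∘ {σ} {τ} {ρ} = resAt-∘ (τ ≟ σ) (ρ ≟ τ) (ρ ≟ σ)

    res≤-< : ∀ {σ τ} .(τ<σ : τ < σ) x → S._≈ᴹ_ τ (⟦ res≤ (proj₁ τ<σ) ⟧ x) (⟦ res τ<σ ⟧ x)
    res≤-< {σ} {τ} = resAt-< (τ ≟ σ)

  res≤-natural : ∀ {S T : Sheaf K P} (f : SheafHom K P S T) {σ τ} .(τ≤σ : τ ≤ σ) x → let open SheafHom f in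
    LeftModule._≈ᴹ_ (Sheaf.stalk T τ) (⟦ at τ ⟧ (⟦ res≤ S τ≤σ ⟧ x)) (⟦ res≤ T τ≤σ ⟧ (⟦ at σ ⟧ x))
  res≤-natural {S} {T} f {σ} {τ} τ≤σ x with τ ≟ σ
  ... | yes ≡.refl = LeftModule.≈ᴹ-refl (Sheaf.stalk T τ)
  ... | no τ≢σ     = SheafHom.natural f (τ≤σ , τ≢σ) x

  dualSheaf : Cosheaf K P → Sheaf K P
  dualSheaf W = record
    { stalk             = λ σ → Dual K (stalk σ)
    ; finiteDimensional = λ σ → Dual-finiteDimensional K (stalk σ) (finiteDimensional σ)
    ; res               = λ τ<σ → transpose K (ext (proj₁ τ<σ))
    ; res-∘             = λ τ<σ ρ<τ ρ<σ f x → ⟦⟧-cong f (ext-∘ (proj₁ ρ<τ) (proj₁ τ<σ) (proj₁ ρ<σ) x)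
    }
    where open Cosheaf W

  dualSheaf-res≤ : ∀ W {σ τ} .(τ≤σ : τ ≤ σ) f x →
    ⟦ ⟦ res≤ (dualSheaf W) τ≤σ ⟧ f ⟧ x K.≈ ⟦ f ⟧ (⟦ Cosheaf.ext W τ≤σ ⟧ x)
  dualSheaf-res≤ W {σ} {τ} τ≤σ f x with τ ≟ σ
  ... | yes ≡.refl = ⟦⟧-cong f (LeftModule.≈ᴹ-sym (Cosheaf.stalk W σ) (Cosheaf.ext-id W τ≤σ x))
  ... | no _       = K.refl

  dualCosheaf : Sheaf K P → Cosheaf K P
  Cosheaf.stalk             (dualCosheaf S) σ   = Dual K (Sheaf.stalk S σ)
  Cosheaf.finiteDimensional (dualCosheaf S) σ   = Dual-finiteDimensional K (Sheaf.stalk S σ) (Sheaf.finiteDimensional S σ)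
  Cosheaf.ext               (dualCosheaf S) σ≤τ = transpose K (res≤ S σ≤τ)
  Cosheaf.ext-id            (dualCosheaf S) σ≤σ f x = ⟦⟧-cong f (res≤-id S σ≤σ x)
  Cosheaf.ext-∘             (dualCosheaf S) σ≤τ τ≤ρ σ≤ρ f x = ⟦⟧-cong f (res≤-∘ S τ≤ρ σ≤τ σ≤ρ x)

  toSheaf : Functor (CoSh K P) (Sh K P ᵒᵖ)
  toSheaf = record
    { F₀     = dualSheaf
    ; F₁     = λ {A} {B} φ → record
      { at      = λ σ → transpose K (CosheafHom.at φ σ)
      ; natural = λ {σ} τ<σ f x → ⟦⟧-cong f (LeftModule.≈ᴹ-sym (Cosheaf.stalk B σ) (CosheafHom.natural φ (proj₁ τ<σ) x))
      }
    ; F-cong = λ φ≈ψ σ f x → ⟦⟧-cong f (φ≈ψ σ x)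
    ; F-id   = λ σ f x → K.refl
    ; F-⊚    = λ φ ψ σ f x → K.refl
    }

  toDualCosheaf : Functor (Sh K P ᵒᵖ) (CoSh K P)
  toDualCosheaf = record
    { F₀     = dualCosheaf
    ; F₁     = λ {A} {B} f → record
      { at      = λ σ → transpose K (SheafHom.at f σ)
      ; natural = λ {σ} σ≤τ g x → ⟦⟧-cong g (LeftModule.≈ᴹ-sym (Sheaf.stalk A σ) (res≤-natural {B} {A} f σ≤τ x))
      }
    ; F-cong = λ f≈g σ h x → ⟦⟧-cong h (f≈g σ x)
    ; F-id   = λ σ f x → K.refl
    ; F-⊚    = λ f g σ h x → K.refl
    }

  module CosheafBidual (W : Cosheaf K P) where
    open Cosheaf W
    W** = dualCosheaf (dualSheaf W)

    fromBidual-evaluates : ∀ σ ξ f → ⟦ f ⟧ (⟦ fromBidual K (stalk σ) (finiteDimensional σ) ⟧ ξ) K.≈ ⟦ ξ ⟧ f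
    fromBidual-evaluates σ = representative-evaluates K (stalk σ) (finiteDimensional σ)

    injective : ∀ σ {x y} → (∀ f → ⟦ f ⟧ x K.≈ ⟦ f ⟧ y) → LeftModule._≈ᴹ_ (stalk σ) x y
    injective σ = toBidual-injective K (stalk σ) (finiteDimensional σ)

    toW** : CosheafHom K P W W**
    toW** = record
      { at      = λ σ → toBidual K {stalk σ}
      ; natural = λ σ≤τ x f → K.sym (dualSheaf-res≤ W σ≤τ f x)
      }

    fromW** : CosheafHom K P W** W
    fromW** = record
      { at      = λ σ → fromBidual K (stalk σ) (finiteDimensional σ)
      -- Vectors of a finite-dimensional stalk are compared through all functionals, which turns the
      -- claim into the known behaviour of the dual restriction maps.
      ; natural = λ {σ} {τ} σ≤τ ξ → injective τ λ f →
          K.trans (fromBidual-evaluates τ (⟦ Cosheaf.ext W** σ≤τ ⟧ ξ) f)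
            (K.trans (K.sym (fromBidual-evaluates σ ξ (⟦ res≤ (dualSheaf W) σ≤τ ⟧ f)))
              (dualSheaf-res≤ W σ≤τ f (⟦ fromBidual K (stalk σ) (finiteDimensional σ) ⟧ ξ)))
      }

  module SheafBidual (S : Sheaf K P) where
    open Sheaf S
    S** = dualSheaf (dualCosheaf S)

    fromBidual-evaluates : ∀ σ ξ f → ⟦ f ⟧ (⟦ fromBidual K (stalk σ) (finiteDimensional σ) ⟧ ξ) K.≈ ⟦ ξ ⟧ f
    fromBidual-evaluates σ = representative-evaluates K (stalk σ) (finiteDimensional σ)

    injective : ∀ σ {x y} → (∀ f → ⟦ f ⟧ x K.≈ ⟦ f ⟧ y) → LeftModule._≈ᴹ_ (stalk σ) x y
    injective σ = toBidual-injective K (stalk σ) (finiteDimensional σ)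

    toS** : SheafHom K P S S**
    toS** = record
      { at      = λ σ → toBidual K {stalk σ}
      ; natural = λ {σ} {τ} τ<σ x f → ⟦⟧-cong f (LeftModule.≈ᴹ-sym (stalk τ) (res≤-< S τ<σ x))
      }

    fromS** : SheafHom K P S** S
    fromS** = record
      { at      = λ σ → fromBidual K (stalk σ) (finiteDimensional σ)
      ; natural = λ {σ} {τ} τ<σ ξ → injective τ λ f →
          K.trans (fromBidual-evaluates τ (⟦ Sheaf.res S** τ<σ ⟧ ξ) f)
            (K.trans (K.sym (fromBidual-evaluates σ ξ (⟦ transpose K (res≤ S (proj₁ τ<σ)) ⟧ f)))
              (⟦⟧-cong f (res≤-< S τ<σ (⟦ fromBidual K (stalk σ) (finiteDimensional σ) ⟧ ξ))))
      }

module _ {ℓ : Level} (K : Field ℓ) (P : FinitePoset ℓ) where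

  open LinearMap using (⟦_⟧)
  private
    module K = Field K

  cosheafBidual : NaturalIsomorphism (toDualCosheaf K P ∘ᶠ toSheaf K P) (Idᶠ (CoSh K P))
  cosheafBidual = record
    { to       = CosheafBidual.fromW** K P
    ; from     = CosheafBidual.toW** K P
    ; inverseˡ = λ W σ x → CosheafBidual.injective K P W σ (CosheafBidual.fromBidual-evaluates K P W σ (evaluate K x))
    ; inverseʳ = λ W σ ξ f → CosheafBidual.fromBidual-evaluates K P W σ ξ f
    ; natural  = λ {A} {B} φ σ ξ → CosheafBidual.injective K P B σ λ f →
        K.trans (CosheafBidual.fromBidual-evaluates K P B σ (⟦ transpose K (transpose K (CosheafHom.at φ σ)) ⟧ ξ) f)
          (K.sym (CosheafBidual.fromBidual-evaluates K P A σ ξ (f ∘ₗ CosheafHom.at φ σ)))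
    }

  private
    module Shᵒᵖ = Category (Sh K P ᵒᵖ)
    module D = Functor (toSheaf K P ∘ᶠ toDualCosheaf K P)

    -- In the opposite category an arrow from the double dual to `S` is a sheaf map from `S` to its
    -- double dual, hence the evaluation maps.
    to : ∀ S → Shᵒᵖ.Hom (D.F₀ S) S
    to S = SheafBidual.toS** K P S

    from : ∀ S → Shᵒᵖ.Hom S (D.F₀ S)
    from S = SheafBidual.fromS** K P S

    to-from : ∀ S → Shᵒᵖ._≈_ {S} {S} (Shᵒᵖ._⊚_ {S} {D.F₀ S} {S} (to S) (from S)) (Shᵒᵖ.id {S})
    to-from S σ x = SheafBidual.injective K P S σ (SheafBidual.fromBidual-evaluates K P S σ (evaluate K x))

    from-to : ∀ S → Shᵒᵖ._≈_ {D.F₀ S} {D.F₀ S} (Shᵒᵖ._⊚_ {D.F₀ S} {S} {D.F₀ S} (from S) (to S)) (Shᵒᵖ.id {D.F₀ S})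
    from-to S σ ξ f = SheafBidual.fromBidual-evaluates K P S σ ξ f

    to-natural : ∀ {S T} (f : Shᵒᵖ.Hom S T) →
      Shᵒᵖ._≈_ {D.F₀ S} {T} (Shᵒᵖ._⊚_ {D.F₀ S} {D.F₀ T} {T} (to T) (D.F₁ {S} {T} f)) (Shᵒᵖ._⊚_ {D.F₀ S} {S} {T} f (to S))
    to-natural f σ x g = K.refl {⟦ g ⟧ (⟦ SheafHom.at f σ ⟧ x)}

  sheafBidual : NaturalIsomorphism (toSheaf K P ∘ᶠ toDualCosheaf K P) (Idᶠ (Sh K P ᵒᵖ))
  sheafBidual = record { to = to ; from = from ; inverseˡ = to-from ; inverseʳ = from-to ; natural = λ {S} {T} → to-natural {S} {T} }

CoSh≃Sh : ∀ {ℓ} (K : Field ℓ) (P : FinitePoset ℓ) → CoSh K P ≃ᶜ Sh K P ᵒᵖ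
CoSh≃Sh K P = equivalence (toSheaf K P) (toDualCosheaf K P) (cosheafBidual K P) (sheafBidual K P)

proposition4p5 : ∀ {ℓ} → ExcludedMiddle ℓ → (K : Field ℓ) (P : FinitePoset ℓ) → IsQuasiCW K P → Sq K P ≃ᶜ Sh K P ᵒᵖ
proposition4p5 em K P _ = ≃ᶜ-trans (Sq≃CoSh em K P) (CoSh≃Sh K P)
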